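{- Let $n_1 \geq 3$ and $m_2 \geq 1$ be integers such that, with $j=j_{n_1,m_2}$, $k=k_{n_1,m_2}$ and $r=r_{n_1,m_2}$ as in the context, $k=0$ and $j = \lfloor (m_2-1)/2 \rfloor$. Let $\epsilon = 2^{m_2-1}$ if $m_2$ is even and $m_2 \geq 4$, and $\epsilon = 2^{m_2-1}-1$ if $m_2$ is odd or $m_2 = 2$. Then for all sufficiently large $m_1$ and all positive integers $n_2$, the graph $K_{m_1(n_1), m_2(n_2)}$ has a distinguishing partition if and only if $n_2 \leq r m_1 + \epsilon$.
   Context: $K_{m_1(n_1),m_2(n_2)}$ denotes the complete multipartite graph whose parts are $m_1$ sets of size $n_1$ and $m_2$ sets of size $n_2$. For a graph $X$ with automorphism group $\mathrm{aut}(X)$ and a partition $P=\{P_1,\dots,P_t\}$ of $V(X)$, put $\gamma(P)=\{\gamma(P_1),\dots,\gamma(P_t)\}$; $P$ is a distinguishing partition if $\gamma(P)\neq P$ for every nontrivial $\gamma\in\mathrm{aut}(X)$. For $n_1 \geq 3$, $j=j_{n_1,m_2}\ge0$ and $k=k_{n_1,m_2}\ge0$ are the integers with $n_1 = 2 + \sum_{i=0}^{j}\binom{m_2}{i} + k$ and either ($j < \lfloor (m_2-1)/2 \rfloor$ and $0 \leq k < \binom{m_2}{j+1}$) or ($j = \lfloor (m_2-1)/2 \rfloor$ and $k \geq 0$). If $j < \lfloor (m_2-1)/2 \rfloor$, $r = 1 + \sum_{i=0}^{j}\frac{m_2-i}{m_2}\binom{m_2}{i} + \frac{m_2 - j - 1}{m_2}k$;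 otherwise $r = 1 + \sum_{i=0}^{j}\frac{m_2-i}{m_2}\binom{m_2}{i} + \frac{k}{2}$. -}

module Defs where

open import Data.Nat using (ℕ; zero; suc; _+_; _*_; _∸_; _^_; _≤_; _<_; _/_)
open import Data.Nat.Combinatorics using (_C_)
open import Data.Bool using (Bool; true; false; if_then_else_; _∧_)
open import Data.Nat.Base using (_≡ᵇ_; _≤ᵇ_; _%_)
open import Data.Fin using (Fin)
open import Data.Product using (_×_; _,_; Σ; ∃)
open import Data.Sum using (_⊎_; inj₁; inj₂)
open import Data.Integer using (+_)
open import Data.Rational as ℚ using (ℚ)
open import Function.Bundles using (_↔_; Inverse; _⇔_)
open import Relation.Binary.PropositionalEquality using (_≡_; _≢_)
open import Relation.Nullary using (¬_)

sumTo : (ℕ → ℕ) → ℕ → ℕ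
sumTo f zero    = f 0
sumTo f (suc j) = sumTo f j + f (suc j)

sumToℚ : (ℕ → ℚ) → ℕ → ℚ
sumToℚ f zero    = f 0
sumToℚ f (suc j) = sumToℚ f j ℚ.+ f (suc j)

-- a / b as a rational (b = 0 never occurs in our uses since m₂ ≥ 1)
frac : ℕ → ℕ → ℚ
frac a zero    = ℚ.0ℚ
frac a (suc b) = (+ a) ℚ./ suc b

jmax : ℕ → ℕ
jmax m₂ = (m₂ ∸ 1) / 2

IsJK : (n₁ m₂ j k : ℕ) → Set
IsJK n₁ m₂ j k =
  n₁ ≡ 2 + sumTo (λ i → m₂ C i) j + k
  × ((j < jmax m₂ × k < m₂ C (suc j)) ⊎ j ≡ jmax m₂)

rJK : (m₂ j k : ℕ) → ℚ
rJK m₂ j k =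
  ℚ.1ℚ ℚ.+ sumToℚ (λ i → frac ((m₂ ∸ i) * (m₂ C i)) m₂) j ℚ.+ lastTerm
  where
  lastTerm : ℚ
  lastTerm = if suc j ≤ᵇ jmax m₂ then frac ((m₂ ∸ j ∸ 1) * k) m₂ else frac k 2

eps : ℕ → ℕ
eps m₂ = if ((m₂ % 2) ≡ᵇ 0) ∧ (4 ≤ᵇ m₂) then 2 ^ (m₂ ∸ 1) else 2 ^ (m₂ ∸ 1) ∸ 1

record Graph : Set₁ where
  field
    V   : Set
    Adj : V → V → Set

record Aut (X : Graph) : Set where
  open Graph X
  field
    perm     : V ↔ V
    preserve : ∀ x y → Adj x y ⇔ Adj (Inverse.to perm x) (Inverse.to perm y)

Nontrivial : {X : Graph} → Aut X → Set
Nontrivial {X} γ = ¬ (∀ (v : Graph.V X) → Inverse.to (Aut.perm γ) v ≡ v)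

-- A partition of V(X) is given by a block-labelling c : V → ℕ;
-- its blocks are the nonempty fibres of c.
Partition : Graph → Set
Partition X = Graph.V X → ℕ

-- γ(P) = P : γ maps blocks onto blocks, i.e. x, y lie in the same block
-- iff γ x, γ y lie in the same block
FixesPartition : {X : Graph} → Aut X → Partition X → Set
FixesPartition {X} γ c =
  ∀ x y → (c x ≡ c y) ⇔ (c (Inverse.to (Aut.perm γ) x) ≡ c (Inverse.to (Aut.perm γ) y))

IsDistinguishing : (X : Graph) → Partition X → Set
IsDistinguishing X P = (γ : Aut X) → Nontrivial γ → ¬ FixesPartition γ P

HasDistinguishingPartition : Graph → Set
HasDistinguishingPartition X = Σ (Partition X) (IsDistinguishing X)

partOf : {m₁ n₁ m₂ n₂ : ℕ} → (Fin m₁ × Fin n₁) ⊎ (Fin m₂ × Fin n₂) → Fin m₁ ⊎ Fin m₂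
partOf (inj₁ (a , _)) = inj₁ a
partOf (inj₂ (b , _)) = inj₂ b

K : (m₁ n₁ m₂ n₂ : ℕ) → Graph
K m₁ n₁ m₂ n₂ = record
  { V   = (Fin m₁ × Fin n₁) ⊎ (Fin m₂ × Fin n₂)
  ; Adj = λ x y → partOf {m₁} {n₁} {m₂} {n₂} x ≢ partOf {m₁} {n₁} {m₂} {n₂} y
  }

-- A partition is distinguishing iff every block meets every part at most once, different blocks meet
-- different sets of parts, and no nontrivial permutation of the parts preserves the resulting hypergraph.
-- Write a block as X ∪ S, with X a set of small parts (those of size n₁) and S a set of large ones.
--
-- Upper bound.  Share the block X ∪ S among its vertices in small parts: each of them receives 2|S| if
-- |X| = 1 and |S| otherwise, so every vertex of a large part outside the blocks X = ∅ is counted at least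
-- twice.  Since a small part lies in at most one block {a} ∪ S for each S, it receives at most
-- n₁ m₂ + Σ_S max(2|S| − m₂, 0) = 2 m₂ r, and the blocks X = ∅ cover a large part at most 2^(m₂−1) times.
-- If n₂ = r m₁ + 2^(m₂−1), every block is ∅ ∪ S, {a} ∪ S with 2|S| ≥ m₂, or {a, a′} ∪ (all large parts).
-- For odd m₂ ≥ 3 any two large parts can then be exchanged; for m₂ ≤ 2 the last two kinds of blocks link
-- the small parts into paths and cycles, one of which can be reversed or rotated.
--
-- Existence.  Start from an asymmetric arrangement of the small parts on a path or a cycle whose edges
-- {a, a′} may or may not be joined to all large parts, add all blocks ∅ ∪ S and all {a} ∪ S with |S| > m₂/2,
-- and lower n₂ by merging the latter for many a at once.  Small n₂ need a separate, sparser arrangement.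

module Submission where

open import Defs
open import Data.Bool using (Bool; true; false; not; _∧_; _∨_; if_then_else_)
import Data.Bool.Properties as Bool
open import Data.Empty using (⊥; ⊥-elim)
open import Data.Fin as Fin using (Fin; zero; suc; toℕ; fromℕ<; cast; splitAt)
import Data.Fin.Properties as Fin
import Data.Integer as ℤ
import Data.Integer.Properties as ℤ
open import Data.List as List using (List; []; _∷_; _++_; map; concat; tabulate; length; cartesianProduct; filterᵇ)
open import Data.List.Membership.Propositional using (_∈_; _∉_)
import Data.List.Membership.Propositional.Properties as ∈
open import Data.List.Relation.Unary.Any as Any using (here; there)
import Data.List.Relation.Unary.Any.Properties as Any
open import Data.List.Relation.Unary.All as All using ([]; _∷_)
import Data.List.Relation.Unary.All.Properties as All
open import Data.List.Relation.Unary.AllPairs as AllPairs using ([]; _∷_)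
import Data.List.Relation.Unary.AllPairs.Properties as AllPairs
open import Data.List.Relation.Unary.Unique.Propositional using (Unique)
import Data.List.Relation.Unary.Unique.Propositional.Properties as Unique
open import Data.List.Relation.Binary.Disjoint.Propositional using (Disjoint)
open import Data.Nat
open import Data.Nat.Combinatorics using (_C_; nC1≡n; nCk+nC[k+1]≡[n+1]C[k+1])
import Data.Nat.Divisibility as Divisibility
import Data.Nat.DivMod as DivMod
open import Data.Nat.Properties
open import Data.Nat.Tactic.RingSolver using (solve-∀)
open import Data.Product using (Σ; ∃; _×_; _,_; proj₁; proj₂)
open import Data.Product.Properties using (,-injectiveˡ; ,-injectiveʳ)
open import Data.Rational as ℚ using (ℚ)
import Data.Rational.Properties as ℚ
import Data.Product.Properties as Product
import Data.Sum as Sum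
import Data.Sum.Properties as Sum
open import Data.Sum using (_⊎_; inj₁; inj₂; [_,_]′)
open import Data.Sum.Properties using (inj₁-injective; inj₂-injective)
open import Data.Vec as Vec using (Vec; []; _∷_; lookup)
import Data.Vec.Properties as Vec
open import Function using (_∘_; id; case_of_)
open import Data.Fin.Permutation using (Permutation; _⟨$⟩ʳ_)
open import Function.Bundles using (_⇔_; Inverse; Equivalence; mk⇔; mk↔ₛ′)
open import Relation.Binary.PropositionalEquality
open import Relation.Nullary using (¬_; Dec; yes; no; does; contradiction)
open import Relation.Nullary.Decidable using (dec-true; dec-false; ¬?; _×-dec_; decidable-stable)
import Algebra.Properties.Semiring.Sum +-*-semiring as FinSum
open import Relation.Binary.Definitions using (Tri; tri<; tri≈; tri>)
import Data.Rational.Unnormalised as ℚᵘ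
import Data.Rational.Unnormalised.Properties as ℚᵘ

-- As (m₂ - i)/m₂ · C(m₂, i) = C(m₂ - 1, i), the rational r is the integer D + 1, where D = Σ_{i ≤
-- j} C(m₂ - 1, i) counts the sets S with |S| > m₂/2 that contain a given large part. In all there
-- are N = n₁ - 2 sets S with |S| > m₂/2. A small part a that lies in a block {a} ∪ S for each of
-- them has exactly two vertices left, so the remaining blocks form paths and cycles through the
-- small parts. Existence must make them rigid, non-existence must move one. What rigidity costs
-- determines ε. Cutting a cycle yields blocks {a} ∪ S with |S| = ⌊m₂/2⌋. For even m₂ these lose
-- nothing against the bound. For odd m₂ each of the 2 m₂ blocks at the cuts is one unit short, in a
-- count where one vertex of every large part is worth 2 m₂ units, so n₂ drops by exactly 1. When n₁
-- = n₂, automorphisms can exchange small and large parts. Only small n₂ are affected, because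
-- beyond a constant n₂ exceeds n₁; the sparse arrangement recognises the small parts by its long
-- blocks.

ind : Bool → ℕ
ind true  = 1
ind false = 0

does-true : ∀ {P : Set} (d : Dec P) → does d ≡ true → P
does-true (yes p) _ = p

does-false : ∀ {P : Set} (d : Dec P) → does d ≡ false → ¬ P
does-false (no p) _ = p

ind≤1 : ∀ b → ind b ≤ 1
ind≤1 true  = ≤-refl
ind≤1 false = z≤n

ind-not : ∀ b → ind b + ind (not b) ≡ 1
ind-not true  = refl
ind-not false = refl

-- Sums over Fin

abstract
  ∑ : ∀ {n} → (Fin n → ℕ) → ℕ
  ∑ = FinSum.sum

  ∑-suc : ∀ {n} (f : Fin (suc n) → ℕ) → ∑ f ≡ f zero + ∑ (f ∘ suc)
  ∑-suc f = refl

  ∑-cong : ∀ {n} {f g : Fin n → ℕ} → (∀ i → f i ≡ g i) → ∑ f ≡ ∑ g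
  ∑-cong = FinSum.sum-cong-≗

  ∑-+ : ∀ {n} (f g : Fin n → ℕ) → ∑ (λ i → f i + g i) ≡ ∑ f + ∑ g
  ∑-+ = FinSum.∑-distrib-+

  ∑-swap : ∀ {m n} (f : Fin m → Fin n → ℕ) → ∑ (λ i → ∑ (f i)) ≡ ∑ (λ j → ∑ λ i → f i j)
  ∑-swap = FinSum.∑-comm

  ∑-*ˡ : ∀ {n} c (f : Fin n → ℕ) → ∑ (λ i → c * f i) ≡ c * ∑ f
  ∑-*ˡ c f = sym (FinSum.*-distribˡ-sum c f)

  ∑-*ʳ : ∀ {n} c (f : Fin n → ℕ) → ∑ (λ i → f i * c) ≡ ∑ f * c
  ∑-*ʳ c f = sym (FinSum.*-distribʳ-sum c f)

  ∑-permute : ∀ {m n} (f : Fin n → ℕ) (π : Permutation m n) → ∑ (λ i → f (π ⟨$⟩ʳ i)) ≡ ∑ f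
  ∑-permute f π = sym (FinSum.sum-permute f π)

  ∑-mono : ∀ {n} {f g : Fin n → ℕ} → (∀ i → f i ≤ g i) → ∑ f ≤ ∑ g
  ∑-mono {zero}  p = z≤n
  ∑-mono {suc n} p = +-mono-≤ (p zero) (∑-mono (p ∘ suc))

  -- Turns equality in a counting bound into equality of every single term; the analysis of extremal
  -- partitions rests on it.
  ∑-mono-≡ : ∀ {n} {f g : Fin n → ℕ} → (∀ i → f i ≤ g i) → ∑ g ≤ ∑ f → ∀ i → f i ≡ g i
  ∑-mono-≡ {suc n} {f} {g} p q zero = ≤-antisym (p zero) (+-cancelʳ-≤ (∑ (g ∘ suc)) _ _
    (≤-trans q (+-monoʳ-≤ (f zero) (∑-mono (p ∘ suc)))))
  ∑-mono-≡ {suc n} {f} {g} p q (suc i) = ∑-mono-≡ (p ∘ suc) (+-cancelˡ-≤ (f zero) _ _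
    (≤-trans (+-monoˡ-≤ _ (p zero)) q)) i

  ∑-const : ∀ n c → ∑ {n} (λ _ → c) ≡ n * c
  ∑-const zero    c = refl
  ∑-const (suc n) c = cong (c +_) (∑-const n c)

  ∑-zero : ∀ {n} {f : Fin n → ℕ} → (∀ i → f i ≡ 0) → ∑ f ≡ 0
  ∑-zero {zero}  p = refl
  ∑-zero {suc n} p = cong₂ _+_ (p zero) (∑-zero (p ∘ suc))

  term≤∑ : ∀ {n} (f : Fin n → ℕ) i → f i ≤ ∑ f
  term≤∑ f zero    = m≤m+n _ _
  term≤∑ f (suc i) = ≤-trans (term≤∑ (f ∘ suc) i) (m≤n+m _ _)

  two-terms≤∑ : ∀ {n} (f : Fin n → ℕ) {i j} → i ≢ j → f i + f j ≤ ∑ f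
  two-terms≤∑ f {zero}  {zero}  i≢j = contradiction refl i≢j
  two-terms≤∑ f {zero}  {suc j} i≢j = +-monoʳ-≤ (f zero) (term≤∑ (f ∘ suc) j)
  two-terms≤∑ f {suc i} {zero}  i≢j rewrite +-comm (f (suc i)) (f zero) = +-monoʳ-≤ (f zero) (term≤∑ (f ∘ suc) i)
  two-terms≤∑ f {suc i} {suc j} i≢j = ≤-trans (two-terms≤∑ (f ∘ suc) (i≢j ∘ cong suc)) (m≤n+m _ _)

  ∑-pos : ∀ {n} (f : Fin n → ℕ) → 1 ≤ ∑ f → ∃ λ i → 1 ≤ f i
  ∑-pos {suc n} f p with f zero in eq
  ... | suc k = zero , subst (1 ≤_) (sym eq) (s≤s z≤n)
  ... | zero  with i , q ← ∑-pos (f ∘ suc) p = suc i , q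

  ∑-single : ∀ {n} (f : Fin n → ℕ) i → (∀ j → j ≢ i → f j ≡ 0) → ∑ f ≡ f i
  ∑-single {suc n} f zero    p = trans (cong (f zero +_) (∑-zero λ j → p (suc j) λ ())) (+-identityʳ _)
  ∑-single {suc n} f (suc i) p rewrite p zero (λ ()) = ∑-single (f ∘ suc) i λ j j≢i → p (suc j) (j≢i ∘ Fin.suc-injective)

  ∑-split : ∀ m {n} (f : ℕ → ℕ) → ∑ {m + n} (f ∘ toℕ) ≡ ∑ {m} (f ∘ toℕ) + ∑ {n} (λ i → f (m + toℕ i))
  ∑-split zero    f = refl
  ∑-split (suc m) f = trans (cong (f 0 +_) (∑-split m (f ∘ suc))) (sym (+-assoc (f 0) _ _))

  ∑-last : ∀ n (f : ℕ → ℕ) → ∑ {suc n} (f ∘ toℕ) ≡ ∑ {n} (f ∘ toℕ) + f n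
  ∑-last zero    f = +-identityʳ (f 0)
  ∑-last (suc n) f = trans (cong (f 0 +_) (∑-last n (f ∘ suc))) (sym (+-assoc (f 0) _ _))

  ∑-point : ∀ {n k} → k < n → ∑ {n} (λ i → ind (does (toℕ i ≟ k))) ≡ 1
  ∑-point {suc n} {zero}  p = cong suc (∑-zero {n} λ _ → refl)
  ∑-point {suc n} {suc k} p = ∑-point {n} (s<s⁻¹ p)

  ∑-point′ : ∀ {n k} → k < n → ∑ {n} (λ i → ind (does (k ≟ toℕ i))) ≡ 1
  ∑-point′ {suc n} {zero}  p = cong suc (∑-zero {n} λ _ → refl)
  ∑-point′ {suc n} {suc k} p = ∑-point′ {n} (s<s⁻¹ p)

  ∑-below : ∀ {n} c → c ≤ n → ∑ {n} (λ i → ind (does (toℕ i <? c))) ≡ c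
  ∑-below {n}     zero    p = ∑-zero {n} λ _ → refl
  ∑-below {suc n} (suc c) p = cong suc (∑-below {n} c (s≤s⁻¹ p))

  ∑-above : ∀ {n} c → c ≤ n → ∑ {n} (λ i → ind (not (does (toℕ i <? c)))) ≡ n ∸ c
  ∑-above {n}     zero    p = trans (∑-const n 1) (*-identityʳ n)
  ∑-above {suc n} (suc c) p = ∑-above {n} c (s≤s⁻¹ p)

variable
  A B : Set

-- Sums over lists

sumL : (A → ℕ) → List A → ℕ
sumL f []       = 0
sumL f (x ∷ xs) = f x + sumL f xs

count : (A → Bool) → List A → ℕ
count p = sumL (ind ∘ p)

sumL-cong : {f g : A → ℕ} → (∀ x → f x ≡ g x) → ∀ xs → sumL f xs ≡ sumL g xs
sumL-cong p []       = refl
sumL-cong p (x ∷ xs) = cong₂ _+_ (p x) (sumL-cong p xs)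

sumL-mono : {f g : A → ℕ} → (∀ x → f x ≤ g x) → ∀ xs → sumL f xs ≤ sumL g xs
sumL-mono p []       = z≤n
sumL-mono p (x ∷ xs) = +-mono-≤ (p x) (sumL-mono p xs)

sumL-mono-≡ : {f g : A → ℕ} → (∀ x → f x ≤ g x) → ∀ xs → sumL g xs ≤ sumL f xs → ∀ {x} → x ∈ xs → f x ≡ g x
sumL-mono-≡ {f = f} {g} p (x ∷ xs) q (here refl) = ≤-antisym (p x) (+-cancelʳ-≤ (sumL g xs) _ _
  (≤-trans q (+-monoʳ-≤ (f x) (sumL-mono p xs))))
sumL-mono-≡ {f = f} {g} p (x ∷ xs) q (there m) = sumL-mono-≡ p xs (+-cancelˡ-≤ (f x) _ _
  (≤-trans (+-monoˡ-≤ _ (p x)) q)) m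

sumL-zero : {f : A → ℕ} → (∀ x → f x ≡ 0) → ∀ xs → sumL f xs ≡ 0
sumL-zero p []       = refl
sumL-zero p (x ∷ xs) rewrite p x = sumL-zero p xs

sumL-++ : (f : A → ℕ) → ∀ xs ys → sumL f (xs ++ ys) ≡ sumL f xs + sumL f ys
sumL-++ f []       ys = refl
sumL-++ f (x ∷ xs) ys = trans (cong (f x +_) (sumL-++ f xs ys)) (sym (+-assoc (f x) _ _))

sumL-map : (f : B → ℕ) (g : A → B) → ∀ xs → sumL f (map g xs) ≡ sumL (f ∘ g) xs
sumL-map f g []       = refl
sumL-map f g (x ∷ xs) = cong (f (g x) +_) (sumL-map f g xs)

sumL-+ : (f g : A → ℕ) → ∀ xs → sumL (λ x → f x + g x) xs ≡ sumL f xs + sumL g xs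
sumL-+ f g []       = refl
sumL-+ f g (x ∷ xs) = trans (cong (f x + g x +_) (sumL-+ f g xs)) (+-interchange (f x) (g x) (sumL f xs) (sumL g xs))
  where
  +-interchange : ∀ a b c d → a + b + (c + d) ≡ a + c + (b + d)
  +-interchange = solve-∀

sumL-*ˡ : ∀ c (f : A → ℕ) xs → sumL (λ x → c * f x) xs ≡ c * sumL f xs
sumL-*ˡ c f []       = sym (*-zeroʳ c)
sumL-*ˡ c f (x ∷ xs) = trans (cong (c * f x +_) (sumL-*ˡ c f xs)) (sym (*-distribˡ-+ c (f x) _))

sumL-*ʳ : ∀ c (f : A → ℕ) xs → sumL (λ x → f x * c) xs ≡ sumL f xs * c
sumL-*ʳ c f []       = refl
sumL-*ʳ c f (x ∷ xs) = trans (cong (f x * c +_) (sumL-*ʳ c f xs)) (sym (*-distribʳ-+ c (f x) _))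

abstract
  sumL-tabulate : ∀ {n} (f : A → ℕ) (g : Fin n → A) → sumL f (tabulate g) ≡ ∑ (f ∘ g)
  sumL-tabulate {n = zero}  f g = refl
  sumL-tabulate {n = suc n} f g = cong (f (g zero) +_) (sumL-tabulate f (g ∘ suc))

  sumL-concat-tabulate : ∀ {n} (f : A → ℕ) (g : Fin n → List A) →
    sumL f (concat (tabulate g)) ≡ ∑ (sumL f ∘ g)
  sumL-concat-tabulate {n = zero}  f g = refl
  sumL-concat-tabulate {n = suc n} f g =
    trans (sumL-++ f (g zero) _) (cong (sumL f (g zero) +_) (sumL-concat-tabulate f (g ∘ suc)))

sumL-× : (f : A → ℕ) (g : B → ℕ) → ∀ xs ys →
  sumL (λ e → f (proj₁ e) * g (proj₂ e)) (cartesianProduct xs ys) ≡ sumL f xs * sumL g ys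
sumL-× f g []       ys = refl
sumL-× f g (x ∷ xs) ys = trans (sumL-++ _ (map (x ,_) ys) _) (trans
  (cong₂ _+_ (trans (sumL-map _ (x ,_) ys) (sumL-*ˡ (f x) g ys)) (sumL-× f g xs ys))
  (sym (*-distribʳ-+ (sumL g ys) (f x) (sumL f xs))))

sumL-filter : (p : A → Bool) (f : A → ℕ) → ∀ xs → sumL f (filterᵇ p xs) ≡ sumL (λ x → ind (p x) * f x) xs
sumL-filter p f []       = refl
sumL-filter p f (x ∷ xs) with p x
... | true  = cong₂ _+_ (sym (+-identityʳ (f x))) (sumL-filter p f xs)
... | false = sumL-filter p f xs

abstract
  ∑-sumL : ∀ {n} (f : Fin n → A → ℕ) xs → ∑ (λ i → sumL (f i) xs) ≡ sumL (λ x → ∑ (λ i → f i x)) xs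
  ∑-sumL {n = n} f []       = ∑-zero {n} λ _ → refl
  ∑-sumL f (x ∷ xs) = trans (∑-+ (λ i → f i x) (λ i → sumL (f i) xs)) (cong (∑ (λ i → f i x) +_) (∑-sumL f xs))

-- Subsets of Fin m

card : ∀ {m} → Vec Bool m → ℕ
card S = ∑ (ind ∘ lookup S)

co : ∀ {m} → Vec Bool m → ℕ
co S = ∑ (ind ∘ not ∘ lookup S)

card+co : ∀ {m} (S : Vec Bool m) → card S + co S ≡ m
card+co {m} S = trans (sym (∑-+ (ind ∘ lookup S) (ind ∘ not ∘ lookup S)))
  (trans (∑-cong (ind-not ∘ lookup S)) (trans (∑-const m 1) (*-identityʳ m)))

card≤ : ∀ {m} (S : Vec Bool m) → card S ≤ m
card≤ S = subst (card S ≤_) (card+co S) (m≤m+n _ _)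

_≟S_ : ∀ {m} (S T : Vec Bool m) → Dec (S ≡ T)
_≟S_ = Vec.≡-dec Bool._≟_

subsets : ∀ m → List (Vec Bool m)
subsets zero    = [] ∷ []
subsets (suc m) = map (true ∷_) (subsets m) ++ map (false ∷_) (subsets m)

∈-subsets : ∀ {m} (S : Vec Bool m) → S ∈ subsets m
∈-subsets []                    = here refl
∈-subsets {suc m} (true  ∷ S) = ∈.∈-++⁺ˡ (∈.∈-map⁺ (true ∷_) (∈-subsets S))
∈-subsets {suc m} (false ∷ S) = ∈.∈-++⁺ʳ (map (true ∷_) (subsets m)) (∈.∈-map⁺ (false ∷_) (∈-subsets S))

subsets-Unique : ∀ m → Unique (subsets m)
subsets-Unique zero    = [] ∷ []
subsets-Unique (suc m) = Unique.++⁺ (Unique.map⁺ Vec.∷-injectiveʳ (subsets-Unique m))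
  (Unique.map⁺ Vec.∷-injectiveʳ (subsets-Unique m)) disj
  where
  disj : Disjoint (map (true ∷_) (subsets m)) (map (false ∷_) (subsets m))
  disj (p , q) with _ , _ , refl ← ∈.∈-map⁻ (true ∷_) p | _ , _ , () ← ∈.∈-map⁻ (false ∷_) q

sumL-subsets : ∀ {m} (f : Vec Bool (suc m) → ℕ) →
  sumL f (subsets (suc m)) ≡ sumL (f ∘ (true ∷_)) (subsets m) + sumL (f ∘ (false ∷_)) (subsets m)
sumL-subsets {m} f = trans (sumL-++ f (map (true ∷_) (subsets m)) _)
  (cong₂ _+_ (sumL-map f _ (subsets m)) (sumL-map f _ (subsets m)))

length-subsets : ∀ m → sumL (λ _ → 1) (subsets m) ≡ 2 ^ m
length-subsets zero    = refl
length-subsets (suc m) = trans (sumL-subsets {m} (λ _ → 1))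
  (trans (cong₂ _+_ (length-subsets m) (length-subsets m)) (cong (λ x → 2 ^ m + x) (sym (+-identityʳ (2 ^ m)))))

-- With `j = jmax m` and m ≥ 1 this selects the sets with more than half of the points: co S ≤ ⌊(m -
-- 1)/2⌋ means 2 · co S < m.
few : ∀ {m} → ℕ → Vec Bool m → Bool
few j S = does (co S <? suc j)

-- Pascal's rule applied to every summand. It mirrors the splitting of the subsets of m + 1 points
-- by their first point, where leaving that point out enlarges the complement by one.
sumTo-pascal : ∀ m j → sumTo (suc m C_) (suc j) ≡ sumTo (m C_) (suc j) + sumTo (m C_) j
sumTo-pascal m zero = refl′ where
  refl′ : 1 + suc m C 1 ≡ 1 + m C 1 + 1
  refl′ = trans (cong suc (trans (sym (nCk+nC[k+1]≡[n+1]C[k+1] m 0)) (+-comm 1 _))) refl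
sumTo-pascal m (suc j) = trans (cong₂ _+_ (sumTo-pascal m j) (sym (nCk+nC[k+1]≡[n+1]C[k+1] m (suc j))))
  (lemma (sumTo (m C_) j) (m C suc j) (sumTo (m C_) j) (m C suc (suc j)))
  where
  lemma : ∀ a b c d → a + b + c + (b + d) ≡ a + b + d + (c + b)
  lemma = solve-∀

sumTo-0C : ∀ j → sumTo (0 C_) j ≡ 1
sumTo-0C zero    = refl
sumTo-0C (suc j) = trans (+-identityʳ _) (sumTo-0C j)

abstract
  count-few : ∀ m j → count (few j) (subsets m) ≡ sumTo (m C_) j
  count-few zero    j = sym (sumTo-0C j)
  count-few (suc m) zero = trans (sumL-subsets {m} _) (trans (cong₂ _+_ (count-few m 0)
    (sumL-zero (λ _ → refl) (subsets m))) (+-identityʳ _))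
  count-few (suc m) (suc j) = trans (sumL-subsets {m} _) (trans (cong₂ _+_ (count-few m (suc j)) (count-few m j))
    (sym (sumTo-pascal m j)))

  -- Deleting `b` leaves the complement unchanged, so these sets correspond to the subsets of the
  -- other m points that miss at most j of them.
  count-few-∋ : ∀ {m} j (b : Fin (suc m)) →
    sumL (λ S → ind (few j S) * ind (lookup S b)) (subsets (suc m)) ≡ sumTo (m C_) j
  count-few-∋ {m} j zero = trans (sumL-subsets {m} _) (trans (cong₂ _+_
    (trans (sumL-cong (λ S → *-identityʳ _) (subsets m)) (count-few m j))
    (sumL-zero (λ S → *-zeroʳ (ind (few j (false ∷ S)))) (subsets m))) (+-identityʳ _))
  count-few-∋ {suc m} zero (suc b) = trans (sumL-subsets {suc m} _) (trans (cong₂ _+_ (count-few-∋ 0 b)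
    (sumL-zero (λ _ → refl) (subsets (suc m)))) (+-identityʳ _))
  count-few-∋ {suc m} (suc j) (suc b) = trans (sumL-subsets {suc m} _) (trans
    (cong₂ _+_ (count-few-∋ (suc j) b) (count-few-∋ j b)) (sym (sumTo-pascal m j)))

count-∋ : ∀ {m} (b : Fin (suc m)) → count (λ S → lookup S b) (subsets (suc m)) ≡ 2 ^ m
count-∋ {m} zero = trans (sumL-subsets {m} _) (trans (cong₂ _+_ (length-subsets m) (sumL-zero (λ _ → refl) (subsets m))) (+-identityʳ _))
count-∋ {suc m} (suc b) = trans (sumL-subsets {suc m} _) (trans (cong₂ _+_ (count-∋ b) (count-∋ b))
  (cong (λ x → 2 ^ m + x) (sym (+-identityʳ (2 ^ m)))))

-- Hypergraphs on the parts of K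

bool-ext : ∀ {a b} → (a ≡ true → b ≡ true) → (b ≡ true → a ≡ true) → a ≡ b
bool-ext {true}  {b}     p q = sym (p refl)
bool-ext {false} {true}  p q = q refl
bool-ext {false} {false} p q = refl

lookup-ext : ∀ {n} {S T : Vec Bool n} → (∀ i → lookup S i ≡ lookup T i) → S ≡ T
lookup-ext {S = S} {T} p = trans (sym (Vec.tabulate∘lookup S)) (trans (Vec.tabulate-cong p) (Vec.tabulate∘lookup T))

Part : ℕ → ℕ → Set
Part m₁ m₂ = Fin m₁ ⊎ Fin m₂

Edge : ℕ → ℕ → Set
Edge m₁ m₂ = Vec Bool m₁ × Vec Bool m₂

Vertex : (m₁ n₁ m₂ n₂ : ℕ) → Set
Vertex m₁ n₁ m₂ n₂ = (Fin m₁ × Fin n₁) ⊎ (Fin m₂ × Fin n₂)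

has : ∀ {m₁ m₂} → Edge m₁ m₂ → Part m₁ m₂ → Bool
has (X , S) (inj₁ a) = lookup X a
has (X , S) (inj₂ b) = lookup S b

edge-ext : ∀ {m₁ m₂} {e f : Edge m₁ m₂} → (∀ p → has e p ≡ has f p) → e ≡ f
edge-ext p = cong₂ _,_ (lookup-ext (p ∘ inj₁)) (lookup-ext (p ∘ inj₂))

_≟P_ : ∀ {m₁ m₂} (p q : Part m₁ m₂) → Dec (p ≡ q)
inj₁ a ≟P inj₁ b with a Fin.≟ b
... | yes refl = yes refl
... | no  a≢b  = no λ { refl → a≢b refl }
inj₂ a ≟P inj₂ b with a Fin.≟ b
... | yes refl = yes refl
... | no  a≢b  = no λ { refl → a≢b refl }
inj₁ a ≟P inj₂ b = no λ ()
inj₂ a ≟P inj₁ b = no λ ()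

anyPart? : ∀ {m₁ m₂} {P : Part m₁ m₂ → Set} → (∀ p → Dec (P p)) → Dec (∃ P)
anyPart? P? with Fin.any? (P? ∘ inj₁) | Fin.any? (P? ∘ inj₂)
... | yes (a , q) | _           = yes (inj₁ a , q)
... | no _        | yes (b , q) = yes (inj₂ b , q)
... | no ¬a       | no ¬b       = no λ { (inj₁ a , q) → ¬a (a , q) ; (inj₂ b , q) → ¬b (b , q) }

-- From a hypergraph to a distinguishing partition

size : ∀ {m₁ m₂} → ℕ → ℕ → Part m₁ m₂ → ℕ
size n₁ n₂ (inj₁ _) = n₁
size n₁ n₂ (inj₂ _) = n₂

pos : (p : A → Bool) (xs : List A) → Fin (count p xs) → Fin (length xs)
pos p (x ∷ xs) i with p x
pos p (x ∷ xs) zero    | true  = zero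
pos p (x ∷ xs) (suc i) | true  = suc (pos p xs i)
pos p (x ∷ xs) i       | false = suc (pos p xs i)

pos-sound : (p : A → Bool) (xs : List A) → ∀ i → p (List.lookup xs (pos p xs i)) ≡ true
pos-sound p (x ∷ xs) i with p x in eq
pos-sound p (x ∷ xs) zero    | true  = eq
pos-sound p (x ∷ xs) (suc i) | true  = pos-sound p xs i
pos-sound p (x ∷ xs) i       | false = pos-sound p xs i

pos-injective : (p : A → Bool) (xs : List A) → ∀ {i j} → pos p xs i ≡ pos p xs j → i ≡ j
pos-injective p (x ∷ xs) {i} {j} eq with p x
pos-injective p (x ∷ xs) {zero}  {zero}  eq | true  = refl
pos-injective p (x ∷ xs) {suc i} {suc j} eq | true  = cong suc (pos-injective p xs (Fin.suc-injective eq))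
pos-injective p (x ∷ xs) {i}     {j}     eq | false = pos-injective p xs (Fin.suc-injective eq)

pos-surjective : (p : A → Bool) (xs : List A) → ∀ k → p (List.lookup xs k) ≡ true → ∃ λ i → pos p xs i ≡ k
pos-surjective p (x ∷ xs) k q with p x in eq
pos-surjective p (x ∷ xs) zero    q | true = zero , refl
pos-surjective p (x ∷ xs) (suc k) q | true with i , r ← pos-surjective p xs k q = suc i , cong suc r
pos-surjective p (x ∷ xs) zero    q | false with () ← trans (sym q) eq
pos-surjective p (x ∷ xs) (suc k) q | false with i , r ← pos-surjective p xs k q = i , cong suc r

Unique⇒lookup-injective : {xs : List A} → Unique xs → ∀ {i j} → List.lookup xs i ≡ List.lookup xs j → i ≡ j
Unique⇒lookup-injective (x≢ ∷ u) {zero}  {zero}  eq = refl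
Unique⇒lookup-injective (x≢ ∷ u) {zero}  {suc j} eq = contradiction eq (All.lookup x≢ (∈.∈-lookup j))
Unique⇒lookup-injective (x≢ ∷ u) {suc i} {zero}  eq = contradiction (sym eq) (All.lookup x≢ (∈.∈-lookup i))
Unique⇒lookup-injective (x≢ ∷ u) {suc i} {suc j} eq = cong suc (Unique⇒lookup-injective u eq)

Preserves : ∀ {m₁ m₂} → List (Edge m₁ m₂) → (Part m₁ m₂ → Part m₁ m₂) → Set
Preserves es π = ∀ {e} → e ∈ es → ∃ λ e′ → e′ ∈ es × (∀ p → has e′ (π p) ≡ has e p)

-- `π` may mix small and large parts: for n₁ = n₂ the graph has such automorphisms, and for n₁ ≠ n₂
-- `π-size` excludes them.
record Symmetry {m₁ m₂} (n₁ n₂ : ℕ) (es : List (Edge m₁ m₂)) : Set where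
  field
    π π⁻     : Part m₁ m₂ → Part m₁ m₂
    ππ⁻      : ∀ p → π (π⁻ p) ≡ p
    π⁻π      : ∀ p → π⁻ (π p) ≡ p
    π-size   : ∀ p → size n₁ n₂ (π p) ≡ size n₁ n₂ p
    π-pres   : Preserves es π
    π⁻-pres  : Preserves es π⁻

flip-Symmetry : ∀ {m₁ m₂ n₁ n₂} {es : List (Edge m₁ m₂)} → Symmetry n₁ n₂ es → Symmetry n₁ n₂ es
flip-Symmetry {n₁ = n₁} {n₂} s = record
  { π = π⁻ ; π⁻ = π ; ππ⁻ = π⁻π ; π⁻π = ππ⁻
  ; π-size = λ p → trans (sym (π-size (π⁻ p))) (cong (size n₁ n₂) (ππ⁻ p))
  ; π-pres = π⁻-pres ; π⁻-pres = π-pres }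
  where open Symmetry s

module Points {m₁ n₁ m₂ n₂ : ℕ} where
  pt : (p : Part m₁ m₂) → Fin (size n₁ n₂ p) → Vertex m₁ n₁ m₂ n₂
  pt (inj₁ a) i = inj₁ (a , i)
  pt (inj₂ b) j = inj₂ (b , j)

  partOf-pt : ∀ p i → partOf (pt p i) ≡ p
  partOf-pt (inj₁ a) i = refl
  partOf-pt (inj₂ b) i = refl

  index : (x : Vertex m₁ n₁ m₂ n₂) {p : Part m₁ m₂} → partOf x ≡ p → Fin (size n₁ n₂ p)
  index (inj₁ (a , i)) refl = i
  index (inj₂ (b , j)) refl = j

  pt-index : ∀ x {p} (q : partOf x ≡ p) → pt p (index x q) ≡ x
  pt-index (inj₁ (a , i)) refl = refl
  pt-index (inj₂ (b , j)) refl = refl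

  index-pt : ∀ p i (q : partOf (pt p i) ≡ p) → index (pt p i) q ≡ i
  index-pt (inj₁ a) i refl = refl
  index-pt (inj₂ b) i refl = refl

  ¬adj⇒part : ∀ {x y : Vertex m₁ n₁ m₂ n₂} → ¬ (partOf x ≢ partOf y) → partOf x ≡ partOf y
  ¬adj⇒part = decidable-stable (_ ≟P _)

-- Vertex i of part p is put into the i-th edge that contains p. By `deg` there are as many such
-- edges as vertices in p, so the blocks are exactly the nonempty edges.
module Realize {m₁ m₂ n₁′ n₂′ : ℕ} (es : List (Edge m₁ m₂))
  (deg : ∀ p → count (λ e → has e p) es ≡ size (suc n₁′) (suc n₂′) p) (uniq : Unique es) where

  n₁ = suc n₁′
  n₂ = suc n₂′
  open Points {m₁} {n₁} {m₂} {n₂}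

  base : (p : Part m₁ m₂) → Vertex m₁ n₁ m₂ n₂
  base (inj₁ a) = inj₁ (a , zero)
  base (inj₂ b) = inj₂ (b , zero)

  partOf-base : ∀ p → partOf (base p) ≡ p
  partOf-base (inj₁ a) = refl
  partOf-base (inj₂ b) = refl

  edgeAt : ∀ p → Fin (size n₁ n₂ p) → Fin (length es)
  edgeAt p i = pos (λ e → has e p) es (cast (sym (deg p)) i)

  edgeAt-injective : ∀ p {i j} → edgeAt p i ≡ edgeAt p j → i ≡ j
  edgeAt-injective p {i} {j} eq = Fin.toℕ-injective (trans (sym (Fin.toℕ-cast _ i))
    (trans (cong toℕ (pos-injective _ es eq)) (Fin.toℕ-cast _ j)))

  edgeAt-surjective : ∀ p k → has (List.lookup es k) p ≡ true → ∃ λ i → edgeAt p i ≡ k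
  edgeAt-surjective p k q with i , r ← pos-surjective (λ e → has e p) es k q =
    cast (deg p) i , trans (cong (pos _ es) (trans (Fin.cast-trans (deg p) (sym (deg p)) i) (Fin.cast-is-id _ i))) r

  block : Vertex m₁ n₁ m₂ n₂ → Fin (length es)
  block x = edgeAt (partOf x) (index x refl)

  edgeOf : Vertex m₁ n₁ m₂ n₂ → Edge m₁ m₂
  edgeOf x = List.lookup es (block x)

  block-pt : ∀ p i → block (pt p i) ≡ edgeAt p i
  block-pt (inj₁ a) i = refl
  block-pt (inj₂ b) i = refl

  block-has : ∀ x → has (edgeOf x) (partOf x) ≡ true
  block-has x = pos-sound (λ e → has e (partOf x)) es _

  vertex-ext : ∀ {x y} → partOf x ≡ partOf y → block x ≡ block y → x ≡ y
  vertex-ext {inj₁ (a , i)} {inj₁ (.a , j)} refl q = cong (λ k → inj₁ (a , k)) (edgeAt-injective (inj₁ a) q)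
  vertex-ext {inj₂ (b , i)} {inj₂ (.b , j)} refl q = cong (λ k → inj₂ (b , k)) (edgeAt-injective (inj₂ b) q)

  find : ∀ p k → has (List.lookup es k) p ≡ true → ∃ λ x → partOf x ≡ p × block x ≡ k
  find p k q with i , r ← edgeAt-surjective p k q = pt p i , partOf-pt p i , trans (block-pt p i) r

  P : Partition (K m₁ n₁ m₂ n₂)
  P = toℕ ∘ block

  -- Non-adjacency is equality of parts, so an automorphism acts on the parts. `f` and `g` enter
  -- symmetrically, and exchanging them yields the inverse action.
  module Induced (f g : Vertex m₁ n₁ m₂ n₂ → Vertex m₁ n₁ m₂ n₂) (fg : ∀ x → f (g x) ≡ x) (gf : ∀ x → g (f x) ≡ x)
    (f-part : ∀ {x y} → partOf x ≡ partOf y → partOf (f x) ≡ partOf (f y))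
    (g-part : ∀ {x y} → partOf x ≡ partOf y → partOf (g x) ≡ partOf (g y))
    (f-block : ∀ {x y} → block x ≡ block y → block (f x) ≡ block (f y))
    (g-block : ∀ {x y} → block x ≡ block y → block (g x) ≡ block (g y)) where

    π : Part m₁ m₂ → Part m₁ m₂
    π p = partOf (f (base p))

    π-partOf : ∀ x → π (partOf x) ≡ partOf (f x)
    π-partOf x = f-part (partOf-base (partOf x))

    edgeOf-π : ∀ x p → has (edgeOf (f x)) (π p) ≡ has (edgeOf x) p
    edgeOf-π x p = bool-ext to from
      where
      from : has (edgeOf x) p ≡ true → has (edgeOf (f x)) (π p) ≡ true
      from q with y , py , by ← find p (block x) q =
        subst₂ (λ k r → has (List.lookup es k) r ≡ true) (f-block by)
          (trans (sym (π-partOf y)) (cong π py)) (block-has (f y))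
      to : has (edgeOf (f x)) (π p) ≡ true → has (edgeOf x) p ≡ true
      to q with z , pz , bz ← find (π p) (block (f x)) q =
        subst₂ (λ k r → has (List.lookup es k) r ≡ true)
          (trans (g-block bz) (cong block (gf x)))
          (trans (g-part pz) (trans (cong partOf (gf (base p))) (partOf-base p)))
          (block-has (g z))

    pres : Preserves es π
    pres {e} e∈ with anyPart? (λ p → has e p Bool.≟ true)
    -- An empty edge has no vertex whose image could be followed, but it is its own image.
    ... | no empty = e , e∈ , λ p → trans (none (π p)) (sym (none p))
      where
      none : ∀ p → has e p ≡ false
      none p = Bool.¬-not λ q → empty (p , q)
    ... | yes (p , q) with x , _ , bx ← find p (Any.index e∈) (trans (cong (λ e → has e p) (sym (Any.lookup-index e∈))) q) =
      edgeOf (f x) , ∈.∈-lookup (block (f x)) ,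
      λ v → trans (edgeOf-π x v) (cong (λ e → has e v) (trans (cong (List.lookup es) bx) (sym (Any.lookup-index e∈))))

    size≤ : ∀ p → size n₁ n₂ p ≤ size n₁ n₂ (π p)
    size≤ p = Fin.injective⇒≤ {f = h} h-injective
      where
      in-π : ∀ i → partOf (f (pt p i)) ≡ π p
      in-π i = trans (sym (π-partOf (pt p i))) (cong π (partOf-pt p i))
      h : Fin (size n₁ n₂ p) → Fin (size n₁ n₂ (π p))
      h i = index (f (pt p i)) (in-π i)
      h-injective : ∀ {i j} → h i ≡ h j → i ≡ j
      h-injective {i} {j} eq = trans (sym (index-pt p i (partOf-pt p i))) (trans (lemma same (partOf-pt p i) (partOf-pt p j)) (index-pt p j (partOf-pt p j)))
        where
        same : pt p i ≡ pt p j
        same = trans (sym (gf _)) (trans (cong g (trans (sym (pt-index _ (in-π i)))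
          (trans (cong (pt (π p)) eq) (pt-index _ (in-π j))))) (gf _))
        lemma : ∀ {x y} → x ≡ y → (q : partOf x ≡ p) (r : partOf y ≡ p) → index x q ≡ index y r
        lemma {inj₁ _} refl refl refl = refl
        lemma {inj₂ _} refl refl refl = refl

  -- Rigidity keeps every part in place. A block and its image then meet the same parts and coincide
  -- by `uniq`, and a vertex is determined by its part and its block.
  distinguishing : (∀ (s : Symmetry n₁ n₂ es) p → Symmetry.π s p ≡ p) → HasDistinguishingPartition (K m₁ n₁ m₂ n₂)
  distinguishing rigid = P , λ γ nontrivial fixes → nontrivial (fixed γ fixes)
    where
    fixed : (γ : Aut (K m₁ n₁ m₂ n₂)) → FixesPartition γ P → ∀ x → Inverse.to (Aut.perm γ) x ≡ x
    fixed γ fixes x = vertex-ext part-fixed (Unique⇒lookup-injective uniq (edge-ext λ p →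
      trans (cong (has (edgeOf (f x))) (sym (rigid s p))) (F.edgeOf-π x p)))
      where
      open Aut γ
      f = Inverse.to perm
      g = Inverse.from perm
      fg : ∀ x → f (g x) ≡ x
      fg = Inverse.strictlyInverseˡ perm
      gf : ∀ x → g (f x) ≡ x
      gf = Inverse.strictlyInverseʳ perm
      f-part : ∀ {x y} → partOf x ≡ partOf y → partOf (f x) ≡ partOf (f y)
      f-part {x} {y} q = ¬adj⇒part λ adj → Equivalence.from (preserve x y) adj q
      f-part⁻ : ∀ {x y} → partOf (f x) ≡ partOf (f y) → partOf x ≡ partOf y
      f-part⁻ {x} {y} q = ¬adj⇒part λ adj → Equivalence.to (preserve x y) adj q
      f-block : ∀ {x y} → block x ≡ block y → block (f x) ≡ block (f y)
      f-block {x} {y} q = Fin.toℕ-injective (Equivalence.to (fixes x y) (cong toℕ q))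
      f-block⁻ : ∀ {x y} → block (f x) ≡ block (f y) → block x ≡ block y
      f-block⁻ {x} {y} q = Fin.toℕ-injective (Equivalence.from (fixes x y) (cong toℕ q))
      g-part : ∀ {x y} → partOf x ≡ partOf y → partOf (g x) ≡ partOf (g y)
      g-part {x} {y} q = f-part⁻ (trans (cong partOf (fg x)) (trans q (cong partOf (sym (fg y)))))
      g-block : ∀ {x y} → block x ≡ block y → block (g x) ≡ block (g y)
      g-block {x} {y} q = f-block⁻ (trans (cong block (fg x)) (trans q (cong block (sym (fg y)))))
      module F = Induced f g fg gf f-part g-part f-block g-block
      module G = Induced g f gf fg g-part f-part g-block f-block
      π⁻π : ∀ p → G.π (F.π p) ≡ p
      π⁻π p = trans (G.π-partOf (f (base p))) (trans (cong partOf (gf (base p))) (partOf-base p))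
      ππ⁻ : ∀ p → F.π (G.π p) ≡ p
      ππ⁻ p = trans (F.π-partOf (g (base p))) (trans (cong partOf (fg (base p))) (partOf-base p))
      s : Symmetry n₁ n₂ es
      s = record { π = F.π ; π⁻ = G.π ; ππ⁻ = ππ⁻ ; π⁻π = π⁻π
        ; π-size = λ p → ≤-antisym (subst (λ q → size n₁ n₂ (F.π p) ≤ size n₁ n₂ q) (π⁻π p) (G.size≤ (F.π p))) (F.size≤ p)
        ; π-pres = F.pres ; π⁻-pres = G.pres }
      part-fixed : partOf (f x) ≡ partOf x
      part-fixed = trans (sym (F.π-partOf x)) (rigid s (partOf x))

-- Symmetries that keep small and large parts apart

isA : ∀ {m₁ m₂} → Part m₁ m₂ → Bool
isA (inj₁ _) = true
isA (inj₂ _) = false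

fromA : ∀ {m₁ m₂} (p : Part m₁ m₂) → isA p ≡ true → ∃ λ a → p ≡ inj₁ a
fromA (inj₁ a) _ = a , refl

fromB : ∀ {m₁ m₂} (p : Part m₁ m₂) → isA p ≡ false → ∃ λ b → p ≡ inj₂ b
fromB (inj₂ b) _ = b , refl

record SplitSymmetry {m₁ m₂} (es : List (Edge m₁ m₂)) : Set where
  field
    σ σ⁻ : Fin m₁ → Fin m₁
    τ τ⁻ : Fin m₂ → Fin m₂
    σσ⁻ : ∀ a → σ (σ⁻ a) ≡ a
    σ⁻σ : ∀ a → σ⁻ (σ a) ≡ a
    ττ⁻ : ∀ b → τ (τ⁻ b) ≡ b
    τ⁻τ : ∀ b → τ⁻ (τ b) ≡ b
    image  : ∀ {X S} → (X , S) ∈ es → ∃ λ X′ → ∃ λ S′ → (X′ , S′) ∈ es ×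
             (∀ a → lookup X′ (σ a) ≡ lookup X a) × (∀ b → lookup S′ (τ b) ≡ lookup S b)
    image⁻ : ∀ {X S} → (X , S) ∈ es → ∃ λ X′ → ∃ λ S′ → (X′ , S′) ∈ es ×
             (∀ a → lookup X′ (σ⁻ a) ≡ lookup X a) × (∀ b → lookup S′ (τ⁻ b) ≡ lookup S b)

  σ-injective : ∀ {a b} → σ a ≡ σ b → a ≡ b
  σ-injective {a} {b} q = trans (sym (σ⁻σ a)) (trans (cong σ⁻ q) (σ⁻σ b))

flip-Split : ∀ {m₁ m₂} {es : List (Edge m₁ m₂)} → SplitSymmetry es → SplitSymmetry es
flip-Split s = record { σ = σ⁻ ; σ⁻ = σ ; τ = τ⁻ ; τ⁻ = τ ; σσ⁻ = σ⁻σ ; σ⁻σ = σσ⁻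
  ; ττ⁻ = τ⁻τ ; τ⁻τ = ττ⁻ ; image = image⁻ ; image⁻ = image } where open SplitSymmetry s

module SplitOf {m₁ m₂ n₁ n₂} {es : List (Edge m₁ m₂)} (s : Symmetry n₁ n₂ es)
  (keeps : ∀ p → isA (Symmetry.π s p) ≡ isA p) where
  open Symmetry s

  keeps⁻ : ∀ p → isA (π⁻ p) ≡ isA p
  keeps⁻ p = trans (sym (keeps (π⁻ p))) (cong isA (ππ⁻ p))

  σ σ⁻ : Fin m₁ → Fin m₁
  σ  a = proj₁ (fromA (π  (inj₁ a)) (keeps  (inj₁ a)))
  σ⁻ a = proj₁ (fromA (π⁻ (inj₁ a)) (keeps⁻ (inj₁ a)))

  τ τ⁻ : Fin m₂ → Fin m₂
  τ  b = proj₁ (fromB (π  (inj₂ b)) (keeps  (inj₂ b)))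
  τ⁻ b = proj₁ (fromB (π⁻ (inj₂ b)) (keeps⁻ (inj₂ b)))

  π-σ : ∀ a → π (inj₁ a) ≡ inj₁ (σ a)
  π-σ a = proj₂ (fromA (π (inj₁ a)) (keeps (inj₁ a)))
  π⁻-σ⁻ : ∀ a → π⁻ (inj₁ a) ≡ inj₁ (σ⁻ a)
  π⁻-σ⁻ a = proj₂ (fromA (π⁻ (inj₁ a)) (keeps⁻ (inj₁ a)))
  π-τ : ∀ b → π (inj₂ b) ≡ inj₂ (τ b)
  π-τ b = proj₂ (fromB (π (inj₂ b)) (keeps (inj₂ b)))
  π⁻-τ⁻ : ∀ b → π⁻ (inj₂ b) ≡ inj₂ (τ⁻ b)
  π⁻-τ⁻ b = proj₂ (fromB (π⁻ (inj₂ b)) (keeps⁻ (inj₂ b)))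

  split : SplitSymmetry es
  split = record
    { σ = σ ; σ⁻ = σ⁻ ; τ = τ ; τ⁻ = τ⁻
    ; σσ⁻ = λ a → inj₁-injective (trans (sym (π-σ (σ⁻ a))) (trans (cong π (sym (π⁻-σ⁻ a))) (ππ⁻ _)))
    ; σ⁻σ = λ a → inj₁-injective (trans (sym (π⁻-σ⁻ (σ a))) (trans (cong π⁻ (sym (π-σ a))) (π⁻π _)))
    ; ττ⁻ = λ b → inj₂-injective (trans (sym (π-τ (τ⁻ b))) (trans (cong π (sym (π⁻-τ⁻ b))) (ππ⁻ _)))
    ; τ⁻τ = λ b → inj₂-injective (trans (sym (π⁻-τ⁻ (τ b))) (trans (cong π⁻ (sym (π-τ b))) (π⁻π _)))
    ; image = λ e∈ → case π-pres e∈ of λ { ((X′ , S′) , e′∈ , h) → X′ , S′ , e′∈ ,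
        (λ a → trans (cong (has (X′ , S′)) (sym (π-σ a))) (h (inj₁ a))) ,
        (λ b → trans (cong (has (X′ , S′)) (sym (π-τ b))) (h (inj₂ b))) }
    ; image⁻ = λ e∈ → case π⁻-pres e∈ of λ { ((X′ , S′) , e′∈ , h) → X′ , S′ , e′∈ ,
        (λ a → trans (cong (has (X′ , S′)) (sym (π⁻-σ⁻ a))) (h (inj₁ a))) ,
        (λ b → trans (cong (has (X′ , S′)) (sym (π⁻-τ⁻ b))) (h (inj₂ b))) }
    }

  trivial : (∀ a → σ a ≡ a) → (∀ b → τ b ≡ b) → ∀ p → π p ≡ p
  trivial p q (inj₁ a) = trans (π-σ a) (cong inj₁ (p a))
  trivial p q (inj₂ b) = trans (π-τ b) (cong inj₂ (q b))

size-keeps : ∀ {m₁ m₂ n₁ n₂} → n₁ ≢ n₂ → (p q : Part m₁ m₂) → size n₁ n₂ p ≡ size n₁ n₂ q → isA p ≡ isA q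
size-keeps n₁≢n₂ (inj₁ _) (inj₁ _) eq = refl
size-keeps n₁≢n₂ (inj₁ _) (inj₂ _) eq = contradiction eq n₁≢n₂
size-keeps n₁≢n₂ (inj₂ _) (inj₁ _) eq = contradiction (sym eq) n₁≢n₂
size-keeps n₁≢n₂ (inj₂ _) (inj₂ _) eq = refl

∑-relabel : ∀ {n} (f : Fin n → ℕ) (σ σ⁻ : Fin n → Fin n) → (∀ a → σ (σ⁻ a) ≡ a) → (∀ a → σ⁻ (σ a) ≡ a) →
  ∑ (f ∘ σ) ≡ ∑ f
∑-relabel f σ σ⁻ p q = ∑-permute f (mk↔ₛ′ σ σ⁻ p q)

card-relabel : ∀ {n} {X X′ : Vec Bool n} (g : Bool → Bool) (σ σ⁻ : Fin n → Fin n) →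
  (∀ a → σ (σ⁻ a) ≡ a) → (∀ a → σ⁻ (σ a) ≡ a) → (∀ a → lookup X′ (σ a) ≡ lookup X a) →
  ∑ (ind ∘ g ∘ lookup X′) ≡ ∑ (ind ∘ g ∘ lookup X)
card-relabel {X = X} {X′} g σ σ⁻ p q h =
  trans (sym (∑-relabel (ind ∘ g ∘ lookup X′) σ σ⁻ p q)) (∑-cong λ a → cong (ind ∘ g) (h a))

-- Sets of parts given by predicates on ℕ

mk : ∀ {n} → (ℕ → Bool) → Vec Bool n
mk f = Vec.tabulate (f ∘ toℕ)

lookup-mk : ∀ {n} (f : ℕ → Bool) (i : Fin n) → lookup (mk f) i ≡ f (toℕ i)
lookup-mk f i = Vec.lookup∘tabulate (f ∘ toℕ) i

abstract
  single : ∀ {n} → ℕ → Vec Bool n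
  single k = mk λ i → does (i ≟ k)

  pair : ∀ {n} → ℕ → ℕ → Vec Bool n
  pair j k = mk λ i → does (i ≟ j) ∨ does (i ≟ k)

  full none : ∀ {n} → Vec Bool n
  full = mk λ _ → true
  none = mk λ _ → false

  lookup-single : ∀ {n} k (i : Fin n) → lookup (single k) i ≡ does (toℕ i ≟ k)
  lookup-single k = lookup-mk λ i → does (i ≟ k)

  lookup-pair : ∀ {n} j k (i : Fin n) → lookup (pair j k) i ≡ does (toℕ i ≟ j) ∨ does (toℕ i ≟ k)
  lookup-pair j k = lookup-mk λ i → does (i ≟ j) ∨ does (i ≟ k)

  lookup-full : ∀ {n} (i : Fin n) → lookup full i ≡ true
  lookup-full = lookup-mk λ _ → true

  lookup-none : ∀ {n} (i : Fin n) → lookup none i ≡ false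
  lookup-none = lookup-mk λ _ → false

single⁺ : ∀ {n} {k} (i : Fin n) → toℕ i ≡ k → lookup (single k) i ≡ true
single⁺ {k = k} i p = trans (lookup-single k i) (dec-true (toℕ i ≟ k) p)

single⁻ : ∀ {n} {k} (i : Fin n) → lookup (single k) i ≡ true → toℕ i ≡ k
single⁻ {k = k} i p = does-true (toℕ i ≟ k) (trans (sym (lookup-single k i)) p)

∨-true : ∀ {a b} → a ∨ b ≡ true → a ≡ true ⊎ b ≡ true
∨-true {true}  p = inj₁ refl
∨-true {false} p = inj₂ p

pair⁺ˡ : ∀ {n} {j k} (i : Fin n) → toℕ i ≡ j → lookup (pair j k) i ≡ true
pair⁺ˡ {j = j} {k} i p = trans (lookup-pair j k i) (cong (_∨ does (toℕ i ≟ k)) (dec-true (toℕ i ≟ j) p))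

pair⁺ʳ : ∀ {n} {j k} (i : Fin n) → toℕ i ≡ k → lookup (pair j k) i ≡ true
pair⁺ʳ {j = j} {k} i p = trans (lookup-pair j k i) (trans (cong (does (toℕ i ≟ j) ∨_) (dec-true (toℕ i ≟ k) p)) (Bool.∨-zeroʳ _))

pair⁻ : ∀ {n} {j k} (i : Fin n) → lookup (pair j k) i ≡ true → toℕ i ≡ j ⊎ toℕ i ≡ k
pair⁻ {j = j} {k} i p with ∨-true {does (toℕ i ≟ j)} (trans (sym (lookup-pair j k i)) p)
... | inj₁ q = inj₁ (does-true (toℕ i ≟ j) q)
... | inj₂ q = inj₂ (does-true (toℕ i ≟ k) q)

∑-via : ∀ {n} (g : Bool → ℕ) (X : Vec Bool n) {f : Fin n → Bool} → (∀ i → lookup X i ≡ f i) →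
  ∑ (g ∘ lookup X) ≡ ∑ (g ∘ f)
∑-via {n} g X {f} p = ∑-cong {n} {g ∘ lookup X} {g ∘ f} (λ i → cong g (p i))

card-single : ∀ {n k} → k < n → card {n} (single k) ≡ 1
card-single {n} {k} p = trans (∑-via ind (single k) (lookup-single k)) (∑-point {n} {k} p)

ind-∨ : ∀ {a b} → (a ≡ true → b ≢ true) → ind (a ∨ b) ≡ ind a + ind b
ind-∨ {false} {b}     p = refl
ind-∨ {true}  {false} p = refl
ind-∨ {true}  {true}  p = contradiction refl (p refl)

ind-∨-≟ : ∀ i {j k} → j ≢ k → ind (does (i ≟ j) ∨ does (i ≟ k)) ≡ ind (does (i ≟ j)) + ind (does (i ≟ k))
ind-∨-≟ i {j} {k} j≢k = ind-∨ λ p q → j≢k (trans (sym (does-true (i ≟ j) p)) (does-true (i ≟ k) q))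

card-pair : ∀ {n j k} → j < n → k < n → j ≢ k → card {n} (pair j k) ≡ 2
card-pair {n} {j} {k} p q j≢k = trans (∑-via ind (pair j k) (lookup-pair j k)) (trans (∑-cong {n} (λ i → ind-∨-≟ (toℕ i) j≢k))
  (trans (∑-+ {n} (λ i → ind (does (toℕ i ≟ j))) (λ i → ind (does (toℕ i ≟ k)))) (cong₂ _+_ (∑-point {n} {j} p) (∑-point {n} {k} q))))

∑-ones : ∀ n → ∑ {n} (λ _ → 1) ≡ n
∑-ones n = trans (∑-const n 1) (*-identityʳ n)

card-full : ∀ {n} → card {n} full ≡ n
card-full {n} = trans (∑-via ind full lookup-full) (∑-ones n)

card-none : ∀ {n} → card {n} none ≡ 0
card-none {n} = trans (∑-via ind none lookup-none) (∑-zero {n} λ _ → refl)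

co-none : ∀ {n} → co {n} none ≡ n
co-none {n} = trans (∑-via (ind ∘ not) none lookup-none) (∑-ones n)

-- The cyclic skeleton

-- `S`, `L` and `R` are the sets of large parts that the blocks of a gap contain.
data Colour (m₂ : ℕ) : Set where
  edge : (S : Vec Bool m₂) → Colour m₂
  cut  : (L R : Vec Bool m₂) → Colour m₂

weight : ∀ {m₂} → Colour m₂ → Fin m₂ → ℕ
weight (edge S)  b = ind (lookup S b)
weight (cut L R) b = ind (lookup L b) + ind (lookup R b)

-- The small parts lie on a cycle; gap g separates left g from g.  An edge-coloured gap
-- becomes a block meeting both of its ends, a cut gap becomes one block at each end.
module Skeleton {m₂ : ℕ} (m′ : ℕ) (2≤m′ : 2 ≤ m′) (col : ℕ → Colour m₂) where

  m₁ = suc m′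

  left : ℕ → ℕ
  left zero    = m′
  left (suc g) = g

  left< : ∀ {g} → g < m₁ → left g < m₁
  left< {zero}  p = ≤-refl
  left< {suc g} p = ≤-trans (n≤1+n _) p

  left≢ : ∀ g → left g ≢ g
  left≢ zero    p = <⇒≢ (≤-trans (s≤s z≤n) 2≤m′) (sym p)
  left≢ (suc g) p = 1+n≢n (sym p)

  -- A cycle of length m₁ ≥ 3 has no two gaps with the same pair of ends; this makes a gap
  -- recoverable from its block.
  left-left : ∀ g → left (left g) ≢ g
  left-left zero = lemma m′ 2≤m′
    where
    lemma : ∀ k → 2 ≤ k → left k ≢ 0
    lemma (suc zero)    (s≤s ()) _
    lemma (suc (suc k)) _        ()
  left-left (suc zero) p = <⇒≢ 2≤m′ (sym p)
  left-left (suc (suc g)) p = <⇒≢ (s≤s (n≤1+n g)) p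

  gapEdges : ℕ → List (Edge m₁ m₂)
  gapEdges g with col g
  ... | edge S  = (pair (left g) g , S) ∷ []
  ... | cut L R = (single (left g) , L) ∷ (single g , R) ∷ []

  data InGap (g : ℕ) : Edge m₁ m₂ → Set where
    pairᵍ  : ∀ {S} → col g ≡ edge S → InGap g (pair (left g) g , S)
    leftᵍ  : ∀ {L R} → col g ≡ cut L R → InGap g (single (left g) , L)
    rightᵍ : ∀ {L R} → col g ≡ cut L R → InGap g (single g , R)

  ∈-gap⁻ : ∀ {g e} → e ∈ gapEdges g → InGap g e
  ∈-gap⁻ {g} p with col g in eq
  ∈-gap⁻ {g} (here refl)         | edge S  = pairᵍ eq
  ∈-gap⁻ {g} (here refl)         | cut L R = leftᵍ eq
  ∈-gap⁻ {g} (there (here refl)) | cut L R = rightᵍ eq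

  ∈-gap⁺ : ∀ {g e} → InGap g e → e ∈ gapEdges g
  ∈-gap⁺ (pairᵍ eq)  rewrite eq = here refl
  ∈-gap⁺ (leftᵍ eq)  rewrite eq = here refl
  ∈-gap⁺ (rightᵍ eq) rewrite eq = there (here refl)

  skeleton : List (Edge m₁ m₂)
  skeleton = concat (tabulate {n = m₁} (gapEdges ∘ toℕ))

  ∈-skeleton⁻ : ∀ {e} → e ∈ skeleton → ∃ λ g → g < m₁ × InGap g e
  ∈-skeleton⁻ p with xs , e∈ , xs∈ ← ∈.∈-concat⁻′ (tabulate (gapEdges ∘ toℕ)) p
    with i , refl ← ∈.∈-tabulate⁻ {n = m₁} {f = gapEdges ∘ toℕ} xs∈ = toℕ i , Fin.toℕ<n i , ∈-gap⁻ e∈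

  ∈-skeleton⁺ : ∀ {g e} → g < m₁ → InGap g e → e ∈ skeleton
  ∈-skeleton⁺ {g} {e} g< p = ∈.∈-concat⁺′ {vs = gapEdges g} (∈-gap⁺ p)
    (subst (λ k → gapEdges k ∈ tabulate {n = m₁} (gapEdges ∘ toℕ)) (Fin.toℕ-fromℕ< g<) (∈.∈-tabulate⁺ {f = gapEdges ∘ toℕ} (fromℕ< g<)))

  single-injective : ∀ {j k} → j < m₁ → single {m₁} j ≡ single k → j ≡ k
  single-injective {j} {k} j< p = trans (sym (Fin.toℕ-fromℕ< j<))
    (single⁻ (fromℕ< j<) (trans (cong (λ X → lookup X (fromℕ< j<)) (sym p)) (single⁺ (fromℕ< j<) (Fin.toℕ-fromℕ< j<))))

  pair-memʳ : ∀ {j k j′ k′} → k < m₁ → pair {m₁} j k ≡ pair j′ k′ → k ≡ j′ ⊎ k ≡ k′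
  pair-memʳ {k = k} k< p with pair⁻ (fromℕ< k<) (trans (cong (λ X → lookup X (fromℕ< k<)) (sym p)) (pair⁺ʳ (fromℕ< k<) (Fin.toℕ-fromℕ< k<)))
  ... | inj₁ q = inj₁ (trans (sym (Fin.toℕ-fromℕ< k<)) q)
  ... | inj₂ q = inj₂ (trans (sym (Fin.toℕ-fromℕ< k<)) q)

  pair-gap-injective : ∀ {g h} → g < m₁ → h < m₁ → pair {m₁} (left g) g ≡ pair (left h) h → g ≡ h
  pair-gap-injective {g} {h} g< h< p with pair-memʳ g< p
  ... | inj₂ q = q
  ... | inj₁ q with pair-memʳ h< (sym p)
  ...   | inj₂ r = sym r
  ...   | inj₁ r = contradiction (trans (cong left (sym r)) (sym q)) (left-left g)

  card-pair-gap : ∀ {g} → g < m₁ → card {m₁} (pair (left g) g) ≡ 2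
  card-pair-gap {g} g< = card-pair (left< g<) g< (left≢ g)

  pair≢single : ∀ {g k} → g < m₁ → k < m₁ → pair {m₁} (left g) g ≢ single k
  pair≢single g< k< p with () ← trans (sym (card-pair-gap g<)) (trans (cong card p) (card-single k<))

  left-injective : ∀ {g h} → g < m₁ → h < m₁ → left g ≡ left h → g ≡ h
  left-injective {zero}  {zero}  g< h< p = refl
  left-injective {zero}  {suc h} g< h< p = contradiction (sym p) (<⇒≢ (s<s⁻¹ h<))
  left-injective {suc g} {zero}  g< h< p = contradiction p (<⇒≢ (s<s⁻¹ g<))
  left-injective {suc g} {suc h} g< h< p = cong suc p

  deg-skeleton : ∀ a → count (λ e → has e (inj₁ a)) skeleton ≡ 2
  deg-skeleton a = trans (sumL-concat-tabulate {n = m₁} _ (gapEdges ∘ toℕ)) (trans (∑-cong {m₁} (at ∘ toℕ))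
    (trans (∑-+ {m₁} (λ g → ind (does (toℕ a ≟ left (toℕ g)))) (λ g → ind (does (toℕ a ≟ toℕ g))))
    (cong₂ _+_ lefts (∑-point′ {m₁} {toℕ a} (Fin.toℕ<n a)))))
    where
    at : ∀ g → count (λ e → has e (inj₁ a)) (gapEdges g) ≡ ind (does (toℕ a ≟ left g)) + ind (does (toℕ a ≟ g))
    at g with col g
    ... | edge S  = trans (+-identityʳ _) (trans (cong ind (lookup-pair (left g) g a)) (ind-∨-≟ (toℕ a) (left≢ g)))
    ... | cut L R = cong₂ _+_ (cong ind (lookup-single (left g) a)) (trans (+-identityʳ _) (cong ind (lookup-single g a)))
    lefts : ∑ {m₁} (λ g → ind (does (toℕ a ≟ left (toℕ g)))) ≡ 1
    -- Gap 0, whose left end wraps around to m′, is moved to the end of the sum, which then runs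
    -- over all small parts in order.
    lefts = trans (∑-suc _) (trans (+-comm _ (∑ {m′} (λ g → ind (does (toℕ a ≟ toℕ g))))) (trans
      (sym (∑-last m′ (λ g → ind (does (toℕ a ≟ g))))) (∑-point′ {m₁} {toℕ a} (Fin.toℕ<n a))))

  deg-skeletonᴮ : ∀ b → count (λ e → has e (inj₂ b)) skeleton ≡ ∑ {m₁} (λ g → weight (col (toℕ g)) b)
  deg-skeletonᴮ b = trans (sumL-concat-tabulate {n = m₁} _ (gapEdges ∘ toℕ)) (∑-cong {m₁} (at ∘ toℕ))
    where
    at : ∀ g → count (λ e → has e (inj₂ b)) (gapEdges g) ≡ weight (col g) b
    at g with col g
    ... | edge S  = +-identityʳ _
    ... | cut L R = cong (ind (lookup L b) +_) (+-identityʳ (ind (lookup R b)))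

  -- A small part between two consecutive cuts lies in two blocks that meet no other small part.
  -- Only their sets of large parts can make them different.
  LabelsApart : Set
  LabelsApart = ∀ {g L R L′ R′} → g < m₁ → col g ≡ cut L R → col (left g) ≡ cut L′ R′ → L ≢ R′

  skeleton-Unique : LabelsApart → Unique skeleton
  skeleton-Unique apart = Unique.concat⁺ (All.tabulate⁺ (λ g → each (Fin.toℕ<n g)))
    (AllPairs.tabulate⁺ λ {i} {j} i≢j (p , q) → i≢j (Fin.toℕ-injective
      (meet (Fin.toℕ<n i) (Fin.toℕ<n j) (∈-gap⁻ p) (∈-gap⁻ q))))
    where
    each : ∀ {g} → g < m₁ → Unique (gapEdges g)
    each {g} g< with col g
    ... | edge S  = [] ∷ []
    ... | cut L R = ((λ p → left≢ g (single-injective (left< g<) (cong proj₁ p))) ∷ []) ∷ ([] ∷ [])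
    meet′ : ∀ {g h e f} → g < m₁ → h < m₁ → InGap g e → InGap h f → e ≡ f → g ≡ h
    meet′ g< h< (pairᵍ p)  (pairᵍ q)  r = pair-gap-injective g< h< (cong proj₁ r)
    meet′ g< h< (pairᵍ p)  (leftᵍ q)  r = contradiction (cong proj₁ r) (pair≢single g< (left< h<))
    meet′ g< h< (pairᵍ p)  (rightᵍ q) r = contradiction (cong proj₁ r) (pair≢single g< h<)
    meet′ g< h< (leftᵍ p)  (pairᵍ q)  r = contradiction (cong proj₁ (sym r)) (pair≢single h< (left< g<))
    meet′ g< h< (rightᵍ p) (pairᵍ q)  r = contradiction (cong proj₁ (sym r)) (pair≢single h< g<)
    meet′ g< h< (leftᵍ p)  (leftᵍ q)  r = left-injective g< h< (single-injective (left< g<) (cong proj₁ r))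
    meet′ g< h< (rightᵍ p) (rightᵍ q) r = single-injective g< (cong proj₁ r)
    meet′ g< h< (leftᵍ p)  (rightᵍ q) r = contradiction (cong proj₂ r)
      (apart g< p (trans (cong col (single-injective (left< g<) (cong proj₁ r))) q))
    meet′ g< h< (rightᵍ p) (leftᵍ q)  r = contradiction (cong proj₂ (sym r))
      (apart h< q (trans (cong col (single-injective (left< h<) (cong proj₁ (sym r)))) p))
    meet : ∀ {g h e} → g < m₁ → h < m₁ → InGap g e → InGap h e → g ≡ h
    meet g< h< p q = meet′ g< h< p q refl

  PairsOnly : List (Edge m₁ m₂) → Set
  PairsOnly es = ∀ {X S} → (X , S) ∈ es → card X ≡ 2 → ∃ λ g → g < m₁ × col g ≡ edge S × X ≡ pair (left g) g

  skeleton-PairsOnly : PairsOnly skeleton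
  skeleton-PairsOnly p c with ∈-skeleton⁻ p
  ... | g , g< , pairᵍ q  = g , g< , q , refl
  ... | g , g< , leftᵍ q  with () ← trans (sym (card-single (left< g<))) c
  ... | g , g< , rightᵍ q with () ← trans (sym (card-single g<)) c

  module Images {es : List (Edge m₁ m₂)} (skeleton⊆ : ∀ {e} → e ∈ skeleton → e ∈ es) (pairs : PairsOnly es)
    (s : SplitSymmetry es) where
    open SplitSymmetry s

    -- A symmetry keeps the number of small parts in a block, and by `pairs` only edge-coloured gaps
    -- give blocks with exactly two.
    edge-image : ∀ {g S x y} → g < m₁ → col g ≡ edge S → toℕ x ≡ left g → toℕ y ≡ g →
      ∃ λ h → ∃ λ T → h < m₁ × col h ≡ edge T × (∀ b → lookup T (τ b) ≡ lookup S b) ×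
      ((toℕ (σ x) ≡ left h × toℕ (σ y) ≡ h) ⊎ (toℕ (σ x) ≡ h × toℕ (σ y) ≡ left h))
    edge-image {g} {S} {x} {y} g< eq x≡ y≡
      with X′ , S′ , e′∈ , hX , hS ← image (skeleton⊆ (∈-skeleton⁺ g< (pairᵍ eq)))
      with h , h< , eq′ , refl ← pairs e′∈ (trans (card-relabel {X = pair (left g) g} {X′} id σ σ⁻ σσ⁻ σ⁻σ hX) (card-pair-gap g<))
      = h , S′ , h< , eq′ , hS , ends
      where
      ends : (toℕ (σ x) ≡ left h × toℕ (σ y) ≡ h) ⊎ (toℕ (σ x) ≡ h × toℕ (σ y) ≡ left h)
      x≢y : toℕ (σ x) ≢ toℕ (σ y)
      x≢y p = left≢ g (trans (sym x≡) (trans (cong toℕ (σ-injective (Fin.toℕ-injective p))) y≡))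
      ends with pair⁻ (σ x) (trans (hX x) (pair⁺ˡ {j = left g} {g} x x≡)) | pair⁻ (σ y) (trans (hX y) (pair⁺ʳ {j = left g} {g} y y≡))
      ... | inj₁ p | inj₁ q = contradiction (trans p (sym q)) x≢y
      ... | inj₁ p | inj₂ q = inj₁ (p , q)
      ... | inj₂ p | inj₁ q = inj₂ (p , q)
      ... | inj₂ p | inj₂ q = contradiction (trans p (sym q)) x≢y

  single-image : ∀ {es : List (Edge m₁ m₂)} (s : SplitSymmetry es) {x S} → (single (toℕ x) , S) ∈ es → let open SplitSymmetry s in
    ∃ λ T → (single (toℕ (σ x)) , T) ∈ es × (∀ b → lookup T (τ b) ≡ lookup S b)
  single-image s {x} {S} p with X′ , S′ , e′∈ , hX , hS ← SplitSymmetry.image s p =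
    S′ , subst (λ X → (X , S′) ∈ _) (lookup-ext same) e′∈ , hS
    where
    open SplitSymmetry s
    at : ∀ j → lookup X′ j ≡ does (toℕ (σ⁻ j) ≟ toℕ x)
    at j = trans (cong (lookup X′) (sym (σσ⁻ j))) (trans (hX (σ⁻ j)) (lookup-single (toℕ x) (σ⁻ j)))
    same : ∀ j → lookup X′ j ≡ lookup (single (toℕ (σ x))) j
    same j = trans (at j) (trans (bool-ext
      (λ q → dec-true (toℕ j ≟ toℕ (σ x)) (cong toℕ (trans (sym (σσ⁻ j)) (cong σ (Fin.toℕ-injective (does-true (_ ≟ _) q))))))
      (λ q → dec-true (_ ≟ _) (cong toℕ (trans (cong σ⁻ (Fin.toℕ-injective (does-true (toℕ j ≟ toℕ (σ x)) q))) (σ⁻σ x)))))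
      (sym (lookup-single (toℕ (σ x)) j)))

-- Once everything below y is fixed, injectivity leaves no value below y for σ y, so the one-sided
-- bound σ y ≤ y is enough for the induction.
fix-all : ∀ {m′} (σ : Fin (suc m′) → Fin (suc m′)) → (∀ {a b} → σ a ≡ σ b → a ≡ b) → σ zero ≡ zero →
  (∀ {x y} → suc (toℕ x) ≡ toℕ y → (∀ i → toℕ i ≤ toℕ x → σ i ≡ i) → toℕ (σ y) ≤ toℕ y) → ∀ i → σ i ≡ i
fix-all {m′} σ inj σ0 step i = upTo (toℕ i) i ≤-refl
  where
  upTo : ∀ k i → toℕ i ≤ k → σ i ≡ i
  upTo zero    zero    p = σ0
  upTo (suc k) i p with m≤n⇒m<n∨m≡n p
  ... | inj₁ q = upTo k i (s≤s⁻¹ q)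
  ... | inj₂ q with m≤n⇒m<n∨m≡n (step {fromℕ< k<} {i} (trans (cong suc (Fin.toℕ-fromℕ< k<)) (sym q))
                    (λ j r → upTo k j (≤-trans r (≤-reflexive (Fin.toℕ-fromℕ< k<)))))
    where
    k< : k < suc m′
    k< = ≤-trans (n≤1+n _) (subst (_< suc m′) q (Fin.toℕ<n i))
  ...   | inj₁ r = inj (upTo k (σ i) (s≤s⁻¹ (subst (toℕ (σ i) <_) q r)))
  ...   | inj₂ r = Fin.toℕ-injective r

-- Automorphisms of a path

Adjacent : ℕ → ℕ → Set
Adjacent x y = suc x ≡ y ⊎ suc y ≡ x

Adjacent-sym : ∀ {x y} → Adjacent x y → Adjacent y x
Adjacent-sym (inj₁ p) = inj₂ p
Adjacent-sym (inj₂ p) = inj₁ p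

Adjacent-≤ : ∀ {x y} → Adjacent x y → y ≤ suc x
Adjacent-≤ (inj₁ refl) = ≤-refl
Adjacent-≤ (inj₂ refl) = ≤-trans (n≤1+n _) (n≤1+n _)

module PathAutomorphism {m′ : ℕ} (σ σ⁻ : Fin (suc m′) → Fin (suc m′))
  (σσ⁻ : ∀ a → σ (σ⁻ a) ≡ a) (σ⁻σ : ∀ a → σ⁻ (σ a) ≡ a)
  (adj  : ∀ {x y} → Adjacent (toℕ x) (toℕ y) → Adjacent (toℕ (σ x)) (toℕ (σ y)))
  (adj⁻ : ∀ {x y} → Adjacent (toℕ x) (toℕ y) → Adjacent (toℕ (σ⁻ x)) (toℕ (σ⁻ y))) where

  σ-inj : ∀ {a b} → σ a ≡ σ b → a ≡ b
  σ-inj {a} {b} q = trans (sym (σ⁻σ a)) (trans (cong σ⁻ q) (σ⁻σ b))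

  fixed : σ zero ≡ zero → ∀ a → σ a ≡ a
  fixed σ0 = fix-all σ σ-inj σ0 λ {x} {y} xy below →
    ≤-trans (Adjacent-≤ (adj {x} {y} (inj₁ xy))) (≤-trans (s≤s (≤-reflexive (cong toℕ (below x ≤-refl)))) (≤-reflexive xy))

  next-to-0 : ∀ {x} → Adjacent (toℕ x) (toℕ (σ zero)) → toℕ (σ⁻ x) ≡ 1
  next-to-0 {x} p with adj⁻ {x} {σ zero} p
  ... | inj₁ q with () ← trans q (cong toℕ (σ⁻σ zero))
  ... | inj₂ q = trans (sym q) (cong (suc ∘ toℕ) (σ⁻σ zero))

  -- An inner vertex has two neighbours; if σ 0 were one, both would be pulled back to 1, the only
  -- neighbour of 0.
  end : toℕ (σ zero) ≡ 0 ⊎ toℕ (σ zero) ≡ m′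
  end with toℕ (σ zero) in eq
  ... | zero  = inj₁ refl
  ... | suc j with m≤n⇒m<n∨m≡n (s≤s⁻¹ (subst (_< suc m′) eq (Fin.toℕ<n (σ zero))))
  ...   | inj₂ p = inj₂ p
  ...   | inj₁ p = contradiction (trans (sym (Fin.toℕ-fromℕ< j<)) (trans (cong toℕ same) (Fin.toℕ-fromℕ< p′)))
                     (<⇒≢ (s≤s (n≤1+n j)))
    where
    j< : j < suc m′
    j< = ≤-trans (n≤1+n _) (≤-trans p (n≤1+n _))
    p′ : suc (suc j) < suc m′
    p′ = s≤s p
    same : fromℕ< j< ≡ fromℕ< p′
    same = trans (sym (σσ⁻ _)) (trans (cong σ (Fin.toℕ-injective (trans
      (next-to-0 {fromℕ< j<} (inj₁ (trans (cong suc (Fin.toℕ-fromℕ< j<)) (sym eq))))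
      (sym (next-to-0 {fromℕ< p′} (inj₂ (trans (cong suc eq) (sym (Fin.toℕ-fromℕ< p′))))))))) (σσ⁻ _))

-- Partitions of the small parts into `w` singletons and one remaining set

blocks : ∀ {n} → ℕ → List (Vec Bool n)
blocks w = tabulate {n = w} (λ i → single (toℕ i)) ++ mk (λ i → not (does (i <? w))) ∷ []

length-blocks : ∀ {n} w → sumL (λ _ → 1) (blocks {n} w) ≡ suc w
length-blocks {n} w = trans (sumL-++ _ (tabulate {n = w} (λ i → single {n} (toℕ i))) _) (trans
  (cong (_+ 1) (trans (sumL-tabulate {n = w} (λ _ → 1) (λ i → single {n} (toℕ i))) (∑-ones w))) (+-comm w 1))

∑-hits : ∀ w k → ∑ {w} (λ i → ind (does (k ≟ toℕ i))) ≡ ind (does (k <? w))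
∑-hits w k with k <? w in eq
... | yes p = trans (∑-point′ p) (cong (ind ∘ does) (sym eq))
... | no ¬p = trans (∑-zero λ i → cong ind (dec-false (k ≟ toℕ i) λ { refl → ¬p (Fin.toℕ<n i) })) (cong (ind ∘ does) (sym eq))

count-blocks : ∀ {n} w (a : Fin n) → count (λ X → lookup X a) (blocks w) ≡ 1
count-blocks {n} w a = trans (sumL-++ _ (tabulate {n = w} (λ i → single {n} (toℕ i))) _) (trans (cong₂ _+_
  (trans (sumL-tabulate {n = w} _ (λ i → single {n} (toℕ i))) (trans (∑-cong λ i → cong ind (lookup-single (toℕ i) a)) (∑-hits w (toℕ a))))
  (trans (+-identityʳ _) (cong ind (lookup-mk (λ i → not (does (i <? w))) a))))
  (ind-not (does (toℕ a <? w))))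

card-above : ∀ {n} w → w ≤ n → card {n} (mk λ i → not (does (i <? w))) ≡ n ∸ w
card-above {n} w p = trans (∑-via ind (mk λ i → not (does (i <? w))) (lookup-mk λ i → not (does (i <? w)))) (∑-above w p)

single≢ : ∀ {n j} {X : Vec Bool n} (j< : j < n) → lookup X (fromℕ< j<) ≡ false → single j ≢ X
single≢ {j = j} j< q refl with () ← trans (sym q) (single⁺ (fromℕ< j<) (Fin.toℕ-fromℕ< j<))

blocks-Unique : ∀ {n} w → w ≤ n → Unique (blocks {n} w)
blocks-Unique {n} w w≤n = Unique.++⁺ (Unique.tabulate⁺ λ {i} {j} → inj {i} {j}) ([] ∷ []) disj
  where
  single-at : ∀ (i : Fin w) → toℕ i < n
  single-at i = ≤-trans (Fin.toℕ<n i) w≤n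
  inj : ∀ {i j : Fin w} → single {n} (toℕ i) ≡ single (toℕ j) → i ≡ j
  inj {i} {j} p = Fin.toℕ-injective (trans (sym (Fin.toℕ-fromℕ< (single-at i))) (single⁻ (fromℕ< (single-at i))
    (trans (cong (λ X → lookup X (fromℕ< (single-at i))) (sym p)) (single⁺ _ (Fin.toℕ-fromℕ< (single-at i))))))
  disj : Disjoint (tabulate {n = w} (λ i → single {n} (toℕ i))) (mk (λ i → not (does (i <? w))) ∷ [])
  disj (p , here refl) with i , q ← ∈.∈-tabulate⁻ {n = w} {f = λ i → single {n} (toℕ i)} p =
    single≢ (single-at i) (trans (lookup-mk (λ i → not (does (i <? w))) (fromℕ< (single-at i)))
      (cong not (dec-true (_ <? w) (subst (_< w) (sym (Fin.toℕ-fromℕ< (single-at i))) (Fin.toℕ<n i))))) (sym q)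

-- The remaining set has n + 1 - w elements. The hypothesis on `w` avoids the value 2, because
-- two-element sets are reserved for the skeleton.
blocks-card : ∀ {n} w {X : Vec Bool (suc n)} → w ≡ n ⊎ 2 + w ≤ n → X ∈ blocks w → card X ≡ 1 ⊎ 3 ≤ card X
blocks-card {n} w ok p with ∈.∈-++⁻ (tabulate {n = w} (λ i → single (toℕ i))) p
... | inj₁ q with i , refl ← ∈.∈-tabulate⁻ {n = w} {f = λ i → single {suc n} (toℕ i)} q = inj₁ (card-single (≤-trans (Fin.toℕ<n i) (w≤ ok)))
  where
  w≤ : w ≡ n ⊎ 2 + w ≤ n → w ≤ suc n
  w≤ (inj₁ refl) = n≤1+n _
  w≤ (inj₂ q)    = ≤-trans (≤-trans (n≤1+n _) (n≤1+n _)) (≤-trans q (n≤1+n _))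
blocks-card {n} w (inj₁ refl) p | inj₂ (here refl) = inj₁ (trans (card-above w (n≤1+n _)) (m+n∸n≡m 1 n))
blocks-card {n} w (inj₂ r)    p | inj₂ (here refl) = inj₂ (subst (3 ≤_) (sym (card-above w (≤-trans (m≤n+m w 2) (≤-trans r (n≤1+n n)))))
  (m+n≤o⇒m≤o∸n 3 (s≤s r)))

-- The blocks for large n₂.  Replacing the blocks {a} ∪ S, for all small parts a, by X ∪ S
-- with X ∈ blocks w lowers the degrees of the large parts in S to w + 1.
module Saturated {m₂′ : ℕ} (m′ : ℕ) (2≤m′ : 2 ≤ m′) (col : ℕ → Colour (suc m₂′)) (w : ℕ) where

  m₂ = suc m₂′
  j  = jmax m₂
  open Skeleton m′ 2≤m′ col public

  slots : List (Edge m₁ m₂)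
  slots = cartesianProduct (blocks w) (filterᵇ (few j) (subsets m₂))

  inner : List (Edge m₁ m₂)
  inner = map (none ,_) (subsets m₂)

  es : List (Edge m₁ m₂)
  es = skeleton ++ slots ++ inner

  sum-few : ∀ f → sumL f (filterᵇ (few j) (subsets m₂)) ≡ sumL (λ S → ind (few j S) * f S) (subsets m₂)
  sum-few f = sumL-filter (few j) f (subsets m₂)

  degᴬ : ∀ a → count (λ e → has e (inj₁ a)) es ≡ 2 + sumTo (m₂ C_) j
  degᴬ a = trans (sumL-++ _ skeleton _) (cong₂ _+_ (deg-skeleton a) (trans (sumL-++ _ slots inner) (trans
    (cong₂ _+_ (trans (sumL-cong (λ _ → sym (*-identityʳ _)) slots) (trans
        (sumL-× (λ X → ind (lookup X a)) (λ _ → 1) (blocks w) (filterᵇ (few j) (subsets m₂)))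
        (trans (cong₂ _*_ (count-blocks w a) (trans (sum-few _) (sumL-cong (λ _ → *-identityʳ _) (subsets m₂)))) (+-identityʳ _))))
      (trans (sumL-map _ _ (subsets m₂)) (sumL-zero (λ _ → cong ind (lookup-none a)) (subsets m₂))))
    (trans (+-identityʳ _) (count-few m₂ j)))))

  degᴮ : ∀ b → count (λ e → has e (inj₂ b)) es ≡
    ∑ {m₁} (λ g → weight (col (toℕ g)) b) + (suc w * sumTo (m₂′ C_) j + 2 ^ m₂′)
  degᴮ b = trans (sumL-++ _ skeleton _) (cong₂ _+_ (deg-skeletonᴮ b) (trans (sumL-++ _ slots inner) (cong₂ _+_
    (trans (sumL-cong (λ _ → sym (*-identityˡ _)) slots) (trans
      (sumL-× (λ _ → 1) (λ S → ind (lookup S b)) (blocks w) (filterᵇ (few j) (subsets m₂)))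
      (cong₂ _*_ (length-blocks {m₁} w) (trans (sum-few _) (count-few-∋ j b)))))
    (trans (sumL-map _ _ (subsets m₂)) (count-∋ b)))))

  -- Cut labels have ⌊m₂/2⌋ elements, the largest size not selected by `few j`. The blocks at the
  -- cuts are therefore new, and no symmetry can confuse them with `slots`.
  module _ (w-ok : w ≡ m′ ⊎ 2 + w ≤ m′) (apart : LabelsApart)
    (label-co : ∀ {g L R} → g < m₁ → col g ≡ cut L R → co L ≡ suc j × co R ≡ suc j) where

    w≤m₁ : w ≤ m₁
    w≤m₁ = [ (λ { refl → n≤1+n _ }) , (λ q → ≤-trans (m≤n+m w 2) (≤-trans q (n≤1+n _))) ]′ w-ok

    skeleton-kind : ∀ {X S} → (X , S) ∈ skeleton → card X ≡ 2 ⊎ card X ≡ 1 × co S ≡ suc j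
    skeleton-kind p with ∈-skeleton⁻ p
    ... | g , g< , pairᵍ q  = inj₁ (card-pair-gap g<)
    ... | g , g< , leftᵍ q  = inj₂ (card-single (left< g<) , proj₁ (label-co g< q))
    ... | g , g< , rightᵍ q = inj₂ (card-single g< , proj₂ (label-co g< q))

    slots-kind : ∀ {X S} → (X , S) ∈ slots → (card X ≡ 1 ⊎ 3 ≤ card X) × co S < suc j
    slots-kind p with X∈ , S∈ ← ∈.∈-cartesianProduct⁻ (blocks w) (filterᵇ (few j) (subsets m₂)) p =
      blocks-card w w-ok X∈ , does-true (_ <? suc j) (Bool.T-≡ .Equivalence.to (proj₂ (∈.∈-filter⁻ (λ S → Bool.T? (few j S)) {xs = subsets m₂} S∈)))

    inner-kind : ∀ {X S} → (X , S) ∈ inner → card X ≡ 0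
    inner-kind p with _ , _ , refl ← ∈.∈-map⁻ (none ,_) p = card-none {m₁}

    es-Unique : Unique es
    es-Unique = Unique.++⁺ (skeleton-Unique apart) (Unique.++⁺
      (Unique.cartesianProduct⁺ (blocks-Unique w w≤m₁) (Unique.filter⁺ (λ S → Bool.T? (few j S)) (subsets-Unique m₂)))
      (Unique.map⁺ ,-injectiveʳ (subsets-Unique m₂))
      (λ { (p , q) → d₁ (proj₁ (slots-kind p)) (inner-kind q) }))
      (λ { (p , q) → case ∈.∈-++⁻ slots q of λ
        { (inj₁ r) → d₂ (skeleton-kind p) (slots-kind r) ; (inj₂ r) → d₃ (skeleton-kind p) (inner-kind r) } })
      where
      d₁ : ∀ {c} → c ≡ 1 ⊎ 3 ≤ c → c ≢ 0
      d₁ (inj₁ ()) refl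
      d₁ (inj₂ ()) refl
      d₂ : ∀ {c k} → c ≡ 2 ⊎ c ≡ 1 × k ≡ suc j → ¬ ((c ≡ 1 ⊎ 3 ≤ c) × k < suc j)
      d₂ (inj₁ refl) (inj₁ () , _)
      d₂ (inj₁ refl) (inj₂ (s≤s (s≤s ())) , _)
      d₂ (inj₂ (_ , refl)) (_ , p) = <-irrefl refl p
      d₃ : ∀ {c k} → c ≡ 2 ⊎ c ≡ 1 × k ≡ suc j → c ≢ 0
      d₃ (inj₁ ()) refl
      d₃ (inj₂ (() , _)) refl

    es-kind : ∀ {X S} → (X , S) ∈ es → (X , S) ∈ skeleton ⊎
      ((card X ≡ 1 ⊎ 3 ≤ card X) × co S < suc j) ⊎ card X ≡ 0
    es-kind p with ∈.∈-++⁻ skeleton p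
    ... | inj₁ q = inj₁ q
    ... | inj₂ q with ∈.∈-++⁻ slots q
    ...   | inj₁ r = inj₂ (inj₁ (slots-kind r))
    ...   | inj₂ r = inj₂ (inj₂ (inner-kind r))

    pairs : PairsOnly es
    pairs p c with es-kind p
    ... | inj₁ q = skeleton-PairsOnly q c
    ... | inj₂ (inj₁ (inj₁ q , _)) with () ← trans (sym q) c
    ... | inj₂ (inj₁ (inj₂ q , _)) with s≤s (s≤s ()) ← subst (3 ≤_) c q
    ... | inj₂ (inj₂ q) with () ← trans (sym q) c

    data Label (k : ℕ) (S : Vec Bool m₂) : Set where
      atLeft  : ∀ {g R} → g < m₁ → k ≡ left g → col g ≡ cut S R → Label k S
      atRight : ∀ {L} → k < m₁ → col k ≡ cut L S → Label k S

    label-edge : ∀ {k S} → Label k S → (single k , S) ∈ skeleton × co S ≡ suc j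
    label-edge (atLeft g< refl eq) = ∈-skeleton⁺ g< (leftᵍ eq) , proj₁ (label-co g< eq)
    label-edge (atRight k< eq)     = ∈-skeleton⁺ k< (rightᵍ eq) , proj₂ (label-co k< eq)

    edge-label : ∀ {k S} → k < m₁ → (single k , S) ∈ skeleton → Label k S
    edge-label {k} {S} k< p = go (∈-skeleton⁻ p) refl
      where
      go : ∀ {X} → (∃ λ g → g < m₁ × InGap g (X , S)) → X ≡ single k → Label k S
      go (g , g< , pairᵍ q)  r = contradiction r (pair≢single g< k<)
      go (g , g< , leftᵍ q)  r = atLeft g< (single-injective k< (sym r)) q
      go (g , g< , rightᵍ q) r with refl ← single-injective k< (sym r) = atRight k< q

    module Rigidity (s : SplitSymmetry es) where
      open SplitSymmetry s public
      open Images {es} ∈.∈-++⁺ˡ pairs s public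

      -- The image again meets a single small part. It cannot belong to `slots`, since τ keeps the
      -- size of the complement, which is at most j there.
      label-image : ∀ {x S} → Label (toℕ x) S → ∃ λ T → Label (toℕ (σ x)) T × (∀ b → lookup T (τ b) ≡ lookup S b)
      label-image {x} {S} l with p , c ← label-edge l with T , q , h ← single-image {es} s {x} {S} (∈.∈-++⁺ˡ p)
        with es-kind q
      ... | inj₁ r = T , edge-label (Fin.toℕ<n (σ x)) r , h
      ... | inj₂ (inj₁ (_ , r)) = contradiction (trans (card-relabel {X = S} {T} not τ τ⁻ ττ⁻ τ⁻τ h) c) (<⇒≢ r)
      ... | inj₂ (inj₂ r) with () ← trans (sym r) (card-single (Fin.toℕ<n (σ x)))

    distinguishing : ∀ {n₁ n₂} → n₁ ≡ 2 + sumTo (m₂ C_) j →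
      (∀ b → n₂ ≡ ∑ {m₁} (λ g → weight (col (toℕ g)) b) + (suc w * sumTo (m₂′ C_) j + 2 ^ m₂′)) → 1 ≤ n₂ → n₁ ≢ n₂ →
      (∀ (s : SplitSymmetry es) → (∀ a → SplitSymmetry.σ s a ≡ a) × (∀ b → SplitSymmetry.τ s b ≡ b)) →
      HasDistinguishingPartition (K m₁ n₁ m₂ n₂)
    distinguishing {suc n₁} {suc n₂} eq₁ eq₂ (s≤s _) n₁≢n₂ rigid =
      Realize.distinguishing es (λ { (inj₁ a) → trans (degᴬ a) (sym eq₁) ; (inj₂ b) → trans (degᴮ b) (sym (eq₂ b)) }) es-Unique
        λ s → let open SplitOf s (λ p → size-keeps n₁≢n₂ _ p (Symmetry.π-size s p)) in
              trivial (proj₁ (rigid split)) (proj₂ (rigid split))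

-- Skeletons with a single cut

module Line {m₂ : ℕ} (m′ : ℕ) (2≤m′ : 2 ≤ m′) (L R : Vec Bool m₂) (T : ℕ → Vec Bool m₂) where

  col : ℕ → Colour m₂
  col zero    = cut L R
  col (suc g) = edge (T g)

  open Skeleton m′ 2≤m′ col

  not-cut : ∀ k → 1 ≤ k → ∀ {L R} → col k ≢ cut L R
  not-cut (suc k) _ ()

  apart : LabelsApart
  apart {zero}  g< _ q = contradiction q (not-cut m′ (≤-trans (n≤1+n 1) 2≤m′))
  apart {suc g} g< () _

  module LineImages {es : List (Edge m₁ m₂)} (skeleton⊆ : ∀ {e} → e ∈ skeleton → e ∈ es) (pairs : PairsOnly es)
    (s : SplitSymmetry es) where
    open SplitSymmetry s
    open Images {es} skeleton⊆ pairs s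

    consecutive : ∀ {x y} → suc (toℕ x) ≡ toℕ y → ∃ λ h → suc h < m₁ × (∀ b → lookup (T h) (τ b) ≡ lookup (T (toℕ x)) b) ×
      ((toℕ (σ x) ≡ h × toℕ (σ y) ≡ suc h) ⊎ (toℕ (σ x) ≡ suc h × toℕ (σ y) ≡ h))
    consecutive {x} {y} p with edge-image {x = x} {y} (subst (_< m₁) (sym p) (Fin.toℕ<n y)) refl refl (sym p)
    ... | suc h , _ , h< , refl , k , ends = h , h< , k , ends

    adjacent : ∀ {x y} → Adjacent (toℕ x) (toℕ y) → Adjacent (toℕ (σ x)) (toℕ (σ y))
    adjacent {x} {y} (inj₁ p) with consecutive {x} {y} p
    ... | h , _ , _ , inj₁ (q , r) = inj₁ (trans (cong suc q) (sym r))
    ... | h , _ , _ , inj₂ (q , r) = inj₂ (trans (cong suc r) (sym q))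
    adjacent {x} {y} (inj₂ p) with consecutive {y} {x} p
    ... | h , _ , _ , inj₁ (q , r) = inj₂ (trans (cong suc q) (sym r))
    ... | h , _ , _ , inj₂ (q , r) = inj₁ (trans (cong suc r) (sym q))

-- m₂ ≤ 2: a path whose first v edges avoid the large parts, which orients it.
module SaturatedLine {m₂′ : ℕ} (m′ : ℕ) (2≤m′ : 2 ≤ m′) (L R : Vec Bool (suc m₂′)) (v w : ℕ) (1≤v : 1 ≤ v) (v<m′ : v < m′)
  (w-ok : w ≡ m′ ⊎ 2 + w ≤ m′) (co-L : co L ≡ suc (jmax (suc m₂′))) (co-R : co R ≡ suc (jmax (suc m₂′)))
  (R-rigid : ∀ (τ : Fin (suc m₂′) → Fin (suc m₂′)) → (∀ {a b} → τ a ≡ τ b → a ≡ b) →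
    (∀ b → lookup R (τ b) ≡ lookup R b) → ∀ b → τ b ≡ b) where

  T : ℕ → Vec Bool (suc m₂′)
  T g = if does (g <? v) then none else full

  T-none : ∀ {g} → g < v → T g ≡ none
  T-none {g} p = cong (if_then none else full) (dec-true (g <? v) p)

  T-full : ∀ {g} → v ≤ g → T g ≡ full
  T-full {g} p = cong (if_then none else full) (dec-false (g <? v) (≤⇒≯ p))

  open Line m′ 2≤m′ L R T hiding (apart)
  open Saturated m′ 2≤m′ col w

  label-co : ∀ {g L R} → g < m₁ → col g ≡ cut L R → co L ≡ suc j × co R ≡ suc j
  label-co {zero} g< refl = co-L , co-R

  apart : LabelsApart
  apart = Line.apart m′ 2≤m′ L R T

  rigid : (s : SplitSymmetry es) → (∀ a → SplitSymmetry.σ s a ≡ a) × (∀ b → SplitSymmetry.τ s b ≡ b)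
  rigid s = σ-fixed , R-rigid τ (λ {a} {b} q → trans (sym (τ⁻τ a)) (trans (cong τ⁻ q) (τ⁻τ b))) R-fixed
    where
    open Rigidity w-ok apart label-co s
    open LineImages {es} ∈.∈-++⁺ˡ (pairs w-ok apart label-co) s
    open LineImages {es} ∈.∈-++⁺ˡ (pairs w-ok apart label-co) (flip-Split s) using () renaming (adjacent to adjacent⁻)
    open PathAutomorphism σ σ⁻ σσ⁻ σ⁻σ (λ {x} {y} → adjacent {x} {y}) (λ {x} {y} → adjacent⁻ {x} {y})
    1<m₁ : 1 < m₁
    1<m₁ = s≤s (≤-trans (n≤1+n 1) 2≤m′)
    one : Fin m₁
    one = fromℕ< 1<m₁
    -- A reversal would send the first edge, which avoids the large parts as v ≥ 1, to the last one,
    -- which contains them as v < m′.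
    not-last : toℕ (σ zero) ≢ m′
    not-last p with consecutive {zero} {one} (sym (Fin.toℕ-fromℕ< 1<m₁))
    ... | h , h< , k , inj₁ (q , _) = contradiction (trans (sym p) q) λ r → <⇒≢ h< (cong suc (sym r))
    ... | h , h< , k , inj₂ (q , _) = case trans (sym full-at) (trans (k zero) none-at) of λ ()
      where
      v≤h : v ≤ h
      v≤h = s≤s⁻¹ (≤-trans v<m′ (≤-reflexive (trans (sym p) q)))
      full-at : lookup (T h) (τ zero) ≡ true
      full-at = trans (cong (λ X → lookup X (τ zero)) (T-full v≤h)) (lookup-full (τ zero))
      none-at : lookup {n = suc m₂′} (T 0) zero ≡ false
      none-at = trans (cong (λ X → lookup {n = suc m₂′} X zero) (T-none 1≤v)) (lookup-none zero)
    σ0 : σ zero ≡ zero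
    σ0 with end
    ... | inj₁ p = Fin.toℕ-injective p
    ... | inj₂ p = contradiction p not-last
    σ-fixed : ∀ a → σ a ≡ a
    σ-fixed = fixed σ0
    -- Vertex 0 is the right end of gap 0, the only cut, so τ must preserve `R`.
    label-0 : ∀ {k S} → k ≡ 0 → Label w-ok apart label-co k S → S ≡ R
    label-0 refl (atRight _ refl) = refl
    label-0 refl (atLeft {zero} _ p _) = contradiction p λ { refl → case 2≤m′ of λ () }
    R-fixed : ∀ b → lookup R (τ b) ≡ lookup R b
    R-fixed b with S , l , h ← label-image {zero} (atRight (s≤s z≤n) refl) =
      trans (cong (λ X → lookup X (τ b)) (sym (label-0 (cong toℕ σ0) l))) (h b)

  sum-weight : ∀ b → ∑ {m₁} (λ g → weight (col (toℕ g)) b) ≡ ind (lookup L b) + ind (lookup R b) + (m′ ∸ v)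
  sum-weight b = trans (∑-suc _) (cong (ind (lookup L b) + ind (lookup R b) +_)
    (trans (∑-cong λ g → at (toℕ g)) (∑-above v (<⇒≤ v<m′))))
    where
    at : ∀ g → ind (lookup (T g) b) ≡ ind (not (does (g <? v)))
    at g with does (g <? v)
    ... | true  = cong ind (lookup-none b)
    ... | false = cong ind (lookup-full b)

  result : ∀ {n₁ n₂} → n₁ ≡ 2 + sumTo (m₂ C_) j →
    (∀ b → n₂ ≡ ind (lookup L b) + ind (lookup R b) + (m′ ∸ v) + (suc w * sumTo (m₂′ C_) j + 2 ^ m₂′)) → 1 ≤ n₂ → n₁ ≢ n₂ →
    HasDistinguishingPartition (K m₁ n₁ m₂ n₂)
  result p q r n₁≢n₂ = distinguishing w-ok apart label-co p (λ b → trans (q b) (cong (_+ _) (sym (sum-weight b)))) r n₁≢n₂ rigid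

-- Cyclic intervals

module Cyclic (m′ c : ℕ) (0<c : 0 < c) (c<m : c < suc m′) where
  private m = suc m′

  low : ℕ → Bool
  low x = does (x % m <? c)

  low-+ : ∀ x y → low (x % m + y) ≡ low (x + y)
  low-+ x y = cong (λ z → does (z <? c)) (trans (DivMod.%-distribˡ-+ (x % m) y m)
    (trans (cong (λ z → (z + y % m) % m) (DivMod.m%n%n≡m%n x m)) (sym (DivMod.%-distribˡ-+ x y m))))

  ∑-shift : ∀ (F : ℕ → ℕ) k → ∑ {m} (λ b → F ((k + toℕ b) % m)) ≡ ∑ {m} (F ∘ toℕ)
  ∑-shift F zero = ∑-cong λ b → cong F (DivMod.m<n⇒m%n≡m (Fin.toℕ<n b))
  ∑-shift F (suc k) = begin
    ∑ {m} (λ b → F ((suc k + toℕ b) % m))                            ≡⟨ ∑-last m′ (λ b → F ((suc k + b) % m)) ⟩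
    ∑ {m′} (λ b → F ((suc k + toℕ b) % m)) + F ((suc k + m′) % m)    ≡⟨ +-comm _ (F ((suc k + m′) % m)) ⟩
    F ((suc k + m′) % m) + ∑ {m′} (λ b → F ((suc k + toℕ b) % m))    ≡⟨ cong₂ _+_ (cong F wrap) (∑-cong λ b → cong (λ x → F (x % m)) (sym (+-suc k (toℕ b)))) ⟩
    F ((k + 0) % m) + ∑ {m′} (λ b → F ((k + suc (toℕ b)) % m))       ≡⟨ ∑-suc (λ b → F ((k + toℕ b) % m)) ⟨
    ∑ {m} (λ b → F ((k + toℕ b) % m))                                ≡⟨ ∑-shift F k ⟩
    ∑ {m} (F ∘ toℕ)                                                  ∎
    where
    open ≡-Reasoning
    wrap : (suc k + m′) % m ≡ (k + 0) % m
    wrap = trans (cong (_% m) (sym (+-suc k m′))) (trans (DivMod.[m+n]%n≡m%n k m) (cong (_% m) (sym (+-identityʳ k))))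

  -- A run of c consecutive residues with 0 < c < m has just one starting point, a residue in the
  -- run whose predecessor is outside. Shifting by -i makes y = m - i + k such a starting point, so
  -- y ≡ 0.
  separate : ∀ {i k} → i < m → k < m → (∀ b → b < m → low (b + i) ≡ low (b + k)) → i ≡ k
  separate {i} {k} i< k< same = sym (+-cancelˡ-≡ (m ∸ i) k i (trans y≡m (sym (m∸n+n≡m (<⇒≤ i<)))))
    where
    y = m ∸ i + k
    same′ : ∀ b → low (b + i) ≡ low (b + k)
    same′ b = trans (sym (low-+ b i)) (trans (same (b % m) (DivMod.m%n<n b m)) (low-+ b k))
    low-y : y % m < c
    low-y = does-true (_ <? c) (trans (sym (same′ (m ∸ i))) (trans (cong low (m∸n+n≡m (<⇒≤ i<)))
      (dec-true (m % m <? c) (subst (_< c) (sym (DivMod.n%n≡0 m)) 0<c))))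
    high-y : ¬ ((m′ + y) % m < c)
    high-y = does-false (_ <? c) (trans (cong low (sym (+-assoc m′ (m ∸ i) k))) (trans (sym (same′ (m′ + (m ∸ i))))
      (trans (cong low (trans (+-assoc m′ (m ∸ i) i) (cong (m′ +_) (m∸n+n≡m (<⇒≤ i<)))))
      (dec-false ((m′ + m) % m <? c) λ p → <⇒≱ c<m (subst (λ z → suc z ≤ c) (trans (DivMod.[m+n]%n≡m%n m′ m) (DivMod.m<n⇒m%n≡m ≤-refl)) p)))))
    y%m≡0 : y % m ≡ 0
    y%m≡0 with y % m in eq
    ... | zero  = refl
    ... | suc t = contradiction (subst (_< c) (sym pred-%) (≤-trans (n≤1+n _) (subst (_< c) eq low-y))) high-y
      where
      t< : t < m
      t< = ≤-trans (n≤1+n _) (subst (_< m) eq (DivMod.m%n<n y m))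
      pred-% : (m′ + y) % m ≡ t
      pred-% = trans (DivMod.%-distribˡ-+ m′ y m) (trans (cong₂ (λ a b → (a + b) % m) (DivMod.m<n⇒m%n≡m {m = m′} ≤-refl) eq)
        (trans (cong (_% m) (trans (+-suc m′ t) (+-comm m t))) (trans (DivMod.[m+n]%n≡m%n t m) (DivMod.m<n⇒m%n≡m t<))))
    -- y lies strictly between 0 and 2 m, so m is the only multiple of m it can be.
    y≡m : y ≡ m
    y≡m with y / m | trans (DivMod.m≡m%n+[m/n]*n y m) (cong (_+ y / m * m) y%m≡0)
    ... | zero        | p = contradiction p (λ q → <⇒≢ (≤-trans (m<n⇒0<n∸m i<) (m≤m+n (m ∸ i) k)) (sym q))
    ... | suc zero    | p = trans p (+-identityʳ m)
    ... | suc (suc q) | p = contradiction p (<⇒≢ (≤-trans (+-mono-≤-< (m∸n≤m m i) k<) (+-monoʳ-≤ m (m≤m+n m (q * m)))))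

  abstract
    -- A cyclic interval described through its complement, because a cut label is characterised by
    -- the size c of its complement.
    arc : ℕ → Vec Bool m
    arc k = mk λ b → not (low (k + b))

    lookup-arc : ∀ k b → lookup (arc k) b ≡ not (low (k + toℕ b))
    lookup-arc k = lookup-mk λ b → not (low (k + b))

  co-arc : ∀ k → co (arc k) ≡ c
  co-arc k = trans (∑-via (ind ∘ not) (arc k) (lookup-arc k)) (trans (∑-cong λ b → cong ind (Bool.not-involutive (low (k + toℕ b))))
    (trans (∑-shift (λ x → ind (does (x <? c))) k) (∑-below c (<⇒≤ c<m))))

  -- k and b enter `arc` only through k + b, so counting the arcs through b is the same as counting
  -- the points of an arc.
  ∑-arc : ∀ b → ∑ {m} (λ k → ind (lookup (arc (toℕ k)) b)) ≡ m ∸ c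
  ∑-arc b = trans (∑-cong λ k → cong ind (trans (lookup-arc (toℕ k) b) (cong (not ∘ low) (+-comm (toℕ k) (toℕ b)))))
    (trans (∑-shift (λ x → ind (not (does (x <? c)))) (toℕ b)) (∑-above c (<⇒≤ c<m)))

  arc-injective : ∀ {i k} → i < m → k < m → arc i ≡ arc k → i ≡ k
  arc-injective {i} {k} i< k< p = separate i< k< λ b b< → Bool.not-injective (trans (swap i b)
    (trans (sym (at i b<)) (trans (cong (λ S → lookup S (fromℕ< b<)) p) (trans (at k b<) (sym (swap k b))))))
    where
    swap : ∀ i b → not (low (b + i)) ≡ not (low (i + b))
    swap i b = cong (not ∘ low) (+-comm b i)
    at : ∀ i {b} (b< : b < m) → lookup (arc i) (fromℕ< b<) ≡ not (low (i + b))
    at i b< = trans (lookup-arc i (fromℕ< b<)) (cong (λ x → not (low (i + x))) (Fin.toℕ-fromℕ< b<))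

  arcs-separate : ∀ {a b : Fin m} → (∀ k → k < m → lookup (arc k) a ≡ lookup (arc k) b) → a ≡ b
  arcs-separate {a} {b} p = Fin.toℕ-injective (separate (Fin.toℕ<n a) (Fin.toℕ<n b) λ k k< →
    Bool.not-injective (trans (sym (lookup-arc k a)) (trans (p k k<) (lookup-arc k b))))

-- m₂ ≥ 3: a cycle with m₂ cuts, both sides of cut k being joined to the same cyclic interval arc k.
-- Cut 0 is the only one with edges on both sides, and the cycle is traversed from there.
module SaturatedCycle {m₂′ : ℕ} (2≤m₂′ : 2 ≤ m₂′) (ℓ : ℕ) (2≤ℓ : 2 ≤ ℓ) (v : ℕ) (v≤ℓ : v ≤ ℓ) (w : ℕ)
  (w-ok : w ≡ suc (ℓ + m₂′) ⊎ 2 + w ≤ suc (ℓ + m₂′)) (c<m : suc (jmax (suc m₂′)) < suc m₂′) where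

  open Cyclic m₂′ (suc (jmax (suc m₂′))) (s≤s z≤n) c<m

  T : ℕ → Vec Bool (suc m₂′)
  T g = if does (g <? v) then full else none

  -- Order of the gaps: one edge, cut 0, a run of ℓ edges, cuts 1, ..., m₂ - 1. The number v of
  -- edges in the run that contain the large parts is the fine adjustment of n₂.
  col : ℕ → Colour (suc m₂′)
  col zero          = edge full
  col (suc zero)    = cut (arc 0) (arc 0)
  col (suc (suc g)) = if does (g <? ℓ) then edge (T g) else cut (arc (suc (g ∸ ℓ))) (arc (suc (g ∸ ℓ)))

  m′ : ℕ
  m′ = suc (ℓ + m₂′)

  2≤m′ : 2 ≤ m′
  2≤m′ = ≤-trans 2≤ℓ (≤-trans (m≤m+n ℓ m₂′) (n≤1+n _))

  open Saturated m′ 2≤m′ col w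

  col-edge : ∀ {g} → g < ℓ → col (suc (suc g)) ≡ edge (T g)
  col-edge {g} p = cong (if_then edge (T g) else cut (arc (suc (g ∸ ℓ))) (arc (suc (g ∸ ℓ)))) (dec-true (g <? ℓ) p)

  col-beyond : ∀ {g} → ¬ g < ℓ → col (suc (suc g)) ≡ cut (arc (suc (g ∸ ℓ))) (arc (suc (g ∸ ℓ)))
  col-beyond {g} p = cong (if_then edge (T g) else cut (arc (suc (g ∸ ℓ))) (arc (suc (g ∸ ℓ)))) (dec-false (g <? ℓ) p)

  -- The left end of cut k; its right end is `suc (base k)`. Label `arc k` occurs at these two small
  -- parts only.
  base : ℕ → ℕ
  base zero    = 0
  base (suc k) = ℓ + suc k

  col-cut : ∀ k → col (suc (base k)) ≡ cut (arc k) (arc k)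
  col-cut zero    = refl
  col-cut (suc k) rewrite +-suc ℓ k = trans (col-beyond (m+n≮m ℓ k))
    (cong (λ i → cut (arc (suc i)) (arc (suc i))) (m+n∸m≡n ℓ k))

  base< : ∀ {k} → k < m₂ → suc (base k) < m₁
  base< {zero}  p = s≤s (s≤s z≤n)
  base< {suc k} p = s≤s (s≤s (+-monoʳ-≤ ℓ (s≤s⁻¹ p)))

  cut-inv : ∀ {g L R} → g < m₁ → col g ≡ cut L R → ∃ λ k → k < m₂ × g ≡ suc (base k) × L ≡ arc k × R ≡ arc k
  cut-inv {suc zero}    g< refl = 0 , s≤s z≤n , refl , refl , refl
  cut-inv {suc (suc g)} g< p with g <? ℓ
  ... | yes q with () ← trans (sym (col-edge q)) p
  ... | no ¬q with refl ← trans (sym (col-beyond ¬q)) p =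
    suc (g ∸ ℓ) , s≤s (subst (_≤ m₂′) (+-∸-assoc 1 (≮⇒≥ ¬q)) (subst (suc g ∸ ℓ ≤_) (m+n∸m≡n ℓ m₂′) (∸-monoˡ-≤ ℓ (s≤s⁻¹ (s≤s⁻¹ g<))))) ,
    cong suc (trans (cong suc (sym (m+[n∸m]≡n (≮⇒≥ ¬q)))) (sym (+-suc ℓ (g ∸ ℓ)))) , refl , refl

  edge-inv : ∀ {g U} → col g ≡ edge U → g ≡ 0 ⊎ ∃ λ h → h < ℓ × g ≡ suc (suc h)
  edge-inv {zero}        p = inj₁ refl
  edge-inv {suc (suc g)} p with g <? ℓ
  ... | yes q = inj₂ (g , q , refl)
  ... | no ¬q with () ← trans (sym (col-beyond ¬q)) p

  base-injective : ∀ {i k} → base i ≡ base k → i ≡ k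
  base-injective {zero}  {zero}  p = refl
  base-injective {zero}  {suc k} p = contradiction (trans p (+-suc ℓ k)) λ ()
  base-injective {suc i} {zero}  p = contradiction (trans (sym p) (+-suc ℓ i)) λ ()
  base-injective {suc i} {suc k} p = +-cancelˡ-≡ ℓ _ _ p

  apart : LabelsApart
  apart {g} g< p q eq with k , k< , refl , refl , _ ← cut-inv g< p with i , i< , r , _ , refl ← cut-inv {base k} (<⇒≤ g<) q
    with refl ← arc-injective k< i< eq = 1+n≢n (sym r)

  label-co : ∀ {g L R} → g < m₁ → col g ≡ cut L R → co L ≡ suc j × co R ≡ suc j
  label-co g< p with k , _ , _ , refl , refl ← cut-inv g< p = co-arc k , co-arc k

  Lab : ℕ → Vec Bool m₂ → Set
  Lab = Label w-ok apart label-co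

  lab-inv : ∀ {x S} → Lab x S → ∃ λ k → k < m₂ × S ≡ arc k × (x ≡ base k ⊎ x ≡ suc (base k))
  lab-inv (atLeft g< refl p) with k , k< , refl , q , _ ← cut-inv g< p = k , k< , q , inj₁ refl
  lab-inv (atRight g< p)     with k , k< , q , _ , r ← cut-inv g< p    = k , k< , r , inj₂ q

  labˡ : ∀ {k} → k < m₂ → Lab (base k) (arc k)
  labˡ {k} k< = atLeft {g = suc (base k)} (base< k<) refl (col-cut k)

  labʳ : ∀ {k} → k < m₂ → Lab (suc (base k)) (arc k)
  labʳ {k} k< = atRight (base< k<) (col-cut k)

  lab-range : ∀ {x S} → Lab x S → x ≤ 1 ⊎ suc ℓ ≤ x
  lab-range l with lab-inv l
  ... | zero  , _ , _ , inj₁ refl = inj₁ z≤n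
  ... | zero  , _ , _ , inj₂ refl = inj₁ ≤-refl
  ... | suc k , _ , _ , inj₁ refl = inj₂ (subst (suc ℓ ≤_) (sym (+-suc ℓ k)) (s≤s (m≤m+n ℓ k)))
  ... | suc k , _ , _ , inj₂ refl = inj₂ (s≤s (m≤m+n ℓ (suc k)))

  data Edg (x y : ℕ) : Set where
    fwd : ∀ {h U} → h < m₁ → col h ≡ edge U → x ≡ left h → y ≡ h → Edg x y
    bwd : ∀ {h U} → h < m₁ → col h ≡ edge U → y ≡ left h → x ≡ h → Edg x y

  edg-inv : ∀ {x y} → Edg x y → (x ≡ m′ × y ≡ 0) ⊎ (x ≡ 0 × y ≡ m′) ⊎
    ∃ λ g → g < ℓ × ((x ≡ suc g × y ≡ suc (suc g)) ⊎ (x ≡ suc (suc g) × y ≡ suc g))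
  edg-inv (fwd {h} h< p refl refl) with edge-inv {h} p
  ... | inj₁ refl = inj₁ (refl , refl)
  ... | inj₂ (g , g< , refl) = inj₂ (inj₂ (g , g< , inj₁ (refl , refl)))
  edg-inv (bwd {h} h< p refl refl) with edge-inv {h} p
  ... | inj₁ refl = inj₂ (inj₁ (refl , refl))
  ... | inj₂ (g , g< , refl) = inj₂ (inj₂ (g , g< , inj₂ (refl , refl)))

  edg-range : ∀ {x y} → Edg x y → x ≡ 0 ⊎ x ≡ m′ ⊎ x ≤ suc ℓ
  edg-range e with edg-inv e
  ... | inj₁ (p , _) = inj₂ (inj₁ p)
  ... | inj₂ (inj₁ (p , _)) = inj₁ p
  ... | inj₂ (inj₂ (g , g< , inj₁ (refl , _))) = inj₂ (inj₂ (≤-trans g< (n≤1+n ℓ)))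
  ... | inj₂ (inj₂ (g , g< , inj₂ (refl , _))) = inj₂ (inj₂ (s≤s g<))

  no-inner-labels : ∀ {g S S′} → g < ℓ → Lab (suc g) S → Lab (suc (suc g)) S′ → ⊥
  no-inner-labels {g} g< l l′ with lab-range l′
  ... | inj₁ (s≤s ())
  ... | inj₂ p with lab-range l
  ...   | inj₂ q = <⇒≱ g< (s≤s⁻¹ q)
  ...   | inj₁ (s≤s z≤n) = <⇒≱ 2≤ℓ (s≤s⁻¹ p)

  -- In the run from 1 to ℓ + 1 only the two outermost small parts carry labels, and ℓ ≥ 2 keeps
  -- them from being joined by an edge. So an edge with two labelled ends is gap 0.
  labelled-edge : ∀ {x y S S′} → Edg x y → Lab x S → Lab y S′ → x ≡ 0 ⊎ x ≡ m′
  labelled-edge e l l′ with edg-inv e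
  ... | inj₁ (p , _)        = inj₂ p
  ... | inj₂ (inj₁ (p , _)) = inj₁ p
  ... | inj₂ (inj₂ (g , g< , inj₁ (refl , refl))) = ⊥-elim (no-inner-labels g< l l′)
  ... | inj₂ (inj₂ (g , g< , inj₂ (refl , refl))) = ⊥-elim (no-inner-labels g< l′ l)

  base-m₂′ : suc (base m₂′) ≡ m′
  base-m₂′ = lemma m₂′ (≤-trans (n≤1+n 1) 2≤m₂′)
    where
    lemma : ∀ k → 1 ≤ k → suc (base k) ≡ suc (ℓ + k)
    lemma (suc k) _ = refl

  base<m′ : ∀ {k} → k < m₂ → base k < m′
  base<m′ k< = s≤s⁻¹ (base< k<)

  lab-m′ : ∀ {S} → Lab m′ S → S ≡ arc m₂′
  lab-m′ l with lab-inv l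
  ... | k , k< , refl , inj₁ p = contradiction (sym p) (<⇒≢ (base<m′ k<))
  ... | k , k< , refl , inj₂ p = cong arc (base-injective {k} {m₂′} (suc-injective (trans (sym p) (sym base-m₂′))))

  -- Vertex 0 is the one joined by an edge to a labelled vertex and by a label to a vertex on an edge.
  origin : ∀ {x y z u S₁ S₂} → Edg x y → Lab y S₁ → Lab x S₂ → Lab z S₂ → z ≢ x → Edg z u → x ≡ 0
  origin e l₁ l₂ l₃ z≢x e′ with labelled-edge e l₂ l₁
  ... | inj₁ p = p
  -- If x = m′, then z is the other small part labelled `arc m₂′`, namely m′ - 1. As m₂ ≥ 3 it lies
  -- between two cuts, hence on no edge.
  ... | inj₂ refl with refl ← lab-m′ l₂ with lab-inv l₃
  ...   | k , k< , p , q with refl ← arc-injective ≤-refl k< p with q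
  ...     | inj₂ refl = contradiction base-m₂′ z≢x
  ...     | inj₁ refl with edg-range e′
  ...       | inj₁ r = case subst (2 ≤_) (base-injective {m₂′} {0} r) 2≤m₂′ of λ ()
  ...       | inj₂ (inj₁ r) = contradiction (trans base-m₂′ (sym r)) 1+n≢n
  ...       | inj₂ (inj₂ r) = contradiction r (<⇒≱ (s≤s⁻¹ (subst (suc (suc ℓ) <_) (sym base-m₂′)
              (s≤s (subst (_≤ ℓ + m₂′) (+-comm ℓ 2) (+-monoʳ-≤ ℓ 2≤m₂′))))))

  common-base : ∀ {i k} → base k ≡ base i ⊎ base k ≡ suc (base i) → suc (base k) ≡ base i ⊎ suc (base k) ≡ suc (base i) → k ≡ i
  common-base (inj₁ p) _ = base-injective p
  common-base (inj₂ p) (inj₂ q) = base-injective (suc-injective q)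
  common-base (inj₂ p) (inj₁ q) = contradiction (trans p (cong suc (sym q))) (<⇒≢ (s≤s (n≤1+n _)))

  base-lo : ∀ {n i} → n ≡ base i ⊎ n ≡ suc (base i) → base i ≤ n
  base-lo (inj₁ refl) = ≤-refl
  base-lo (inj₂ refl) = n≤1+n _

  base-hi : ∀ {n i} → n ≡ base i ⊎ n ≡ suc (base i) → n ≤ suc (base i)
  base-hi (inj₁ refl) = n≤1+n _
  base-hi (inj₂ refl) = ≤-refl

  label-step : ∀ {x y S} → Lab x S → Lab y S → y ≤ suc x
  label-step p q with lab-inv p | lab-inv q
  ... | i , i< , refl , r | k , k< , eq , t with refl ← arc-injective i< k< eq = ≤-trans (base-hi {i = i} t) (s≤s (base-lo {i = i} r))

  edge-step : ∀ {x y} → 1 ≤ x → x ≤ ℓ → Edg x y → y ≤ suc x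
  edge-step 1≤ ≤ℓ e with edg-inv e
  ... | inj₁ (refl , _) = contradiction ≤ℓ (<⇒≱ (s≤s (m≤m+n ℓ m₂′)))
  ... | inj₂ (inj₁ (refl , _)) with () ← 1≤
  ... | inj₂ (inj₂ (g , _ , inj₁ (refl , refl))) = ≤-refl
  ... | inj₂ (inj₂ (g , _ , inj₂ (refl , refl))) = ≤-trans (n≤1+n _) (n≤1+n _)

  -- Successive small parts are linked by an edge or by a common label. A symmetry keeps both
  -- relations, and `edge-step` and `label-step` bound the image, so being fixed spreads upwards
  -- from 0.
  neighbours : ∀ x → suc x < m₁ → (1 ≤ x × x ≤ ℓ × Edg x (suc x)) ⊎ (∃ λ S → Lab x S × Lab (suc x) S)
  neighbours zero    p = inj₂ (arc 0 , labˡ {0} (s≤s z≤n) , labʳ {0} (s≤s z≤n))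
  neighbours (suc k) p with suc k ≤? ℓ
  ... | yes q = inj₁ (s≤s z≤n , q , fwd {h = suc (suc k)} p (col-edge q) refl refl)
  ... | no ¬q = inj₂ (arc (suc (k ∸ ℓ)) ,
      subst (λ x → Lab x (arc (suc (k ∸ ℓ)))) (sym k≡) (labˡ {suc (k ∸ ℓ)} i<) ,
      subst (λ x → Lab (suc x) (arc (suc (k ∸ ℓ)))) (sym k≡) (labʳ {suc (k ∸ ℓ)} i<))
    where
    k≡ : suc k ≡ ℓ + suc (k ∸ ℓ)
    k≡ = trans (cong suc (sym (m+[n∸m]≡n (s≤s⁻¹ (≰⇒> ¬q))))) (sym (+-suc ℓ (k ∸ ℓ)))
    i< : suc (k ∸ ℓ) < m₂
    i< = s≤s (+-cancelˡ-≤ ℓ (suc (k ∸ ℓ)) m₂′ (subst (_≤ ℓ + m₂′) k≡ (s≤s⁻¹ (s≤s⁻¹ p))))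

  common-arc : ∀ {k S} → Lab (base k) S → Lab (suc (base k)) S → S ≡ arc k
  common-arc {k} p q with lab-inv p | lab-inv q
  ... | i , i< , refl , r | i′ , i′< , eq , t with refl ← arc-injective i< i′< eq = cong arc (sym (common-base {i} {k} r t))

  rigid : (s : SplitSymmetry es) → (∀ a → SplitSymmetry.σ s a ≡ a) × (∀ b → SplitSymmetry.τ s b ≡ b)
  rigid s = σ-fixed , τ-fixed
    where
    open Rigidity w-ok apart label-co s

    edg-image : ∀ {x y} → Edg (toℕ x) (toℕ y) → Edg (toℕ (σ x)) (toℕ (σ y))
    edg-image {x} {y} (fwd h< p q r) with edge-image {x = x} {y} h< p q r
    ... | h , _ , h′< , p′ , _ , inj₁ (q′ , r′) = fwd h′< p′ q′ r′
    ... | h , _ , h′< , p′ , _ , inj₂ (q′ , r′) = bwd h′< p′ r′ q′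
    edg-image {x} {y} (bwd h< p q r) with edge-image {x = y} {x} h< p q r
    ... | h , _ , h′< , p′ , _ , inj₁ (q′ , r′) = bwd h′< p′ q′ r′
    ... | h , _ , h′< , p′ , _ , inj₂ (q′ , r′) = fwd h′< p′ r′ q′

    lab-images : ∀ {x y S} → Lab (toℕ x) S → Lab (toℕ y) S →
      ∃ λ T → Lab (toℕ (σ x)) T × Lab (toℕ (σ y)) T × (∀ b → lookup T (τ b) ≡ lookup S b)
    lab-images {x} {y} l l′ with T , p , h ← label-image {x} l with T′ , q , h′ ← label-image {y} l′ =
      T , p , subst (Lab (toℕ (σ y))) (lookup-ext λ b → subst (λ b → lookup T′ b ≡ lookup T b) (ττ⁻ b)
        (trans (h′ (τ⁻ b)) (sym (h (τ⁻ b))))) q , h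

    at : ∀ {k} → k < m₁ → Fin m₁
    at k< = fromℕ< k<

    lab-at : ∀ {k S} (k< : k < m₁) → Lab k S → Lab (toℕ (at k<)) S
    lab-at {S = S} k< = subst (λ k → Lab k S) (sym (Fin.toℕ-fromℕ< k<))

    edg-at : ∀ {i k} (i< : i < m₁) (k< : k < m₁) → Edg i k → Edg (toℕ (at i<)) (toℕ (at k<))
    edg-at i< k< = subst₂ Edg (sym (Fin.toℕ-fromℕ< i<)) (sym (Fin.toℕ-fromℕ< k<))

    1< : 1 < m₁
    1< = s≤s (s≤s z≤n)
    2< : 2 < m₁
    2< = s≤s 2≤m′
    m′< : m′ < m₁
    m′< = ≤-refl

    first-edge : Edg (toℕ (σ zero)) (toℕ (σ (at m′<)))
    first-edge = edg-image {zero} {at m′<} (edg-at {0} {m′} (s≤s z≤n) m′< (bwd {h = 0} {full} (s≤s z≤n) refl refl refl))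

    second-edge : Edg (toℕ (σ (at 1<))) (toℕ (σ (at 2<)))
    second-edge = edg-image {at 1<} {at 2<} (edg-at {1} {2} 1< 2< (fwd {h = 2} {T 0} 2< (col-edge {0} (≤-trans (n≤1+n 1) 2≤ℓ)) refl refl))

    last-label : ∃ λ S → Lab (toℕ (σ (at m′<))) S
    last-label = case label-image {at m′<} {arc m₂′} (lab-at m′< (subst (λ k → Lab k (arc m₂′)) base-m₂′ (labʳ {m₂′} ≤-refl)))
      of λ { (S , l , _) → S , l }

    0≢1 : toℕ (σ (at 1<)) ≢ toℕ (σ zero)
    0≢1 p = Fin.0≢1+n (sym (σ-injective {at 1<} {zero} (Fin.toℕ-injective p)))

    -- 0 has an edge to the labelled small part m′ and shares `arc 0` with 1, which has an edge to
    -- 2. `origin` applies to the images of 0, m′, 1 and 2.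
    σ0 : σ zero ≡ zero
    σ0 = Fin.toℕ-injective (go (lab-images {zero} {at 1<} {arc 0} (labˡ {0} (s≤s z≤n)) (lab-at 1< (labʳ {0} (s≤s z≤n)))))
      where
      go : (∃ λ S → Lab (toℕ (σ zero)) S × Lab (toℕ (σ (at 1<))) S × (∀ b → lookup S (τ b) ≡ lookup (arc 0) b)) → toℕ (σ zero) ≡ 0
      go (S , l , l′ , _) = origin first-edge (proj₂ last-label) l l′ 0≢1 second-edge

    step : ∀ {x y} → suc (toℕ x) ≡ toℕ y → (∀ i → toℕ i ≤ toℕ x → σ i ≡ i) → toℕ (σ y) ≤ toℕ y
    step {x} {y} xy below = ≤-trans ([ by-edge , by-label ]′ (neighbours (toℕ x) (subst (_< m₁) (sym xy) (Fin.toℕ<n y)))) (≤-reflexive xy)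
      where
      fx : toℕ (σ x) ≡ toℕ x
      fx = cong toℕ (below x ≤-refl)
      by-edge : 1 ≤ toℕ x × toℕ x ≤ ℓ × Edg (toℕ x) (suc (toℕ x)) → toℕ (σ y) ≤ suc (toℕ x)
      by-edge (p , q , e) = edge-step p q (subst (λ n → Edg n (toℕ (σ y))) fx
        (edg-image {x} {y} (subst (Edg (toℕ x)) xy e)))
      by-label : (∃ λ S → Lab (toℕ x) S × Lab (suc (toℕ x)) S) → toℕ (σ y) ≤ suc (toℕ x)
      by-label (S , l , l′) = go (lab-images {x} {y} l (subst (λ n → Lab n S) xy l′))
        where
        go : (∃ λ T → Lab (toℕ (σ x)) T × Lab (toℕ (σ y)) T × (∀ b → lookup T (τ b) ≡ lookup S b)) → toℕ (σ y) ≤ suc (toℕ x)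
        go (T , p , q , _) = label-step (subst (λ n → Lab n T) fx p) q

    σ-fixed : ∀ a → σ a ≡ a
    σ-fixed = fix-all σ σ-injective σ0 (λ {x} {y} → step {x} {y})

    -- With σ trivial, τ carries a label common to both ends of cut k to another such label, and
    -- `arc k` is the only one.
    arc-fixed : ∀ b k → k < m₂ → lookup (arc k) (τ b) ≡ lookup (arc k) b
    arc-fixed b k k< = go (lab-images {at lo} {at (base< k<)} {arc k} (lab-at lo (labˡ {k} k<)) (lab-at (base< k<) (labʳ {k} k<)))
      where
      lo : base k < m₁
      lo = <⇒≤ (base< k<)
      back : ∀ {n S} (n< : n < m₁) → Lab (toℕ (σ (at n<))) S → Lab n S
      back {n} {S} n< = subst (λ i → Lab i S) (trans (cong toℕ (σ-fixed (at n<))) (Fin.toℕ-fromℕ< n<))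
      go : (∃ λ T → Lab (toℕ (σ (at lo))) T × Lab (toℕ (σ (at (base< k<)))) T × (∀ b → lookup T (τ b) ≡ lookup (arc k) b)) →
        lookup (arc k) (τ b) ≡ lookup (arc k) b
      go (T , p , q , h) = trans (cong (λ S → lookup S (τ b)) (sym (common-arc {k} (back lo p) (back (base< k<) q)))) (h b)

    τ-fixed : ∀ b → τ b ≡ b
    τ-fixed b = arcs-separate (arc-fixed b)

  -- Gap 0 contributes 1, the run of edges v, and every arc through b counts once at each end of its
  -- cut.
  sum-weight : ∀ b → ∑ {m₁} (λ g → weight (col (toℕ g)) b) ≡ 1 + v + ((m₂ ∸ suc j) + (m₂ ∸ suc j))
  sum-weight b = begin
    ∑ {m₁} (W ∘ toℕ)                                                  ≡⟨ trans (∑-suc (W ∘ toℕ)) (cong (W 0 +_) (∑-suc (W ∘ toℕ ∘ suc))) ⟩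
    W 0 + (W 1 + ∑ {ℓ + m₂′} (λ g → W (2 + toℕ g)))                  ≡⟨ cong (λ z → W 0 + (W 1 + z)) (∑-split ℓ {m₂′} (λ g → W (2 + g))) ⟩
    W 0 + (W 1 + (∑ {ℓ} (λ g → W (2 + toℕ g)) + ∑ {m₂′} (λ k → W (2 + (ℓ + toℕ k)))))
      ≡⟨ cong₂ _+_ (cong ind (lookup-full b)) (cong (W 1 +_) (cong₂ _+_ low-part high-part)) ⟩
    1 + (hit 0 + hit 0 + (v + (H + H)))                       ≡⟨ rearrange (hit 0) v H ⟩
    1 + v + ((hit 0 + H) + (hit 0 + H))                       ≡⟨ cong (λ z → 1 + v + (z + z)) (trans (sym (∑-suc (λ k → hit (toℕ k)))) (∑-arc b)) ⟩
    1 + v + ((m₂ ∸ suc j) + (m₂ ∸ suc j))                             ∎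
    where
    open ≡-Reasoning
    W : ℕ → ℕ
    W g = weight (col g) b
    hit : ℕ → ℕ
    hit k = ind (lookup (arc k) b)
    H = ∑ {m₂′} (λ k → hit (suc (toℕ k)))
    at : ∀ g → ind (lookup (T g) b) ≡ ind (does (g <? v))
    at g with does (g <? v)
    ... | true  = cong ind (lookup-full b)
    ... | false = cong ind (lookup-none b)
    low-part : ∑ {ℓ} (λ g → W (2 + toℕ g)) ≡ v
    low-part = trans (∑-cong λ g → trans (cong (λ c → weight c b) (col-edge (Fin.toℕ<n g))) (at (toℕ g))) (∑-below v v≤ℓ)
    high-part : ∑ {m₂′} (λ k → W (2 + (ℓ + toℕ k))) ≡ H + H
    high-part = trans (∑-cong λ k → trans (cong (λ g → W (suc g)) (sym (+-suc ℓ (toℕ k)))) (cong (λ c → weight c b) (col-cut (suc (toℕ k)))))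
      (∑-+ (λ k → hit (suc (toℕ k))) (λ k → hit (suc (toℕ k))))
    rearrange : ∀ a v h → 1 + (a + a + (v + (h + h))) ≡ 1 + v + ((a + h) + (a + h))
    rearrange = solve-∀

  result : ∀ {n₁ n₂} → n₁ ≡ 2 + sumTo (m₂ C_) j →
    n₂ ≡ 1 + v + ((m₂ ∸ suc j) + (m₂ ∸ suc j)) + (suc w * sumTo (m₂′ C_) j + 2 ^ m₂′) → 1 ≤ n₂ → n₁ ≢ n₂ →
    HasDistinguishingPartition (K m₁ n₁ m₂ n₂)
  result p q r n₁≢n₂ = distinguishing w-ok apart label-co p (λ b → trans q (cong (_+ _) (sym (sum-weight b)))) r n₁≢n₂ rigid

-- The arrangement for small n₂

∑-splitAt : ∀ m {n} (f : Fin m ⊎ Fin n → ℕ) → ∑ (λ i → f (splitAt m i)) ≡ ∑ (f ∘ inj₁) + ∑ (f ∘ inj₂)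
∑-splitAt zero    f = cong (_+ ∑ (f ∘ inj₂)) (sym (∑-zero {0} {f ∘ inj₁} λ ()))
∑-splitAt (suc m) f = trans (∑-suc (λ i → f (splitAt (suc m) i))) (trans (cong (f (inj₁ zero) +_) (∑-splitAt m (f ∘ Sum.map suc id)))
  (trans (sym (+-assoc (f (inj₁ zero)) _ _)) (cong (_+ ∑ (f ∘ inj₂)) (sym (∑-suc (f ∘ inj₁))))))

total : ∀ {m₁ m₂} → Edge m₁ m₂ → ℕ
total (X , S) = card X + card S

-- Only the total size is invariant here, because `π` is allowed to exchange small and large parts.
total-relabel : ∀ {m₁ m₂} (e e′ : Edge m₁ m₂) (π π⁻ : Part m₁ m₂ → Part m₁ m₂) → (∀ p → π (π⁻ p) ≡ p) → (∀ p → π⁻ (π p) ≡ p) →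
  (∀ p → has e′ (π p) ≡ has e p) → total e′ ≡ total e
total-relabel {m₁} {m₂} e e′ π π⁻ ππ⁻ π⁻π h = trans (sym (∑-splitAt m₁ (ind ∘ has e′))) (trans
  (trans (sym (∑-relabel (λ i → ind (has e′ (splitAt m₁ i))) ρ ρ⁻ (inverse π π⁻ ππ⁻) (inverse π⁻ π π⁻π)))
    (∑-cong λ i → cong ind (trans (cong (has e′) (Fin.splitAt-join m₁ m₂ (π (splitAt m₁ i)))) (h (splitAt m₁ i)))))
  (∑-splitAt m₁ (ind ∘ has e)))
  where
  conj : (Part m₁ m₂ → Part m₁ m₂) → Fin (m₁ + m₂) → Fin (m₁ + m₂)
  conj f i = Fin.join m₁ m₂ (f (splitAt m₁ i))
  ρ ρ⁻ : Fin (m₁ + m₂) → Fin (m₁ + m₂)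
  ρ  = conj π
  ρ⁻ = conj π⁻
  inverse : ∀ f g → (∀ p → f (g p) ≡ p) → ∀ i → conj f (conj g i) ≡ i
  inverse f g fg i = trans (cong (Fin.join m₁ m₂ ∘ f) (Fin.splitAt-join m₁ m₂ (g (splitAt m₁ i))))
    (trans (cong (Fin.join m₁ m₂) (fg (splitAt m₁ i))) (Fin.join-splitAt m₁ m₂ i))

below above : ∀ {n} → ℕ → Vec Bool n
below c = mk λ i → does (i <? c)
above c = mk λ i → not (does (i <? c))

card-below : ∀ {n} c → c ≤ n → card {n} (below c) ≡ c
card-below c p = trans (∑-via ind (below c) (lookup-mk λ i → does (i <? c))) (∑-below c p)

∑-window : ∀ n b k → b + k ≤ n → ∑ {n} (λ g → ind (does (b ≤? toℕ g) ∧ does (toℕ g <? b + k))) ≡ k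
∑-window n       zero    k p = ∑-below k p
∑-window (suc n) (suc b) k p = trans (∑-suc (λ g → ind (does (suc b ≤? toℕ g) ∧ does (toℕ g <? suc b + k))))
  (trans (∑-cong λ g → cong (λ z → ind (z ∧ does (toℕ g <? b + k))) (shift b (toℕ g))) (∑-window n b k (s≤s⁻¹ p)))
  where
  shift : ∀ b g → does (suc b ≤? suc g) ≡ does (b ≤? g)
  shift zero    g = refl
  shift (suc b) g = refl

-- The blocks for small n₂: a path with n₂ consecutive blocks containing each large part,
-- and N cuts of the path into an initial and a final segment that are longer than any other block.
module Sparse {m₂ : ℕ} (m′ : ℕ) (2≤m′ : 2 ≤ m′) (N n₂ : ℕ) (1≤N : 1 ≤ N) (1≤n₂ : 1 ≤ n₂) (room : m₂ + n₂ ≤ m′)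
  (long : (3 + m₂ + N) + (3 + m₂ + N) ≤ suc m′) where

  -- Large part b lies on the path edges b, ..., b + n₂ - 1. Different starting points tell the
  -- large parts apart once the path is fixed.
  window : ℕ → ℕ → Bool
  window g b = does (b ≤? g) ∧ does (g <? b + n₂)

  T : ℕ → Vec Bool m₂
  T g = mk (window g)

  lookup-T : ∀ g b → lookup (T g) b ≡ window g (toℕ b)
  lookup-T g = lookup-mk (window g)

  open Line m′ 2≤m′ none none T
  open Skeleton m′ 2≤m′ col

  -- A block of the skeleton meets at most 2 + m₂ parts, so segments of length at least 3 + m₂
  -- exceed all of them.
  c : ℕ
  c = 3 + m₂

  cutAt : ℕ → List (Edge m₁ m₂)
  cutAt t = (below (c + t) , none) ∷ (above (c + t) , none) ∷ []

  cuts es : List (Edge m₁ m₂)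
  cuts = concat (tabulate {n = N} (cutAt ∘ toℕ))
  es   = skeleton ++ cuts

  c+t≤ : ∀ {t} → t < N → c + t < c + N
  c+t≤ = +-monoʳ-< c

  c+N≤ : c + N ≤ m₁
  c+N≤ = ≤-trans (m≤m+n _ _) long

  data InCut (X : Vec Bool m₁) (S : Vec Bool m₂) : Set where
    initial : ∀ {t} → t < N → X ≡ below (c + t) → card X ≡ c + t → S ≡ none → InCut X S
    final   : ∀ {t} → t < N → X ≡ above (c + t) → card X ≡ m₁ ∸ (c + t) → S ≡ none → InCut X S

  in-cutAt : ∀ {t X S} → t < N → (X , S) ∈ cutAt t → InCut X S
  in-cutAt t< (here refl)         = initial t< refl (card-below _ (≤-trans (<⇒≤ (c+t≤ t<)) c+N≤)) refl
  in-cutAt t< (there (here refl)) = final t< refl (card-above _ (≤-trans (<⇒≤ (c+t≤ t<)) c+N≤)) refl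

  in-cuts : ∀ {X S} → (X , S) ∈ cuts → InCut X S
  in-cuts p with xs , e∈ , xs∈ ← ∈.∈-concat⁻′ (tabulate (cutAt ∘ toℕ)) p
    with t , refl ← ∈.∈-tabulate⁻ {n = N} {f = cutAt ∘ toℕ} xs∈ = in-cutAt (Fin.toℕ<n t) e∈

  -- All initial segments have fewer than c + N small parts, so no final segment has the size of an
  -- initial one.
  final-long : ∀ {t} → t < N → c + N ≤ m₁ ∸ (c + t)
  final-long {t} t< = m+n≤o⇒m≤o∸n (c + N) (≤-trans (+-monoʳ-≤ (c + N) (<⇒≤ (c+t≤ t<))) long)

  cut-card : ∀ {X S} → InCut X S → c ≤ card X
  cut-card (initial {t} t< _ p _) = ≤-trans (m≤m+n c t) (≤-reflexive (sym p))
  cut-card (final t< _ p _)   = ≤-trans (≤-trans (m≤m+n c N) (final-long t<)) (≤-reflexive (sym p))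

  cut-none : ∀ {X S} → InCut X S → S ≡ none
  cut-none (initial _ _ _ p) = p
  cut-none (final _ _ _ p)   = p

  initial≢final : ∀ {t u} → t < N → u < N → c + t ≢ m₁ ∸ (c + u)
  initial≢final t< u< p = <⇒≱ (c+t≤ t<) (≤-trans (final-long u<) (≤-reflexive (sym p)))

  skeleton-card : ∀ {X S} → (X , S) ∈ skeleton → card X ≤ 2
  skeleton-card p with ∈-skeleton⁻ p
  ... | g , g< , pairᵍ q  = ≤-reflexive (card-pair-gap g<)
  ... | g , g< , leftᵍ q  = ≤-trans (≤-reflexive (card-single (left< g<))) (s≤s z≤n)
  ... | g , g< , rightᵍ q = ≤-trans (≤-reflexive (card-single g<)) (s≤s z≤n)

  es-Unique : Unique es
  es-Unique = Unique.++⁺ (skeleton-Unique (Line.apart m′ 2≤m′ none none T))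
    (Unique.concat⁺ (All.tabulate⁺ {n = N} (λ t → each (Fin.toℕ<n t)))
      (AllPairs.tabulate⁺ {n = N} λ {i} {k} i≢k (p , q) → i≢k (Fin.toℕ-injective (same (Fin.toℕ<n i) (Fin.toℕ<n k) p q))))
    λ { (p , q) → <⇒≱ (s≤s (skeleton-card p)) (≤-trans (m≤m+n 3 m₂) (cut-card (in-cuts q))) }
    where
    card-initial : ∀ {t} → t < N → card {m₁} (below (c + t)) ≡ c + t
    card-initial t< = card-below _ (≤-trans (<⇒≤ (c+t≤ t<)) c+N≤)
    card-final : ∀ {t} → t < N → card {m₁} (above (c + t)) ≡ m₁ ∸ (c + t)
    card-final t< = card-above _ (≤-trans (<⇒≤ (c+t≤ t<)) c+N≤)
    clash : ∀ {t u} → t < N → u < N → below {m₁} (c + t) ≢ above (c + u)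
    clash t< u< p = initial≢final t< u< (trans (sym (card-initial t<)) (trans (cong card p) (card-final u<)))
    each : ∀ {t} → t < N → Unique (cutAt t)
    each t< = ((clash t< t< ∘ cong proj₁) ∷ []) ∷ ([] ∷ [])
    same′ : ∀ {t u e f} → t < N → u < N → e ∈ cutAt t → f ∈ cutAt u → e ≡ f → t ≡ u
    same′ t< u< (here refl) (here refl) r = +-cancelˡ-≡ c _ _ (trans (sym (card-initial t<)) (trans (cong (card ∘ proj₁) r) (card-initial u<)))
    same′ t< u< (here refl) (there (here refl)) r = contradiction (cong proj₁ r) (clash t< u<)
    same′ t< u< (there (here refl)) (here refl) r = contradiction (cong proj₁ (sym r)) (clash u< t<)
    same′ t< u< (there (here refl)) (there (here refl)) r = +-cancelˡ-≡ c _ _ (∸-cancelˡ-≡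
      (≤-trans (<⇒≤ (c+t≤ t<)) c+N≤) (≤-trans (<⇒≤ (c+t≤ u<)) c+N≤)
      (trans (sym (card-final t<)) (trans (cong (card ∘ proj₁) r) (card-final u<))))
    same : ∀ {t u e} → t < N → u < N → e ∈ cutAt t → e ∈ cutAt u → t ≡ u
    same t< u< p q = same′ t< u< p q refl

  pairs : PairsOnly es
  pairs p card≡2 with ∈.∈-++⁻ skeleton p
  ... | inj₁ q = skeleton-PairsOnly q card≡2
  ... | inj₂ q with s≤s (s≤s ()) ← subst (3 ≤_) card≡2 (≤-trans (m≤m+n 3 m₂) (cut-card (in-cuts q)))

  degᴬ : ∀ a → count (λ e → has e (inj₁ a)) es ≡ 2 + N
  degᴬ a = trans (sumL-++ (λ e → ind (has e (inj₁ a))) skeleton cuts) (cong₂ _+_ (deg-skeleton a)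
    (trans (sumL-concat-tabulate {n = N} (λ e → ind (has e (inj₁ a))) (cutAt ∘ toℕ)) (trans (∑-cong {N} (at ∘ toℕ)) (∑-ones N))))
    where
    at : ∀ t → count (λ e → has e (inj₁ a)) (cutAt t) ≡ 1
    at t = trans (cong₂ _+_ (cong ind (lookup-mk (λ i → does (i <? c + t)) a)) (trans (+-identityʳ _) (cong ind (lookup-mk (λ i → not (does (i <? c + t))) a))))
      (ind-not (does (toℕ a <? c + t)))

  degᴮ : ∀ b → count (λ e → has e (inj₂ b)) es ≡ n₂
  degᴮ b = trans (sumL-++ (λ e → ind (has e (inj₂ b))) skeleton cuts) (trans (cong₂ _+_ (trans (deg-skeletonᴮ b) on-path)
    (trans (sumL-concat-tabulate {n = N} (λ e → ind (has e (inj₂ b))) (cutAt ∘ toℕ)) (∑-zero {N} λ t → cong₂ _+_ (cong ind (lookup-none b)) (trans (+-identityʳ _) (cong ind (lookup-none b))))))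
    (+-identityʳ n₂))
    where
    on-path : ∑ {m₁} (λ g → weight (col (toℕ g)) b) ≡ n₂
    on-path = trans (∑-suc (λ g → weight (col (toℕ g)) b)) (trans (cong₂ _+_ (cong₂ _+_ (cong ind (lookup-none b)) (cong ind (lookup-none b)))
      (∑-cong λ g → cong ind (lookup-T (toℕ g) b))) (∑-window m′ (toℕ b) n₂ (≤-trans (+-monoˡ-≤ n₂ (<⇒≤ (Fin.toℕ<n b))) room)))

  ∈-cuts : ∀ {e} → e ∈ cutAt 0 → e ∈ es
  ∈-cuts p = ∈.∈-++⁺ʳ skeleton (∈.∈-concat⁺′ {vs = cutAt 0} p
    (subst (λ t → cutAt t ∈ tabulate {n = N} (cutAt ∘ toℕ)) (Fin.toℕ-fromℕ< 1≤N) (∈.∈-tabulate⁺ {f = cutAt ∘ toℕ} (fromℕ< 1≤N))))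

  rigid : (s : SplitSymmetry es) → (∀ a → SplitSymmetry.σ s a ≡ a) × (∀ b → SplitSymmetry.τ s b ≡ b)
  rigid s = σ-fixed , λ b → Fin.toℕ-injective (≤-antisym (τ≤ b) (≤-trans (≤-reflexive (cong toℕ (sym (τ⁻τ b)))) (τ⁻≤ (τ b))))
    where
    open SplitSymmetry s
    module F = LineImages {es} ∈.∈-++⁺ˡ pairs s
    module G = LineImages {es} ∈.∈-++⁺ˡ pairs (flip-Split s)
    open PathAutomorphism σ σ⁻ σσ⁻ σ⁻σ (λ {x} {y} → F.adjacent {x} {y}) (λ {x} {y} → G.adjacent {x} {y})

    -- The initial segment of length c is the only block with exactly c small parts. It must be
    -- preserved, which rules out the reversal of the path.
    near-start : ∀ {X S} → (X , S) ∈ es → card X ≡ c → lookup X (σ zero) ≡ true → toℕ (σ zero) < c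
    near-start p q r with ∈.∈-++⁻ skeleton p
    ... | inj₁ p′ = contradiction (skeleton-card p′) (<⇒≱ (≤-trans (s≤s (s≤s (s≤s z≤n))) (≤-reflexive (sym q))))
    ... | inj₂ p′ with in-cuts p′
    ...   | final t< _ q′ _ = contradiction (trans (+-identityʳ c) (trans (sym q) q′)) (initial≢final {0} 1≤N t<)
    ...   | initial {t} t< refl q′ _ with refl ← +-cancelˡ-≡ c t 0 (trans (sym q′) (trans q (sym (+-identityʳ c)))) =
      subst (toℕ (σ zero) <_) (+-identityʳ c) (does-true (toℕ (σ zero) <? c + 0) (trans (sym (lookup-mk (λ i → does (i <? c + 0)) (σ zero))) r))

    σ0<c : toℕ (σ zero) < c
    σ0<c = go (image (∈-cuts (here refl)))
      where
      go : (∃ λ X′ → ∃ λ S′ → (X′ , S′) ∈ es × (∀ a → lookup X′ (σ a) ≡ lookup (below (c + 0)) a) × (∀ b → lookup S′ (τ b) ≡ lookup none b)) → toℕ (σ zero) < c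
      go (X′ , S′ , e∈ , hX , _) = near-start e∈
        (trans (card-relabel {X = below (c + 0)} {X′} id σ σ⁻ σσ⁻ σ⁻σ hX) (trans (card-below (c + 0) (≤-trans (<⇒≤ (c+t≤ 1≤N)) c+N≤)) (+-identityʳ c)))
        (hX zero)

    c≤m′ : c ≤ m′
    c≤m′ = s≤s⁻¹ (≤-trans (s≤s (m≤m+n c N)) (≤-trans (+-monoˡ-≤ (c + N) {1} {c + N} (s≤s z≤n)) long))

    σ-fixed : ∀ a → σ a ≡ a
    σ-fixed = fixed (Fin.toℕ-injective ([ id , (λ p → contradiction (≤-trans σ0<c c≤m′) (<⇒≱ (s≤s (≤-reflexive (sym p))))) ]′ end))

    -- Path edge b is fixed and contains large part b, while it contains no large part beyond b.
    -- Applied to the inverse as well, the inequality becomes τ b = b.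
    τ≤′ : (s : SplitSymmetry es) → (∀ a → SplitSymmetry.σ s a ≡ a) → ∀ b → toℕ (SplitSymmetry.τ s b) ≤ toℕ b
    τ≤′ s fx b = go (consecutive {x} {y} (trans (cong suc (Fin.toℕ-fromℕ< b<m₁)) (sym (Fin.toℕ-fromℕ< b<m′))))
      where
      open LineImages {es} ∈.∈-++⁺ˡ pairs s
      b<m′ : suc (toℕ b) < m₁
      b<m′ = s≤s (≤-trans (Fin.toℕ<n b) (≤-trans (m≤m+n m₂ n₂) room))
      b<m₁ : toℕ b < m₁
      b<m₁ = <⇒≤ b<m′
      x y : Fin m₁
      x = fromℕ< b<m₁
      y = fromℕ< b<m′
      self : lookup (T (toℕ x)) b ≡ true
      self = trans (lookup-T (toℕ x) b) (trans (cong (λ n → window n (toℕ b)) (Fin.toℕ-fromℕ< b<m₁))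
        (cong₂ _∧_ (dec-true (toℕ b ≤? toℕ b) ≤-refl) (dec-true (toℕ b <? toℕ b + n₂) (subst (_≤ toℕ b + n₂) (+-comm (toℕ b) 1) (+-monoʳ-≤ (toℕ b) 1≤n₂)))))
      ∧-fst : ∀ {p q} → p ∧ q ≡ true → p ≡ true
      ∧-fst {true} _ = refl
      conclude : ∀ {h} → h ≡ toℕ x → lookup (T h) (SplitSymmetry.τ s b) ≡ lookup (T (toℕ x)) b → toℕ (SplitSymmetry.τ s b) ≤ toℕ b
      conclude {h} p q = ≤-trans (does-true (toℕ (SplitSymmetry.τ s b) ≤? h) (∧-fst (trans (sym (lookup-T h (SplitSymmetry.τ s b))) (trans q self))))
        (≤-reflexive (trans p (Fin.toℕ-fromℕ< b<m₁)))
      go : (∃ λ h → suc h < m₁ × (∀ b → lookup (T h) (SplitSymmetry.τ s b) ≡ lookup (T (toℕ x)) b) ×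
        ((toℕ (SplitSymmetry.σ s x) ≡ h × toℕ (SplitSymmetry.σ s y) ≡ suc h) ⊎ (toℕ (SplitSymmetry.σ s x) ≡ suc h × toℕ (SplitSymmetry.σ s y) ≡ h))) →
        toℕ (SplitSymmetry.τ s b) ≤ toℕ b
      go (h , _ , k , inj₁ (p , _)) = conclude (trans (sym p) (cong toℕ (fx x))) (k b)
      go (h , _ , k , inj₂ (p , q)) = contradiction
        (trans (cong suc (trans (sym (Fin.toℕ-fromℕ< b<m₁)) (trans (cong toℕ (sym (fx x))) p))) (cong suc (cong suc (trans (sym q) (trans (cong toℕ (fx y)) (Fin.toℕ-fromℕ< b<m′))))))
        (<⇒≢ (s≤s (s≤s (n≤1+n _))))

    τ≤ : ∀ b → toℕ (τ b) ≤ toℕ b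
    τ≤ = τ≤′ s σ-fixed
    τ⁻≤ : ∀ b → toℕ (τ⁻ b) ≤ toℕ b
    τ⁻≤ = τ≤′ (flip-Split s) λ a → trans (cong σ⁻ (sym (σ-fixed a))) (σ⁻σ a)

  -- The small parts are the ones that meet a block of size at least c.
  A-kept : ∀ {n₁ n₂} (s : Symmetry n₁ n₂ es) a → isA (Symmetry.π s (inj₁ a)) ≡ true
  A-kept s a = go (does (toℕ a <? c + 0)) refl
    where
    open Symmetry s
    in-cut : ∀ {X S} → (X , S) ∈ es → c ≤ total (X , S) → S ≡ none
    in-cut {X} {S} p q with ∈.∈-++⁻ skeleton p
    ... | inj₁ r = contradiction q (<⇒≱ (+-mono-≤ (s≤s (skeleton-card r)) (card≤ S)))
    ... | inj₂ r = cut-none (in-cuts r)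
    meets : ∀ {X S} p → S ≡ none → has (X , S) p ≡ true → isA p ≡ true
    meets (inj₁ _) _ _ = refl
    meets (inj₂ b) refl q = case trans (sym q) (lookup-none b) of λ ()
    use : ∀ {X S} → (X , S) ∈ cutAt 0 → lookup X a ≡ true → isA (π (inj₁ a)) ≡ true
    use {X} {S} p q = finish (π-pres (∈-cuts p))
      where
      finish : (∃ λ e′ → e′ ∈ es × (∀ p → has e′ (π p) ≡ has (X , S) p)) → isA (π (inj₁ a)) ≡ true
      finish (e′ , e∈ , h) = meets (π (inj₁ a)) (in-cut e∈ (≤-trans (≤-trans (cut-card (in-cutAt 1≤N p)) (m≤m+n (card X) (card S)))
        (≤-reflexive (sym (total-relabel (X , S) e′ π π⁻ ππ⁻ π⁻π h))))) (trans (h (inj₁ a)) q)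
    go : ∀ z → does (toℕ a <? c + 0) ≡ z → isA (π (inj₁ a)) ≡ true
    go true  p = use (here refl) (trans (lookup-mk (λ i → does (i <? c + 0)) a) p)
    go false p = use (there (here refl)) (trans (lookup-mk (λ i → not (does (i <? c + 0))) a) (cong not p))

  kept : ∀ {n₁ n₂} (s : Symmetry n₁ n₂ es) p → isA (Symmetry.π s p) ≡ isA p
  kept s (inj₁ a) = A-kept s a
  kept s (inj₂ b) = Bool.¬-not λ q → case (fromA (π (inj₂ b)) q) of λ { (a , r) →
    case trans (sym (A-kept (flip-Symmetry s) a)) (cong isA (trans (cong π⁻ (sym r)) (π⁻π (inj₂ b)))) of λ () }
    where open Symmetry s

  result : HasDistinguishingPartition (K m₁ (2 + N) m₂ n₂)
  result = lemma n₂ 1≤n₂ refl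
    where
    lemma : ∀ n → 1 ≤ n → n ≡ n₂ → HasDistinguishingPartition (K m₁ (2 + N) m₂ n)
    lemma (suc n) _ eq = Realize.distinguishing es (λ { (inj₁ a) → degᴬ a ; (inj₂ b) → trans (degᴮ b) (sym eq) }) es-Unique
      λ s → let open SplitOf s (kept s) in trivial (proj₁ (rigid split)) (proj₂ (rigid split))

-- m₂ = 1 and n₂ = 2 m₁: every block contains the large part, the path is 0, …, m₁ − 1, and the only
-- other block with several small parts is {0, 1, m₁ − 1}.
module Theta (k : ℕ) (2≤k : 2 ≤ k) where

  m′ m₁ : ℕ
  m′ = suc k
  m₁ = suc m′

  triple : Vec Bool m₁
  triple = mk λ i → does (i ≟ 0) ∨ (does (i ≟ 1) ∨ does (i ≟ m′))

  lookup-triple : ∀ i → lookup triple i ≡ does (toℕ i ≟ 0) ∨ (does (toℕ i ≟ 1) ∨ does (toℕ i ≟ m′))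
  lookup-triple = lookup-mk λ i → does (i ≟ 0) ∨ (does (i ≟ 1) ∨ does (i ≟ m′))

  steps tails Xs : List (Vec Bool m₁)
  steps = tabulate {n = m′} (λ g → pair (toℕ g) (suc (toℕ g)))
  tails = tabulate {n = k} (λ g → single (2 + toℕ g))
  Xs    = none ∷ triple ∷ single 0 ∷ (steps ++ tails)

  es : List (Edge m₁ 1)
  es = map (_, full) Xs

  1≢m′ : 1 ≢ m′
  1≢m′ p = <⇒≢ (≤-trans 2≤k (n≤1+n k)) p

  ind-triple : ∀ i → ind (does (i ≟ 0) ∨ (does (i ≟ 1) ∨ does (i ≟ m′))) ≡ ind (does (i ≟ 0)) + (ind (does (i ≟ 1)) + ind (does (i ≟ m′)))
  ind-triple i = trans (ind-∨ λ p q → [ (λ r → case trans (sym (does-true (i ≟ 0) p)) (does-true (i ≟ 1) r) of λ ()) ,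
      (λ r → case trans (sym (does-true (i ≟ 0) p)) (does-true (i ≟ m′) r) of λ ()) ]′ (∨-true q))
    (cong (ind (does (i ≟ 0)) +_) (ind-∨-≟ i 1≢m′))

  card-triple : card triple ≡ 3
  card-triple = trans (∑-via ind triple lookup-triple) (trans (∑-cong {m₁} (λ i → ind-triple (toℕ i)))
    (trans (∑-+ {m₁} (λ i → ind (does (toℕ i ≟ 0))) (λ i → ind (does (toℕ i ≟ 1)) + ind (does (toℕ i ≟ m′))))
      (cong₂ _+_ (∑-point {m₁} {0} (s≤s z≤n)) (trans (∑-+ {m₁} (λ i → ind (does (toℕ i ≟ 1))) (λ i → ind (does (toℕ i ≟ m′))))
        (cong₂ _+_ (∑-point {m₁} {1} (s≤s (s≤s z≤n))) (∑-point {m₁} {m′} ≤-refl))))))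

  data Shape (X : Vec Bool m₁) : Set where
    is-none   : X ≡ none → Shape X
    is-triple : X ≡ triple → Shape X
    is-step   : ∀ {g} → g < m′ → X ≡ pair g (suc g) → Shape X
    is-single : ∀ {g} → g < m₁ → g ≢ 1 → X ≡ single g → Shape X

  shape : ∀ {X} → X ∈ Xs → Shape X
  shape (here p) = is-none p
  shape (there (here p)) = is-triple p
  shape (there (there (here p))) = is-single (s≤s z≤n) (λ ()) p
  shape (there (there (there p))) with ∈.∈-++⁻ steps p
  ... | inj₁ q with g , r ← ∈.∈-tabulate⁻ {f = λ g → pair {m₁} (toℕ g) (suc (toℕ g))} q = is-step (Fin.toℕ<n g) r
  ... | inj₂ q with g , r ← ∈.∈-tabulate⁻ {f = λ g → single {m₁} (2 + toℕ g)} q = is-single (s≤s (s≤s (Fin.toℕ<n g))) (λ ()) r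

  card-step : ∀ {g} → g < m′ → card {m₁} (pair g (suc g)) ≡ 2
  card-step p = card-pair (≤-trans p (n≤1+n _)) (s≤s p) (λ q → 1+n≢n (sym q))

  open Skeleton {1} m′ (≤-trans 2≤k (n≤1+n k)) (λ _ → edge full) using (single-injective; single-image; pair-gap-injective)

  Xs-Unique : Unique Xs
  Xs-Unique = All.tabulate (λ p q → not-none (cong card q) p) ∷ All.tabulate (λ p q → not-triple (cong card q) p) ∷
    All.tabulate (λ p q → not-0 q p) ∷
    Unique.++⁺ (Unique.tabulate⁺ λ {i} {j} p → Fin.toℕ-injective (suc-injective (pair-gap-injective {suc (toℕ i)} {suc (toℕ j)} (s≤s (Fin.toℕ<n i)) (s≤s (Fin.toℕ<n j)) p)))
      (Unique.tabulate⁺ λ {i} {j} p → Fin.toℕ-injective (suc-injective (suc-injective (single-injective (s≤s (s≤s (Fin.toℕ<n i))) p))))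
      λ { (p , q) → disj p q }
    where
    step-card : ∀ {X} → X ∈ steps → card X ≡ 2
    step-card p with g , refl ← ∈.∈-tabulate⁻ {f = λ g → pair {m₁} (toℕ g) (suc (toℕ g))} p = card-step (Fin.toℕ<n g)
    tail-card : ∀ {X} → X ∈ tails → card X ≡ 1
    tail-card p with g , refl ← ∈.∈-tabulate⁻ {f = λ g → single {m₁} (2 + toℕ g)} p = card-single (s≤s (s≤s (Fin.toℕ<n g)))
    disj : ∀ {X} → X ∈ steps → X ∉ tails
    disj p q with () ← trans (sym (step-card p)) (tail-card q)
    rest-card : ∀ {X} → X ∈ steps ++ tails → card X ≡ 2 ⊎ card X ≡ 1
    rest-card p = Sum.map step-card tail-card (∈.∈-++⁻ steps p)
    not-none : ∀ {X} → card {m₁} none ≡ card X → X ∉ triple ∷ single 0 ∷ (steps ++ tails)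
    not-none q (here refl) with () ← trans (sym (card-none {m₁})) (trans q card-triple)
    not-none q (there (here refl)) with () ← trans (sym (card-none {m₁})) (trans q (card-single (s≤s z≤n)))
    not-none q (there (there p)) with rest-card p
    ... | inj₁ r with () ← trans (sym (card-none {m₁})) (trans q r)
    ... | inj₂ r with () ← trans (sym (card-none {m₁})) (trans q r)
    not-triple : ∀ {X} → card triple ≡ card X → X ∉ single 0 ∷ (steps ++ tails)
    not-triple q (here refl) with () ← trans (sym card-triple) (trans q (card-single (s≤s z≤n)))
    not-triple q (there p) with rest-card p
    ... | inj₁ r with () ← trans (sym card-triple) (trans q r)
    ... | inj₂ r with () ← trans (sym card-triple) (trans q r)
    not-0 : ∀ {X} → single 0 ≡ X → X ∉ steps ++ tails
    not-0 refl p with ∈.∈-++⁻ steps p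
    ... | inj₁ r with () ← trans (sym (step-card r)) (card-single (s≤s z≤n))
    ... | inj₂ r with g , q ← ∈.∈-tabulate⁻ {f = λ g → single {m₁} (2 + toℕ g)} r with () ← single-injective (s≤s z≤n) q

  degᴮ : ∀ b → count (λ e → has e (inj₂ b)) es ≡ 2 * m₁
  degᴮ b = trans (sumL-map (λ e → ind (has e (inj₂ b))) (_, full) Xs) (trans (sumL-cong (λ _ → cong ind (lookup-full b)) Xs)
    (trans (cong (3 +_) (trans (sumL-++ (λ _ → 1) steps tails) (cong₂ _+_ (trans (sumL-tabulate {n = m′} (λ _ → 1) (λ g → pair {m₁} (toℕ g) (suc (toℕ g)))) (∑-ones m′))
      (trans (sumL-tabulate {n = k} (λ _ → 1) (λ g → single {m₁} (2 + toℕ g))) (∑-ones k))))) (arith k)))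
    where
    arith : ∀ k → 3 + (suc k + k) ≡ 2 * (2 + k)
    arith = solve-∀

  degᴬ : ∀ a → count (λ e → has e (inj₁ a)) es ≡ 3
  degᴬ a = trans (sumL-map (λ e → ind (has e (inj₁ a))) (_, full) Xs) (trans (cong₂ _+_ (cong ind (lookup-none a)) (cong₂ _+_ (trans (cong ind (lookup-triple a)) (ind-triple i))
      (cong₂ _+_ (cong ind (lookup-single 0 a)) (trans (sumL-++ f steps tails) (cong₂ _+_ on-steps on-tails)))))
    -- The terms are regrouped into three sums of δ over 0, ..., m′, each equal to 1.
    (trans (arith (δ 0) (δ 1) (δ m′) (∑ {m′} (δ ∘ toℕ)) (∑ {m′} (δ ∘ suc ∘ toℕ)) (∑ {k} (λ g → δ (2 + toℕ g))))
      (cong₂ _+_ (trans (sym (∑-last m′ δ)) hit) (cong₂ _+_ (trans (sym (∑-suc {m′} (δ ∘ toℕ))) hit)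
        (trans (cong (δ 0 +_) (sym (∑-suc {k} (δ ∘ suc ∘ toℕ)))) (trans (sym (∑-suc {m′} (δ ∘ toℕ))) hit))))))
    where
    i = toℕ a
    f : Vec Bool m₁ → ℕ
    f X = ind (lookup X a)
    δ : ℕ → ℕ
    δ n = ind (does (i ≟ n))
    hit : ∑ {m₁} (δ ∘ toℕ) ≡ 1
    hit = ∑-point′ {m₁} {i} (Fin.toℕ<n a)
    on-steps : sumL f steps ≡ ∑ {m′} (δ ∘ toℕ) + ∑ {m′} (δ ∘ suc ∘ toℕ)
    on-steps = trans (sumL-tabulate {n = m′} f (λ g → pair {m₁} (toℕ g) (suc (toℕ g)))) (trans
      (∑-cong λ g → trans (cong ind (lookup-pair (toℕ g) (suc (toℕ g)) a)) (ind-∨-≟ i λ p → 1+n≢n (sym p)))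
      (∑-+ {m′} (δ ∘ toℕ) (δ ∘ suc ∘ toℕ)))
    on-tails : sumL f tails ≡ ∑ {k} (λ g → δ (2 + toℕ g))
    on-tails = trans (sumL-tabulate {n = k} f (λ g → single {m₁} (2 + toℕ g))) (∑-cong λ g → cong ind (lookup-single (2 + toℕ g) a))
    arith : ∀ d0 d1 dm s t u → 0 + ((d0 + (d1 + dm)) + (d0 + ((s + t) + u))) ≡ (s + dm) + ((d0 + t) + (d0 + (d1 + u)))
    arith = solve-∀

  step-only : ∀ {X S} → (X , S) ∈ es → card X ≡ 2 → ∃ λ g → g < m′ × X ≡ pair g (suc g)
  step-only p c with X , X∈ , refl ← ∈.∈-map⁻ (_, full) p with shape X∈
  ... | is-none refl      with () ← trans (sym (card-none {m₁})) c
  ... | is-triple refl    with () ← trans (sym card-triple) c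
  ... | is-step {g} g< q  = g , g< , q
  ... | is-single g< _ refl with () ← trans (sym (card-single g<)) c

  no-single-1 : ∀ {S} → (single 1 , S) ∉ es
  no-single-1 p with X , X∈ , q ← ∈.∈-map⁻ (_, full) p with refl ← ,-injectiveˡ q with shape X∈
  ... | is-none r      with () ← trans (sym (card-single {m₁} {1} (s≤s (s≤s z≤n)))) (trans (cong card r) card-none)
  ... | is-triple r    with () ← trans (sym (card-single {m₁} {1} (s≤s (s≤s z≤n)))) (trans (cong card r) card-triple)
  ... | is-step g< r   with () ← trans (sym (card-single {m₁} {1} (s≤s (s≤s z≤n)))) (trans (cong card r) (card-step g<))
  ... | is-single g< g≢1 r = contradiction (sym (single-injective (s≤s (s≤s z≤n)) r)) g≢1

  step∈ : ∀ {g} → g < m′ → (pair g (suc g) , full) ∈ es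
  step∈ {g} g< = ∈.∈-map⁺ (_, full) (there (there (there (∈.∈-++⁺ˡ (subst (λ n → pair n (suc n) ∈ steps) (Fin.toℕ-fromℕ< g<)
    (∈.∈-tabulate⁺ {f = λ g → pair {m₁} (toℕ g) (suc (toℕ g))} (fromℕ< g<)))))))

  tail∈ : ∀ {g} → g < k → (single (2 + g) , full) ∈ es
  tail∈ {g} g< = ∈.∈-map⁺ (_, full) (there (there (there (∈.∈-++⁺ʳ steps (subst (λ n → single (2 + n) ∈ tails) (Fin.toℕ-fromℕ< g<)
    (∈.∈-tabulate⁺ {f = λ g → single {m₁} (2 + toℕ g)} (fromℕ< g<)))))))

  adjacent⁺ : (s : SplitSymmetry es) → ∀ {x y} → suc (toℕ x) ≡ toℕ y → Adjacent (toℕ (SplitSymmetry.σ s x)) (toℕ (SplitSymmetry.σ s y))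
  adjacent⁺ s {x} {y} p = go (image (step∈ (s≤s⁻¹ (subst (_< m₁) (sym p) (Fin.toℕ<n y)))))
    where
    open SplitSymmetry s
    go : (∃ λ X′ → ∃ λ S′ → (X′ , S′) ∈ es × (∀ a → lookup X′ (σ a) ≡ lookup (pair (toℕ x) (suc (toℕ x))) a) × (∀ b → lookup S′ (τ b) ≡ lookup full b)) →
      Adjacent (toℕ (σ x)) (toℕ (σ y))
    go (X′ , S′ , e∈ , hX , _) with g , g< , refl ← step-only e∈ (trans (card-relabel {X = pair (toℕ x) (suc (toℕ x))} {X′} id σ σ⁻ σσ⁻ σ⁻σ hX)
                                        (card-step (s≤s⁻¹ (subst (_< m₁) (sym p) (Fin.toℕ<n y)))))
      with pair⁻ {j = g} (σ x) (trans (hX x) (pair⁺ˡ {j = toℕ x} {suc (toℕ x)} x refl)) | pair⁻ {j = g} (σ y) (trans (hX y) (pair⁺ʳ {j = toℕ x} {suc (toℕ x)} y (sym p)))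
    ... | inj₁ q | inj₁ r = ⊥-elim (distinct (trans q (sym r)))
      where
      distinct : toℕ (σ x) ≢ toℕ (σ y)
      distinct q = 1+n≢n (trans p (cong toℕ (sym (σ-injective (Fin.toℕ-injective q)))))
    ... | inj₂ q | inj₂ r = ⊥-elim (distinct (trans q (sym r)))
      where
      distinct : toℕ (σ x) ≢ toℕ (σ y)
      distinct q = 1+n≢n (trans p (cong toℕ (sym (σ-injective (Fin.toℕ-injective q)))))
    ... | inj₁ q | inj₂ r = inj₁ (trans (cong suc q) (sym r))
    ... | inj₂ q | inj₁ r = inj₂ (trans (cong suc r) (sym q))

  adjacent : (s : SplitSymmetry es) → ∀ {x y} → Adjacent (toℕ x) (toℕ y) → Adjacent (toℕ (SplitSymmetry.σ s x)) (toℕ (SplitSymmetry.σ s y))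
  adjacent s {x} {y} (inj₁ p) = adjacent⁺ s {x} {y} p
  adjacent s {x} {y} (inj₂ p) = Adjacent-sym (adjacent⁺ s {y} {x} p)

  rigid : (s : SplitSymmetry es) → (∀ a → SplitSymmetry.σ s a ≡ a) × (∀ b → SplitSymmetry.τ s b ≡ b)
  rigid s = fixed (Fin.toℕ-injective ([ id , (λ p → ⊥-elim (not-last p)) ]′ end)) , only-one
    where
    open SplitSymmetry s
    open PathAutomorphism σ σ⁻ σσ⁻ σ⁻σ (λ {x} {y} → adjacent s {x} {y}) (λ {x} {y} → adjacent (flip-Split s) {x} {y})
    only-one : ∀ b → τ b ≡ b
    only-one zero with τ zero
    ... | zero = refl
    one : Fin m₁
    one = suc zero
    next : ∀ {n} → Adjacent m′ n → n < m₁ → n ≡ k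
    next (inj₁ p) q = contradiction (sym p) (<⇒≢ q)
    next (inj₂ p) q = suc-injective p
    -- Reversing the path takes 1 to k. But k forms a block with the large part alone, as k ≥ 2, and
    -- 1 is the only small part that does not.
    not-last : toℕ (σ zero) ≢ m′
    not-last p = go (single-image {es} (flip-Split s) {σ one} {full} (subst (λ n → (single n , full) ∈ es) 2+k′≡ (tail∈ k′<k)))
      where
      σ1 : toℕ (σ one) ≡ k
      σ1 = next (subst (λ n → Adjacent n (toℕ (σ one))) p (adjacent s {zero} {one} (inj₁ refl))) (Fin.toℕ<n (σ one))
      k′<k : k ∸ 2 < k
      k′<k = ∸-monoʳ-< {k} {2} {0} (s≤s z≤n) 2≤k
      2+k′≡ : 2 + (k ∸ 2) ≡ toℕ (σ one)
      2+k′≡ = trans (m+[n∸m]≡n 2≤k) (sym σ1)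
      go : (∃ λ S → (single (toℕ (σ⁻ (σ one))) , S) ∈ es × (∀ b → lookup S (τ⁻ b) ≡ lookup full b)) → ⊥
      go (S , q , _) = no-single-1 (subst (λ a → (single (toℕ a) , S) ∈ es) (σ⁻σ one) q)

  result : HasDistinguishingPartition (K m₁ 3 1 (2 * m₁))
  result = Realize.distinguishing es (λ { (inj₁ a) → degᴬ a ; (inj₂ b) → degᴮ b }) (Unique.map⁺ ,-injectiveˡ Xs-Unique)
    λ s → let open SplitOf s (λ p → size-keeps (λ q → <⇒≢ (≤-trans (s≤s (s≤s (≤-trans 2≤k (m≤m+n k _)))) (≤-refl {2 * m₁})) q) _ p (Symmetry.π-size s p)) in
          trivial (proj₁ (rigid split)) (proj₂ (rigid split))

-- Choice of the parameters of a construction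

sumTo-pos : ∀ m j → 1 ≤ sumTo (m C_) j
sumTo-pos m zero    = ≤-refl
sumTo-pos m (suc j) = ≤-trans (sumTo-pos m j) (m≤m+n _ _)

-- Each w reaches the U values after (w + 1) D. Consecutive w shift this interval by D ≤ U, so no
-- value is skipped.
choose : ∀ D U k t → D ≤ U → suc D ≤ t → t ≤ suc k * D + U →
  ∃ λ w → ∃ λ u → w ≤ k × 1 ≤ u × u ≤ U × t ≡ u + suc w * D
choose D U zero t _ p q = 0 , t ∸ D , z≤n , m<n⇒0<n∸m p ,
  m≤n+o⇒m∸n≤o t D (≤-trans q (+-monoˡ-≤ U (≤-reflexive (+-identityʳ D)))) ,
  trans (sym (m∸n+n≡m (<⇒≤ p))) (cong (t ∸ D +_) (sym (+-identityʳ D)))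
choose D U (suc k) t D≤U p q with t ≤? suc k * D + U
... | yes r with w , u , w≤ , rest ← choose D U k t D≤U p r = w , u , ≤-trans w≤ (n≤1+n k) , rest
... | no ¬r = suc k , t ∸ (2 + k) * D , ≤-refl , m<n⇒0<n∸m big , m≤n+o⇒m∸n≤o t ((2 + k) * D) q , sym (m∸n+n≡m (<⇒≤ big))
  where
  big : (2 + k) * D < t
  big = ≤-trans (s≤s (≤-trans (≤-reflexive (+-comm D (suc k * D))) (+-monoʳ-≤ (suc k * D) D≤U))) (≰⇒> ¬r)

two-more : ∀ d x → d + (d + x) ≡ x + (d + d)
two-more = solve-∀

-- The width m′ - 1 is forbidden, since it would leave a set of two small parts. Jumping from m′ - 2
-- to m′ shifts the interval by 2 D, whence the stronger hypothesis on U.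
choose-width : ∀ D U m′ t → 2 ≤ m′ → D + D ≤ U → suc D ≤ t → t ≤ suc m′ * D + U →
  ∃ λ w → ∃ λ u → (w ≡ m′ ⊎ 2 + w ≤ m′) × 1 ≤ u × u ≤ U × t ≡ u + suc w * D
choose-width D U (suc (suc k)) t _ 2D≤U p q with suc (suc (suc k)) * D <? t
... | yes r = _ , t ∸ (3 + k) * D , inj₁ refl , m<n⇒0<n∸m r , m≤n+o⇒m∸n≤o t ((3 + k) * D) q , sym (m∸n+n≡m (<⇒≤ r))
... | no ¬r with w , u , w≤ , rest ← choose D U k t (≤-trans (m≤m+n D D) 2D≤U) p
        (≤-trans (≮⇒≥ ¬r) (≤-trans (≤-reflexive (two-more D (suc k * D))) (+-monoʳ-≤ (suc k * D) 2D≤U))) =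
  w , u , inj₂ (s≤s (s≤s w≤)) , rest
choose-width D U (suc zero) t (s≤s ())

data EpsCase (m₂′ : ℕ) : Set where
  even : ∀ p → 1 ≤ p → m₂′ ≡ suc (p + p) → jmax (suc m₂′) ≡ p → eps (suc m₂′) ≡ 2 ^ m₂′ → EpsCase m₂′
  odd  : ∀ p → m₂′ ≡ p + p → jmax (suc m₂′) ≡ p → eps (suc m₂′) ≡ 2 ^ m₂′ ∸ 1 → EpsCase m₂′
  two  : m₂′ ≡ 1 → EpsCase m₂′

halves : ∀ n → ∃ λ p → n ≡ p + p ⊎ n ≡ suc (p + p)
halves zero = 0 , inj₁ refl
halves (suc n) with halves n
... | p , inj₁ refl = p , inj₂ refl
... | p , inj₂ refl = suc p , inj₁ (cong suc (sym (+-suc p p)))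

double : ∀ p → p + p ≡ p * 2
double p = trans (cong (p +_) (sym (+-identityʳ p))) (*-comm 2 p)

odd≢even : ∀ p k → suc (p + p) ≢ k + k
odd≢even p       zero    ()
odd≢even zero    (suc k) r = case trans (suc-injective r) (+-suc k k) of λ ()
odd≢even (suc p) (suc k) r = odd≢even p k (suc-injective (trans (cong suc (sym (+-suc p p))) (suc-injective (trans r (cong suc (+-suc k k))))))

double-injective : ∀ p k → p + p ≡ k + k → p ≡ k
double-injective p k r = *-cancelʳ-≡ p k 2 (trans (sym (double p)) (trans r (double k)))

half-even : ∀ p → (p + p) / 2 ≡ p
half-even p = trans (cong (_/ 2) (double p)) (DivMod.m*n/n≡m p 2)

half-odd : ∀ p → suc (p + p) / 2 ≡ p
half-odd p = trans (cong (λ x → suc x / 2) (double p)) (trans (DivMod.+-distrib-/-∣ʳ 1 {p * 2} {2} (Divisibility.n∣m*n p)) (DivMod.m*n/n≡m p 2))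

epsCase : ∀ m₂′ → EpsCase m₂′
epsCase m₂′ with halves m₂′
... | p , inj₁ refl = odd p refl (half-even p) (cong (λ z → if (z ≡ᵇ 0) ∧ (4 ≤ᵇ suc (p + p)) then 2 ^ (p + p) else 2 ^ (p + p) ∸ 1)
  (trans (cong (λ x → suc x % 2) (double p)) (DivMod.[m+kn]%n≡m%n 1 p 2)))
... | zero , inj₂ refl = two refl
... | suc p , inj₂ refl = even (suc p) (s≤s z≤n) refl (half-odd (suc p)) (cong₂ (λ y z → if (z ≡ᵇ 0) ∧ y then 2 ^ suc (suc p + suc p) else 2 ^ suc (suc p + suc p) ∸ 1)
  (4≤ p) (trans (cong (λ x → suc (suc x) % 2) (double (suc p))) (DivMod.[m+kn]%n≡m%n 2 (suc p) 2)))
  where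
  4≤ : ∀ p → (4 ≤ᵇ suc (suc (suc p + suc p))) ≡ true
  4≤ p rewrite +-suc p p = refl

module Existence (m₂′ : ℕ) where
  -- `h` is the size of a cut label. Above `low-bound`, n₂ differs from n₁ = 2 + N, and after the
  -- fixed contribution of at most 2 h + 2^(m₂ - 1) more than D remains, enough for w = 0 and one
  -- edge.
  m₂ j D N h low-bound : ℕ
  m₂ = suc m₂′
  j  = jmax m₂
  D  = sumTo (m₂′ C_) j
  N  = sumTo (m₂ C_) j
  h  = m₂ ∸ suc j
  low-bound = 2 + N + (h + h + 2 ^ m₂′ + D)

  Realizable : ℕ → ℕ → Set
  Realizable m₁ n₂ = HasDistinguishingPartition (K m₁ (2 + N) m₂ n₂)

  sparse : ∀ m′ n₂ → 2 ≤ m′ → 1 ≤ n₂ → n₂ ≤ low-bound → m₂ + low-bound ≤ m′ → (3 + m₂ + N) + (3 + m₂ + N) ≤ suc m′ →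
    Realizable (suc m′) n₂
  sparse m′ n₂ 2≤m′ 1≤n₂ low room long = Sparse.result m′ 2≤m′ N n₂ (sumTo-pos m₂ j) 1≤n₂ (≤-trans (+-monoʳ-≤ m₂ low) room) long

  n₁≢n₂ : ∀ {n₂} → low-bound < n₂ → 2 + N ≢ n₂
  n₁≢n₂ p q = <⇒≱ p (≤-trans (≤-reflexive (sym q)) (m≤m+n (2 + N) _))

  big-t : ∀ {n₂} c → c + D ≤ h + h + 2 ^ m₂′ + D → low-bound < n₂ → suc D ≤ n₂ ∸ c
  big-t {n₂} c p q = m+n≤o⇒m≤o∸n (suc D) (≤-trans (s≤s (≤-trans (≤-reflexive (+-comm D c)) (≤-trans p (m≤n+m _ (2 + N))))) q)

  module _ (L R : Vec Bool m₂) (e : ℕ) (labels : ∀ b → ind (lookup L b) + ind (lookup R b) ≡ e)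
    (co-L : co L ≡ suc j) (co-R : co R ≡ suc j) (D≡1 : D ≡ 1) (e≤ : e ≤ h + h)
    (R-rigid : ∀ (τ : Fin m₂ → Fin m₂) → (∀ {a b} → τ a ≡ τ b → a ≡ b) → (∀ b → lookup R (τ b) ≡ lookup R b) → ∀ b → τ b ≡ b) where

    line : ∀ k n₂ → 2 ≤ k → 1 ≤ n₂ → low-bound < n₂ → n₂ ≤ e + 2 ^ m₂′ + (2 + k + k) → Realizable (2 + k) n₂
    line k n₂ 2≤k 1≤n₂ lo hi with choose-width D k (suc k) (n₂ ∸ (e + 2 ^ m₂′)) (≤-trans 2≤k (n≤1+n k))
        (subst (λ d → d + d ≤ k) (sym D≡1) 2≤k)
        (big-t (e + 2 ^ m₂′) (+-monoˡ-≤ D (+-monoˡ-≤ (2 ^ m₂′) e≤)) lo)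
        (m≤n+o⇒m∸n≤o n₂ (e + 2 ^ m₂′) (≤-trans hi (+-monoʳ-≤ (e + 2 ^ m₂′) (≤-reflexive (cong (_+ k) (trans (sym (*-identityʳ (2 + k))) (cong ((2 + k) *_) (sym D≡1))))))))
    -- Of the m′ = k + 1 path edges u contain the large parts; 1 ≤ u ≤ k leaves edges of both kinds,
    -- as the orientation of the path requires.
    ... | w , u , w-ok , 1≤u , u≤k , eq = SaturatedLine.result (suc k) (≤-trans 2≤k (n≤1+n k)) L R (suc k ∸ u) w
      (m+n≤o⇒m≤o∸n 1 (s≤s u≤k)) (∸-monoʳ-< {suc k} {u} {0} 1≤u (≤-trans u≤k (n≤1+n k))) w-ok co-L co-R R-rigid refl
      (λ b → trans n₂≡ (cong₂ (λ x y → x + y + (suc w * D + 2 ^ m₂′)) (sym (labels b)) (sym (m∸[m∸n]≡n (≤-trans u≤k (n≤1+n k))))))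
      1≤n₂ (n₁≢n₂ lo)
      where
      arith : ∀ e x u y → e + x + (u + y) ≡ e + u + (y + x)
      arith = solve-∀
      le : e + 2 ^ m₂′ ≤ n₂
      le = ≤-trans (+-monoˡ-≤ (2 ^ m₂′) e≤) (≤-trans (m≤m+n _ D) (≤-trans (m≤n+m _ (2 + N)) (<⇒≤ lo)))
      n₂≡ : n₂ ≡ e + u + (suc w * D + 2 ^ m₂′)
      n₂≡ = trans (sym (m+[n∸m]≡n le)) (trans (cong (e + 2 ^ m₂′ +_) eq) (arith e (2 ^ m₂′) u (suc w * D)))

  cycle : 2 ≤ m₂′ → ∀ ℓ n₂ → 2 ≤ ℓ → D + D ≤ suc ℓ → 1 ≤ n₂ → low-bound < n₂ →
    n₂ ≤ (h + h + 2 ^ m₂′) + ((2 + ℓ + m₂′) * D + suc ℓ) → Realizable (2 + ℓ + m₂′) n₂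
  cycle 2≤m₂′ ℓ n₂ 2≤ℓ D≤ 1≤n₂ lo hi with choose-width D (suc ℓ) (suc (ℓ + m₂′)) (n₂ ∸ (h + h + 2 ^ m₂′))
      (≤-trans 2≤ℓ (≤-trans (m≤m+n ℓ m₂′) (n≤1+n _))) D≤ (big-t (h + h + 2 ^ m₂′) ≤-refl lo) (m≤n+o⇒m∸n≤o n₂ (h + h + 2 ^ m₂′) hi)
  -- Gap 0 always contains the large parts, so only u - 1 of the u edges are taken from the run.
  ... | w , suc v , w-ok , _ , s≤s v≤ℓ , eq = SaturatedCycle.result 2≤m₂′ ℓ 2≤ℓ v v≤ℓ w w-ok c<m refl n₂≡ 1≤n₂ (n₁≢n₂ lo)
    where
    c<m : suc j < m₂
    c<m = s≤s (DivMod.m/n<m m₂′ 2 {{>-nonZero (≤-trans (n≤1+n 1) 2≤m₂′)}} (s≤s (s≤s z≤n)))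
    arith : ∀ a x v y → a + x + (suc v + y) ≡ 1 + v + a + (y + x)
    arith = solve-∀
    le : h + h + 2 ^ m₂′ ≤ n₂
    le = ≤-trans (m≤m+n _ D) (≤-trans (m≤n+m _ (2 + N)) (<⇒≤ lo))
    n₂≡ : n₂ ≡ 1 + v + (h + h) + (suc w * D + 2 ^ m₂′)
    n₂≡ = trans (sym (m+[n∸m]≡n le)) (trans (cong (h + h + 2 ^ m₂′ +_) eq) (arith (h + h) (2 ^ m₂′) v (suc w * D)))

  -- The m₂ cuts take the place of m₂ edges, each worth 1 at every large part, and contribute 2 h
  -- instead. This is m₂ for even m₂ and m₂ - 1 for odd m₂, the 1 missing from `eps`.
  eps-bound : 2 ≤ m₂′ → m₂ + eps m₂ ≤ h + h + 2 ^ m₂′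
  eps-bound 2≤ with epsCase m₂′
  ... | two refl = contradiction 2≤ λ { (s≤s ()) }
  ... | even p _ refl jp ep = ≤-reflexive (cong₂ _+_ (trans (arith p) (sym (cong (λ z → z + z) h≡))) ep)
    where
    arith : ∀ p → suc (suc (p + p)) ≡ suc p + suc p
    arith = solve-∀
    h≡ : h ≡ suc p
    h≡ = trans (cong (λ i → m₂ ∸ suc i) jp) (trans (cong (_∸ suc p) (arith p)) (m+n∸m≡n (suc p) (suc p)))
  ... | odd p refl jp ep = ≤-reflexive (trans (cong (m₂ +_) ep) (trans (arith (p + p) (2 ^ (p + p)) (m^n>0 2 (p + p))) (cong (_+ 2 ^ m₂′) (sym (cong (λ z → z + z) h≡)))))
    where
    arith : ∀ a b → 1 ≤ b → suc a + (b ∸ 1) ≡ a + b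
    arith a (suc b) _ = sym (+-suc a b)
    h≡ : h ≡ p
    h≡ = trans (cong (λ i → m₂ ∸ suc i) jp) (m+n∸m≡n (suc p) p)

  threshold : ℕ
  threshold = 4 + m₂ + low-bound + ((3 + m₂ + N) + (3 + m₂ + N)) + (D + D)

  module _ {m₁ : ℕ} (large : threshold ≤ m₁) where
    via : ∀ {x} → x ≤ threshold → x ≤ m₁
    via p = ≤-trans p large

    room-large : suc (m₂ + low-bound) ≤ m₁
    room-large = via (≤-trans (s≤s (≤-trans (m≤n+m _ 3) (≤-trans (m≤m+n _ _) (m≤m+n _ (D + D))))) ≤-refl)
    long-large : (3 + m₂ + N) + (3 + m₂ + N) ≤ m₁
    long-large = via (≤-trans (m≤n+m _ (4 + m₂ + low-bound)) (m≤m+n _ (D + D)))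
    cycle-large : 4 + m₂ + (D + D) ≤ m₁
    cycle-large = via (+-monoˡ-≤ (D + D) (≤-trans (m≤m+n (4 + m₂) low-bound) (m≤m+n _ _)))

  small-or-large : ∀ {m₁ n₂} → threshold ≤ m₁ → 1 ≤ n₂ → (low-bound < n₂ → Realizable m₁ n₂) → Realizable m₁ n₂
  small-or-large {zero}   {n₂} large = contradiction (long-large large) λ ()
  small-or-large {suc m′} {n₂} large 1≤n₂ high with n₂ ≤? low-bound
  ... | yes p = sparse m′ n₂ (s≤s⁻¹ (≤-trans (s≤s (s≤s (s≤s z≤n))) (long-large large))) 1≤n₂ p (s≤s⁻¹ (room-large large)) (long-large large)
  ... | no ¬p = high (≰⇒> ¬p)

  high-cycle : 2 ≤ m₂′ → ∀ {m₁ n₂} → threshold ≤ m₁ → 1 ≤ n₂ → n₂ ≤ suc D * m₁ + eps m₂ → low-bound < n₂ → Realizable m₁ n₂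
  high-cycle 2≤ {m₁} {n₂} large 1≤n₂ hi lo = subst (λ m → Realizable m n₂) m₁≡
    (cycle 2≤ ℓ n₂ (≤-trans (s≤s (s≤s z≤n)) ℓ-large) (≤-trans (≤-trans (m≤n+m (D + D) 3) ℓ-large) (n≤1+n ℓ)) 1≤n₂ lo
      (≤-trans hi (≤-trans (≤-reflexive (cong (λ m → suc D * m + eps m₂) (sym m₁≡))) bound)))
    where
    ℓ = m₁ ∸ (2 + m₂′)
    2+m₂′≤ : 2 + m₂′ ≤ m₁
    2+m₂′≤ = ≤-trans (≤-trans (m≤n+m (suc m₂) 3) (m≤m+n (4 + m₂) (D + D))) (cycle-large large)
    m₁≡ : 2 + ℓ + m₂′ ≡ m₁
    m₁≡ = trans (arith ℓ m₂′) (m∸n+n≡m 2+m₂′≤)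
      where
      arith : ∀ a b → 2 + a + b ≡ a + (2 + b)
      arith = solve-∀
    ℓ-large : 3 + (D + D) ≤ ℓ
    ℓ-large = m+n≤o⇒m≤o∸n (3 + (D + D)) (≤-trans (≤-reflexive (arith (D + D) m₂′)) (cycle-large large))
      where
      arith : ∀ d m → 3 + d + (2 + m) ≡ 4 + suc m + d
      arith = solve-∀
    bound : suc D * (2 + ℓ + m₂′) + eps m₂ ≤ (h + h + 2 ^ m₂′) + ((2 + ℓ + m₂′) * D + suc ℓ)
    bound = ≤-trans (≤-reflexive (arith D ℓ m₂′ (eps m₂))) (+-monoˡ-≤ _ (eps-bound 2≤))
      where
      arith : ∀ D ℓ m e → suc D * (2 + ℓ + m) + e ≡ (suc m + e) + ((2 + ℓ + m) * D + suc ℓ)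
      arith = solve-∀

at-least-4 : ∀ {x m} → 4 + x ≤ m → ∃ λ k → 2 ≤ k × m ≡ 2 + k
at-least-4 (s≤s (s≤s (s≤s (s≤s p)))) = _ , s≤s (s≤s z≤n) , refl

existence : ∀ m₂′ → let open Existence m₂′ in ∀ {m₁ n₂} → threshold ≤ m₁ → 1 ≤ n₂ → n₂ ≤ suc D * m₁ + eps m₂ → Realizable m₁ n₂
existence (suc (suc m)) large 1≤n₂ hi = Existence.small-or-large (2 + m) large 1≤n₂ (Existence.high-cycle (2 + m) (s≤s (s≤s z≤n)) large 1≤n₂ hi)
existence zero {m₁} {n₂} large 1≤n₂ hi = Existence.small-or-large 0 large 1≤n₂ high
  where
  high : Existence.low-bound 0 < n₂ → Existence.Realizable 0 m₁ n₂
  high lo with k , 2≤k , refl ← at-least-4 (Existence.cycle-large 0 large) with m≤n⇒m<n∨m≡n (≤-trans hi (≤-reflexive (+-identityʳ _)))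
  -- The path needs an edge without the large part to be oriented and so reaches only 2 m₁ - 1; the
  -- extreme value has its own arrangement.
  ... | inj₂ refl = Theta.result k 2≤k
  ... | inj₁ p = Existence.line 0 none none 0 (λ { zero → cong₂ _+_ (cong ind (lookup-none {1} zero)) (cong ind (lookup-none {1} zero)) })
      co-none co-none refl z≤n (λ { τ _ _ zero → only (τ zero) }) k n₂ 2≤k 1≤n₂ lo (s≤s⁻¹ (≤-trans p (≤-reflexive (arith k))))
    where
    only : ∀ (b : Fin 1) → b ≡ zero
    only zero = refl
    arith : ∀ k → 2 * (2 + k) ≡ suc (1 + (2 + k + k))
    arith = solve-∀
existence (suc zero) {m₁} {n₂} large 1≤n₂ hi = Existence.small-or-large 1 large 1≤n₂ high
  where
  second first : Vec Bool 2
  first  = true ∷ false ∷ []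
  second = false ∷ true ∷ []
  co-first : co first ≡ 1
  co-first = trans (∑-suc (ind ∘ not ∘ lookup first)) (trans (∑-suc (ind ∘ not ∘ lookup first ∘ suc)) (cong suc (∑-zero {0} λ ())))
  co-second : co second ≡ 1
  co-second = trans (∑-suc (ind ∘ not ∘ lookup second)) (trans (cong suc (∑-suc (ind ∘ not ∘ lookup second ∘ suc))) (cong suc (∑-zero {0} λ ())))
  first-rigid : ∀ (τ : Fin 2 → Fin 2) → (∀ b → lookup first (τ b) ≡ lookup first b) → ∀ b → τ b ≡ b
  first-rigid τ p b = go b (τ b) (p b)
    where
    go : ∀ b c → lookup first c ≡ lookup first b → c ≡ b
    go zero       zero       _ = refl
    go zero       (suc zero) ()
    go (suc zero) zero       ()
    go (suc zero) (suc zero) _ = refl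
  high : Existence.low-bound 1 < n₂ → Existence.Realizable 1 m₁ n₂
  high lo with k , 2≤k , refl ← at-least-4 (Existence.cycle-large 1 large) =
    -- Complementary labels at the two ends give both large parts the same degree, and the label of
    -- the first small part tells them apart.
    Existence.line 1 second first 1 (λ { zero → refl ; (suc zero) → refl }) co-second co-first refl (s≤s z≤n) (λ τ _ → first-rigid τ)
      k n₂ 2≤k 1≤n₂ lo (≤-trans hi (≤-reflexive (arith k)))
    where
    arith : ∀ k → 2 * (2 + k) + 1 ≡ 1 + 2 + (2 + k + k)
    arith = solve-∀

-- Counting tools for the upper bound

sumL-point : (_≟_ : (x y : A) → Dec (x ≡ y)) (φ : A → ℕ) → ∀ {xs x} → Unique xs → x ∈ xs →
  sumL (λ y → ind (does (x ≟ y)) * φ y) xs ≡ φ x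
sumL-point _≟_ φ {y ∷ xs} {x} (y∉ ∷ u) (here refl) = trans (cong₂ _+_
  (cong (λ b → ind b * φ x) (dec-true (x ≟ x) refl)) (off y∉)) (trans (+-identityʳ _) (+-identityʳ _))
  where
  off : ∀ {ys} → All.All (x ≢_) ys → sumL (λ y → ind (does (x ≟ y)) * φ y) ys ≡ 0
  off []       = refl
  off {y ∷ ys} (p ∷ ps) = cong₂ _+_ (cong (λ b → ind b * φ y) (dec-false (x ≟ y) p)) (off ps)
sumL-point _≟_ φ {y ∷ xs} {x} (y∉ ∷ u) (there p) = cong₂ _+_
  (cong (λ b → ind b * φ y) (dec-false (x ≟ y) λ { refl → All.lookup y∉ p refl })) (sumL-point _≟_ φ u p)

ind-∧ : ∀ a b → ind (a ∧ b) ≡ ind a * ind b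
ind-∧ true  b = sym (+-identityʳ _)
ind-∧ false b = refl

∧-true : ∀ {a b} → a ∧ b ≡ true → a ≡ true × b ≡ true
∧-true {true} {true} _ = refl , refl

1≤ind⇒true : ∀ {b} → 1 ≤ ind b → b ≡ true
1≤ind⇒true {true} _ = refl

∑-indicator-≤1 : ∀ {k} (P : Fin k → Bool) → (∀ {i j} → P i ≡ true → P j ≡ true → i ≡ j) → ∑ (ind ∘ P) ≤ 1
∑-indicator-≤1 P uniq with ∑ (ind ∘ P) in eq
... | zero        = z≤n
... | suc zero    = ≤-refl
... | suc (suc n) with i , q ← ∑-pos (ind ∘ P) (≤-trans (s≤s z≤n) (≤-reflexive (sym eq))) =
  contradiction (trans (sym eq) (∑-single (ind ∘ P) i λ j j≢i → at j j≢i)) λ r → <⇒≱ (s≤s (s≤s z≤n)) (≤-trans (≤-reflexive r) (ind≤1 (P i)))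
  where
  at : ∀ j → j ≢ i → ind (P j) ≡ 0
  at j j≢i = cong ind (Bool.¬-not λ r → j≢i (uniq r (1≤ind⇒true q)))

∑-any : ∀ {k} (f : Fin k → ℕ) n → (∀ {i j} → f i ≡ f j → i ≡ j) →
  ∑ (λ i → ind (does (f i ≟ n))) ≡ ind (does (Fin.any? (λ i → f i ≟ n)))
∑-any f n inj with Fin.any? (λ i → f i ≟ n)
... | yes (i , p) = trans (∑-single _ i λ j j≢i → cong ind (dec-false (f j ≟ n) λ q → j≢i (inj (trans q (sym p))))) (cong ind (dec-true (f i ≟ n) p))
... | no ¬p = ∑-zero λ i → cong ind (dec-false (f i ≟ n) λ q → ¬p (i , q))

-- The selected sets are distinct, so a sum over them is a partial sum over all subsets. `all-hit`
-- is the case of equality, where every set of positive weight must occur.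
module DistinctSubsets {k m : ℕ} (P : Fin k → Bool) (S : Fin k → Vec Bool m)
  (inj : ∀ {i j} → P i ≡ true → P j ≡ true → S i ≡ S j → i ≡ j) (φ : Vec Bool m → ℕ) where

  hits : Vec Bool m → ℕ
  hits T = ∑ (λ i → ind (P i ∧ does (S i ≟S T)))

  hits≤1 : ∀ T → hits T ≤ 1
  hits≤1 T = ∑-indicator-≤1 (λ i → P i ∧ does (S i ≟S T)) λ {i} {j} p q →
    inj (proj₁ (∧-true p)) (proj₁ (∧-true q)) (trans (does-true (S i ≟S T) (proj₂ (∧-true {P i} p))) (sym (does-true (S j ≟S T) (proj₂ (∧-true {P j} q)))))

  as-sumL : ∑ (λ i → ind (P i) * φ (S i)) ≡ sumL (λ T → hits T * φ T) (subsets m)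
  as-sumL = begin
    ∑ (λ i → ind (P i) * φ (S i))
      ≡⟨ ∑-cong (λ i → cong (ind (P i) *_) (sym (sumL-point _≟S_ φ (subsets-Unique m) (∈-subsets (S i))))) ⟩
    ∑ (λ i → ind (P i) * sumL (λ T → ind (does (S i ≟S T)) * φ T) (subsets m))
      ≡⟨ ∑-cong (λ i → sym (sumL-*ˡ (ind (P i)) (λ T → ind (does (S i ≟S T)) * φ T) (subsets m))) ⟩
    ∑ (λ i → sumL (λ T → ind (P i) * (ind (does (S i ≟S T)) * φ T)) (subsets m))
      ≡⟨ ∑-sumL (λ i T → ind (P i) * (ind (does (S i ≟S T)) * φ T)) (subsets m) ⟩
    sumL (λ T → ∑ (λ i → ind (P i) * (ind (does (S i ≟S T)) * φ T))) (subsets m)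
      ≡⟨ sumL-cong (λ T → trans (∑-cong λ i → trans (sym (*-assoc (ind (P i)) (ind (does (S i ≟S T))) (φ T))) (cong (_* φ T) (sym (ind-∧ (P i) (does (S i ≟S T))))))
           (∑-*ʳ (φ T) (λ i → ind (P i ∧ does (S i ≟S T))))) (subsets m) ⟩
    sumL (λ T → hits T * φ T) (subsets m) ∎
    where open ≡-Reasoning

  hits-bound : ∀ T → hits T * φ T ≤ φ T
  hits-bound T = ≤-trans (*-monoˡ-≤ (φ T) (hits≤1 T)) (≤-reflexive (+-identityʳ (φ T)))

  bound : ∑ (λ i → ind (P i) * φ (S i)) ≤ sumL φ (subsets m)
  bound = ≤-trans (≤-reflexive as-sumL) (sumL-mono hits-bound (subsets m))

  all-hit : sumL φ (subsets m) ≤ ∑ (λ i → ind (P i) * φ (S i)) → ∀ T → 1 ≤ φ T → ∃ λ i → P i ≡ true × S i ≡ T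
  all-hit le T 1≤φ with hits T in eq | sumL-mono-≡ hits-bound (subsets m) (≤-trans le (≤-reflexive as-sumL)) (∈-subsets T)
  ... | zero  | q = contradiction 1≤φ (<⇒≱ (s≤s (≤-reflexive (sym q))))
  ... | suc n | q with i , r ← ∑-pos (λ i → ind (P i ∧ does (S i ≟S T))) (≤-trans (s≤s z≤n) (≤-reflexive (sym eq))) =
    i , proj₁ (∧-true (1≤ind⇒true r)) , does-true (S i ≟S T) (proj₂ (∧-true {P i} (1≤ind⇒true r)))

squeeze : ∀ {a b c d} → a ≤ b → c ≤ d → b + d ≤ a + c → b ≤ a × d ≤ c
squeeze {a} {b} {c} {d} p q r = +-cancelʳ-≤ d b a (≤-trans r (+-monoʳ-≤ a q)) , +-cancelˡ-≤ b d c (≤-trans r (+-monoˡ-≤ c p))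

module Surplus (m₂′ : ℕ) where
  private
    m₂ j : ℕ
    m₂ = suc m₂′
    j  = jmax m₂

  D N surplus : ℕ
  D = sumTo (m₂′ C_) j
  N = sumTo (m₂ C_) j
  surplus = sumL (λ S → 2 * card S ∸ m₂) (subsets m₂)

  -- Truncated subtraction makes `2 * card S ∸ m₂` vanish unless S has more than half of the large
  -- parts, which is what `few j` tests.
  few-card : ∀ (S : Vec Bool m₂) → ind (few j S) * m₂ + (2 * card S ∸ m₂) ≡ ind (few j S) * (2 * card S)
  few-card S with few j S in eq
  ... | true = trans (cong (_+ (2 * card S ∸ m₂)) (+-identityʳ m₂)) (trans (m+[n∸m]≡n {m₂} {2 * card S} many) (sym (+-identityʳ _)))
    where
    co≤ : co S ≤ j
    co≤ = s≤s⁻¹ (does-true (co S <? suc j) eq)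
    2co≤ : 2 * co S ≤ m₂′
    2co≤ = ≤-trans (*-monoʳ-≤ 2 co≤) (≤-trans (≤-reflexive (*-comm 2 j)) (DivMod.m/n*n≤m m₂′ 2))
    many : m₂ ≤ 2 * card S
    many = +-cancelʳ-≤ (2 * co S) m₂ (2 * card S) (≤-trans (+-monoʳ-≤ m₂ (≤-trans 2co≤ (n≤1+n _)))
      (≤-reflexive (trans (cong (m₂ +_) (sym (+-identityʳ m₂))) (trans (cong (2 *_) (sym (card+co S))) (*-distribˡ-+ 2 (card S) (co S))))))
  ... | false = m≤n⇒m∸n≡0 (+-cancelʳ-≤ (2 * co S) (2 * card S) m₂ (≤-trans (≤-reflexive (trans (sym (*-distribˡ-+ 2 (card S) (co S)))
      (trans (cong (2 *_) (card+co S)) (cong (m₂ +_) (+-identityʳ m₂))))) (+-monoʳ-≤ m₂ (≤-trans m₂≤ (*-monoʳ-≤ 2 co≥)))))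
    where
    co≥ : suc j ≤ co S
    co≥ = ≮⇒≥ (does-false (co S <? suc j) eq)
    m₂≤ : m₂ ≤ 2 * suc j
    m₂≤ = ≤-trans (s≤s (≤-reflexive (DivMod.m≡m%n+[m/n]*n m₂′ 2))) (≤-trans (+-monoˡ-≤ (j * 2) (DivMod.m%n<n m₂′ 2)) (≤-reflexive (*-comm (suc j) 2)))

  -- Both sides are the sum of 2|S| over the sets S with more than half of the large parts, taken
  -- set by set on the left and large part by large part on the right.
  surplus-total : N * m₂ + surplus ≡ 2 * (m₂ * D)
  surplus-total = begin
    N * m₂ + surplus
      ≡⟨ cong (λ x → x * m₂ + surplus) (sym (count-few m₂ j)) ⟩
    count (few j) (subsets m₂) * m₂ + surplus
      ≡⟨ cong (_+ surplus) (sym (sumL-*ʳ m₂ (ind ∘ few j) (subsets m₂))) ⟩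
    sumL (λ S → ind (few j S) * m₂) (subsets m₂) + surplus
      ≡⟨ sym (sumL-+ (λ S → ind (few j S) * m₂) (λ S → 2 * card S ∸ m₂) (subsets m₂)) ⟩
    sumL (λ S → ind (few j S) * m₂ + (2 * card S ∸ m₂)) (subsets m₂)
      ≡⟨ sumL-cong (λ S → trans (few-card S) (trans (swap (ind (few j S)) (card S)) (cong (2 *_) (sym (∑-*ˡ (ind (few j S)) (ind ∘ lookup S)))))) (subsets m₂) ⟩
    sumL (λ S → 2 * ∑ (λ b → ind (few j S) * ind (lookup S b))) (subsets m₂)
      ≡⟨ sumL-*ˡ 2 (λ S → ∑ (λ b → ind (few j S) * ind (lookup S b))) (subsets m₂) ⟩
    2 * sumL (λ S → ∑ (λ b → ind (few j S) * ind (lookup S b))) (subsets m₂)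
      ≡⟨ cong (2 *_) (sym (∑-sumL (λ b S → ind (few j S) * ind (lookup S b)) (subsets m₂))) ⟩
    2 * ∑ {m₂} (λ b → sumL (λ S → ind (few j S) * ind (lookup S b)) (subsets m₂))
      ≡⟨ cong (2 *_) (trans (∑-cong (count-few-∋ j)) (∑-const m₂ D)) ⟩
    2 * (m₂ * D) ∎
    where
    open ≡-Reasoning
    swap : ∀ a b → a * (2 * b) ≡ 2 * (a * b)
    swap = solve-∀

-- From a distinguishing partition to a rigid hypergraph

module Distinguished {m₁ n₁ m₂′ n₂ : ℕ} (c : Vertex m₁ n₁ (suc m₂′) n₂ → ℕ) (dist : IsDistinguishing (K m₁ n₁ (suc m₂′) n₂) c) where
  m₂ : ℕ
  m₂ = suc m₂′
  V : Set
  V = Vertex m₁ n₁ m₂ n₂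

  _≟V_ : (x y : V) → Dec (x ≡ y)
  _≟V_ = Sum.≡-dec (Product.≡-dec Fin._≟_ Fin._≟_) (Product.≡-dec Fin._≟_ Fin._≟_)

  trivial : (g g⁻ : V → V) → (∀ x → g (g⁻ x) ≡ x) → (∀ x → g⁻ (g x) ≡ x) →
    (∀ {x y} → partOf x ≡ partOf y → partOf (g x) ≡ partOf (g y)) → (∀ {x y} → partOf x ≡ partOf y → partOf (g⁻ x) ≡ partOf (g⁻ y)) →
    (∀ {x y} → c x ≡ c y → c (g x) ≡ c (g y)) → (∀ {x y} → c x ≡ c y → c (g⁻ x) ≡ c (g⁻ y)) → ∀ x → g x ≡ x
  trivial g g⁻ gg⁻ g⁻g part part⁻ block block⁻ x with g x ≟V x
  ... | yes p = p
  ... | no ¬p = ⊥-elim (dist γ (λ all → ¬p (all x)) fixes)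
    where
    γ : Aut (K m₁ n₁ m₂ n₂)
    γ = record { perm = mk↔ₛ′ g g⁻ gg⁻ g⁻g ; preserve = λ x y → mk⇔
      (λ adj q → adj (trans (cong partOf (sym (g⁻g x))) (trans (part⁻ {g x} {g y} q) (cong partOf (g⁻g y)))))
      (λ adj q → adj (part {x} {y} q)) }
    fixes : FixesPartition γ c
    fixes x y = mk⇔ (block {x} {y}) (λ q → trans (cong c (sym (g⁻g x))) (trans (block⁻ {g x} {g y} q) (cong c (g⁻g y))))

  swap : V → V → V → V
  swap x y z = if does (z ≟V x) then y else (if does (z ≟V y) then x else z)

  swap-cases : ∀ x y z → (z ≡ x × swap x y z ≡ y) ⊎ (z ≡ y × swap x y z ≡ x) ⊎ (z ≢ x × z ≢ y × swap x y z ≡ z)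
  swap-cases x y z with z ≟V x
  ... | yes p = inj₁ (p , refl)
  ... | no ¬p with z ≟V y
  ...   | yes q = inj₂ (inj₁ (q , refl))
  ...   | no ¬q = inj₂ (inj₂ (¬p , ¬q , refl))

  swap-left : ∀ x y → swap x y x ≡ y
  swap-left x y = cong (λ b → if b then y else (if does (x ≟V y) then x else x)) (dec-true (x ≟V x) refl)

  swap-involutive : ∀ x y → x ≢ y → ∀ z → swap x y (swap x y z) ≡ z
  swap-involutive x y x≢y z with swap-cases x y z
  ... | inj₂ (inj₂ (_ , _ , p)) = trans (cong (swap x y) p) p
  ... | inj₂ (inj₁ (refl , p)) = trans (cong (swap x y) p) (swap-left x y)
  ... | inj₁ (refl , p) with swap-cases x y y
  ...   | inj₁ (q , _) = contradiction (sym q) x≢y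
  ...   | inj₂ (inj₁ (_ , q)) = trans (cong (swap x y) p) q
  ...   | inj₂ (inj₂ (_ , q , _)) = contradiction refl q

  -- A block meets each part at most once: otherwise exchange two common vertices.
  vertex-ext : ∀ {x y} → partOf x ≡ partOf y → c x ≡ c y → x ≡ y
  vertex-ext {x} {y} p q with x ≟V y
  ... | yes r = r
  ... | no x≢y = trans (sym (trivial (swap x y) (swap x y) (swap-involutive x y x≢y) (swap-involutive x y x≢y) part part block block x)) (swap-left x y)
    where
    keep : ∀ {B : Set} (f : V → B) → f x ≡ f y → ∀ z → f (swap x y z) ≡ f z
    keep f r z with swap-cases x y z
    ... | inj₁ (refl , s) = trans (cong f s) (sym r)
    ... | inj₂ (inj₁ (refl , s)) = trans (cong f s) r
    ... | inj₂ (inj₂ (_ , _ , s)) = cong f s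
    part : ∀ {z w} → partOf z ≡ partOf w → partOf (swap x y z) ≡ partOf (swap x y w)
    part {z} {w} r = trans (keep partOf p z) (trans r (sym (keep partOf p w)))
    block : ∀ {z w} → c z ≡ c w → c (swap x y z) ≡ c (swap x y w)
    block {z} {w} r = trans (keep c q z) (trans r (sym (keep c q w)))

  cA : Fin m₁ → Fin n₁ → ℕ
  cA a i = c (inj₁ (a , i))
  cB : Fin m₂ → Fin n₂ → ℕ
  cB b k = c (inj₂ (b , k))

  cA-injective : ∀ {a i k} → cA a i ≡ cA a k → i ≡ k
  cA-injective p = cong proj₂ (inj₁-injective (vertex-ext refl p))
  cB-injective : ∀ {b i k} → cB b i ≡ cB b k → i ≡ k
  cB-injective p = cong proj₂ (inj₂-injective (vertex-ext refl p))

  meetsA : ∀ n (a : Fin m₁) → Dec (∃ λ i → cA a i ≡ n)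
  meetsA n a = Fin.any? (λ i → cA a i ≟ n)
  meetsB : ∀ n (b : Fin m₂) → Dec (∃ λ k → cB b k ≡ n)
  meetsB n b = Fin.any? (λ k → cB b k ≟ n)

  abstract
    XA : ℕ → Vec Bool m₁
    XA n = Vec.tabulate (does ∘ meetsA n)
    SB : ℕ → Vec Bool m₂
    SB n = Vec.tabulate (does ∘ meetsB n)

    lookup-XA : ∀ n a → lookup (XA n) a ≡ does (meetsA n a)
    lookup-XA n a = Vec.lookup∘tabulate (does ∘ meetsA n) a
    lookup-SB : ∀ n b → lookup (SB n) b ≡ does (meetsB n b)
    lookup-SB n b = Vec.lookup∘tabulate (does ∘ meetsB n) b

  sig : ℕ → Edge m₁ m₂
  sig n = XA n , SB n

  sig⁺ : ∀ {n} y → c y ≡ n → has (sig n) (partOf y) ≡ true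
  sig⁺ {n} (inj₁ (a , i)) p = trans (lookup-XA n a) (dec-true (meetsA n a) (i , p))
  sig⁺ {n} (inj₂ (b , k)) p = trans (lookup-SB n b) (dec-true (meetsB n b) (k , p))

  sig⁻ : ∀ {n} p → has (sig n) p ≡ true → ∃ λ y → partOf y ≡ p × c y ≡ n
  sig⁻ {n} (inj₁ a) q with i , r ← does-true (meetsA n a) (trans (sym (lookup-XA n a)) q) = inj₁ (a , i) , refl , r
  sig⁻ {n} (inj₂ b) q with k , r ← does-true (meetsB n b) (trans (sym (lookup-SB n b)) q) = inj₂ (b , k) , refl , r

  -- A vertex is determined by its part and its block, so `g` and `g⁻` are inverse as soon as they
  -- are inverse on parts and on blocks.
  module Lift (π π⁻ : Part m₁ m₂ → Part m₁ m₂) (ππ⁻ : ∀ p → π (π⁻ p) ≡ p) (π⁻π : ∀ p → π⁻ (π p) ≡ p) (g g⁻ : V → V)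
    (part : ∀ x → partOf (g x) ≡ π (partOf x)) (part⁻ : ∀ x → partOf (g⁻ x) ≡ π⁻ (partOf x))
    (block : ∀ {x y} → c x ≡ c y → c (g x) ≡ c (g y)) (block⁻ : ∀ {x y} → c x ≡ c y → c (g⁻ x) ≡ c (g⁻ y))
    (gg⁻ : ∀ x → c (g (g⁻ x)) ≡ c x) (g⁻g : ∀ x → c (g⁻ (g x)) ≡ c x) where

    identity : ∀ x → g x ≡ x
    identity = trivial g g⁻
      (λ x → vertex-ext (trans (part (g⁻ x)) (trans (cong π (part⁻ x)) (ππ⁻ _))) (gg⁻ x))
      (λ x → vertex-ext (trans (part⁻ (g x)) (trans (cong π⁻ (part x)) (π⁻π _))) (g⁻g x))
      (λ {x} {y} p → trans (part x) (trans (cong π p) (sym (part y))))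
      (λ {x} {y} p → trans (part⁻ x) (trans (cong π⁻ p) (sym (part⁻ y)))) block block⁻

  swapℕ : ℕ → ℕ → ℕ → ℕ
  swapℕ a b n = if does (n ≟ a) then b else (if does (n ≟ b) then a else n)

  swapℕ-cases : ∀ a b n → (n ≡ a × swapℕ a b n ≡ b) ⊎ (n ≡ b × swapℕ a b n ≡ a) ⊎ (swapℕ a b n ≡ n)
  swapℕ-cases a b n with does (n ≟ a) in p
  ... | true = inj₁ (does-true (n ≟ a) p , refl)
  ... | false with does (n ≟ b) in q
  ...   | true = inj₂ (inj₁ (does-true (n ≟ b) q , refl))
  ...   | false = inj₂ (inj₂ refl)

  swapℕ-left : ∀ a b → swapℕ a b a ≡ b
  swapℕ-left a b = cong (λ z → if z then b else (if does (a ≟ b) then a else a)) (dec-true (a ≟ a) refl)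

  swapℕ-right : ∀ a b → swapℕ a b b ≡ a
  swapℕ-right a b with swapℕ-cases a b b
  ... | inj₁ (p , q) = trans q p
  ... | inj₂ (inj₁ (_ , q)) = q
  ... | inj₂ (inj₂ q) with does (b ≟ a) in p
  ...   | true = does-true (b ≟ a) p
  ...   | false = cong (λ z → if z then a else b) (dec-true (b ≟ b) refl)

  swapℕ-involutive : ∀ a b n → swapℕ a b (swapℕ a b n) ≡ n
  swapℕ-involutive a b n with swapℕ-cases a b n
  ... | inj₁ (refl , p) = trans (cong (swapℕ a b) p) (swapℕ-right a b)
  ... | inj₂ (inj₁ (refl , p)) = trans (cong (swapℕ a b) p) (swapℕ-left a b)
  ... | inj₂ (inj₂ p) = trans (cong (swapℕ a b) p) p

  -- Blocks meeting the same parts coincide: otherwise exchange them.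
  block-ext : ∀ x y → sig (c x) ≡ sig (c y) → c x ≡ c y
  block-ext x y eq = trans (sym (cong c (identity x))) (trans (g-block x) (swapℕ-left (c x) (c y)))
    where
    f : ℕ → ℕ
    f = swapℕ (c x) (c y)
    sig-f : ∀ n → sig (f n) ≡ sig n
    sig-f n with swapℕ-cases (c x) (c y) n
    ... | inj₁ (refl , p) = trans (cong sig p) (sym eq)
    ... | inj₂ (inj₁ (refl , p)) = trans (cong sig p) eq
    ... | inj₂ (inj₂ p) = cong sig p
    move : ∀ z → ∃ λ z′ → partOf z′ ≡ partOf z × c z′ ≡ f (c z)
    move z = sig⁻ (partOf z) (trans (cong (λ e → has e (partOf z)) (sig-f (c z))) (sig⁺ z refl))
    g : V → V
    g z = proj₁ (move z)
    g-part : ∀ z → partOf (g z) ≡ partOf z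
    g-part z = proj₁ (proj₂ (move z))
    g-block : ∀ z → c (g z) ≡ f (c z)
    g-block z = proj₂ (proj₂ (move z))
    respects : ∀ {z w} → c z ≡ c w → c (g z) ≡ c (g w)
    respects {z} {w} p = trans (g-block z) (trans (cong f p) (sym (g-block w)))
    twice : ∀ z → c (g (g z)) ≡ c z
    twice z = trans (g-block (g z)) (trans (cong f (g-block z)) (swapℕ-involutive (c x) (c y) (c z)))
    open Lift id id (λ _ → refl) (λ _ → refl) g g g-part g-part (λ {z} {w} → respects {z} {w}) (λ {z} {w} → respects {z} {w}) twice twice

  Carries : (Part m₁ m₂ → Part m₁ m₂) → Set
  Carries π = ∀ x → ∃ λ y → partOf y ≡ π (partOf x) × (∀ p → has (sig (c y)) (π p) ≡ has (sig (c x)) p)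

  -- A permutation of the parts that carries blocks to blocks lifts to an automorphism: x goes to
  -- the vertex where the image of its block meets the image of its part.
  no-symmetry : (π π⁻ : Part m₁ m₂ → Part m₁ m₂) → (∀ p → π (π⁻ p) ≡ p) → (∀ p → π⁻ (π p) ≡ p) →
    Carries π → Carries π⁻ → ∀ x → π (partOf x) ≡ partOf x
  no-symmetry π π⁻ ππ⁻ π⁻π carry carry⁻ x = trans (sym (part x)) (cong partOf (identity x))
    where
    g g⁻ : V → V
    g  = proj₁ ∘ carry
    g⁻ = proj₁ ∘ carry⁻
    part : ∀ x → partOf (g x) ≡ π (partOf x)
    part x = proj₁ (proj₂ (carry x))
    part⁻ : ∀ x → partOf (g⁻ x) ≡ π⁻ (partOf x)
    part⁻ x = proj₁ (proj₂ (carry⁻ x))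
    sig-g : ∀ x p → has (sig (c (g x))) (π p) ≡ has (sig (c x)) p
    sig-g x = proj₂ (proj₂ (carry x))
    sig-g⁻ : ∀ x p → has (sig (c (g⁻ x))) (π⁻ p) ≡ has (sig (c x)) p
    sig-g⁻ x = proj₂ (proj₂ (carry⁻ x))
    sig-g′ : ∀ x p → has (sig (c (g x))) p ≡ has (sig (c x)) (π⁻ p)
    sig-g′ x p = trans (cong (has (sig (c (g x)))) (sym (ππ⁻ p))) (sig-g x (π⁻ p))
    sig-g⁻′ : ∀ x p → has (sig (c (g⁻ x))) p ≡ has (sig (c x)) (π p)
    sig-g⁻′ x p = trans (cong (has (sig (c (g⁻ x)))) (sym (π⁻π p))) (sig-g⁻ x (π p))
    same : ∀ {x y} → (∀ p → has (sig (c x)) p ≡ has (sig (c y)) p) → c x ≡ c y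
    same {x} {y} h = block-ext x y (edge-ext h)
    open Lift π π⁻ ππ⁻ π⁻π g g⁻ part part⁻
      (λ {x} {y} q → same {g x} {g y} λ p → trans (sig-g′ x p) (trans (cong (λ n → has (sig n) (π⁻ p)) q) (sym (sig-g′ y p))))
      (λ {x} {y} q → same {g⁻ x} {g⁻ y} λ p → trans (sig-g⁻′ x p) (trans (cong (λ n → has (sig n) (π p)) q) (sym (sig-g⁻′ y p))))
      (λ x → same {g (g⁻ x)} {x} λ p → trans (sig-g′ (g⁻ x) p) (sig-g⁻ x p))
      (λ x → same {g⁻ (g x)} {x} λ p → trans (sig-g⁻′ (g x) p) (sig-g x p))

-- The counting bound and its case of equality

≟-sym : ∀ a b → does (a ≟ b) ≡ does (b ≟ a)
≟-sym a b = bool-ext (λ p → dec-true (b ≟ a) (sym (does-true (a ≟ b) p))) (λ p → dec-true (a ≟ b) (sym (does-true (b ≟ a) p)))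

card-0 : ∀ {m} {X : Vec Bool m} → card X ≡ 0 → ∀ i → lookup X i ≡ false
card-0 {X = X} p i = Bool.¬-not λ q → contradiction (≤-trans (≤-reflexive (cong ind (sym q))) (term≤∑ (ind ∘ lookup X) i)) (<⇒≱ (s≤s (≤-reflexive p)))

card-1 : ∀ {m} {X : Vec Bool m} → card X ≡ 1 → ∀ {i k} → lookup X i ≡ true → lookup X k ≡ true → i ≡ k
card-1 {X = X} p {i} {k} q r with i Fin.≟ k
... | yes s = s
... | no ¬s = contradiction (≤-trans (≤-reflexive (cong₂ (λ x y → ind x + ind y) (sym q) (sym r))) (two-terms≤∑ (ind ∘ lookup X) ¬s)) (<⇒≱ (s≤s (≤-reflexive p)))

∈⇒1≤card : ∀ {m} {X : Vec Bool m} {i} → lookup X i ≡ true → 1 ≤ card X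
∈⇒1≤card {X = X} {i} p = ≤-trans (≤-reflexive (cong ind (sym p))) (term≤∑ (ind ∘ lookup X) i)

co-0 : ∀ {m} {X : Vec Bool m} → co X ≡ 0 → ∀ i → lookup X i ≡ true
co-0 {X = X} p i = Bool.¬-not λ q → contradiction (≤-trans (≤-reflexive (cong (ind ∘ not) (sym q))) (term≤∑ (ind ∘ not ∘ lookup X) i)) (<⇒≱ (s≤s (≤-reflexive p)))

module Weights {m₁ n₁ m₂′ n₂ : ℕ} (c : Vertex m₁ n₁ (suc m₂′) n₂ → ℕ) (dist : IsDistinguishing (K m₁ n₁ (suc m₂′) n₂) c) where
  open Distinguished c dist public
  open Surplus m₂′ public

  -- A vertex of a small part in block n sends `w n` to every vertex of a large part in that block:
  -- `F n` is what it sends in all, `u n` what such a vertex receives.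
  w u F : ℕ → ℕ
  w n = if does (card (XA n) ≟ 1) then 2 else 1
  u n = card (XA n) * w n
  F n = card (SB n) * w n

  alone outside : ℕ → Bool
  alone n   = does (card (XA n) ≟ 1)
  outside n = does (card (XA n) ≟ 0)

  sumA : ∀ n → ∑ (λ a → ∑ (λ i → ind (does (cA a i ≟ n)))) ≡ card (XA n)
  sumA n = ∑-cong λ a → trans (∑-any (cA a) n cA-injective) (cong ind (sym (lookup-XA n a)))

  sumB : ∀ n → ∑ (λ b → ∑ (λ k → ind (does (cB b k ≟ n)))) ≡ card (SB n)
  sumB n = ∑-cong λ b → trans (∑-any (cB b) n cB-injective) (cong ind (sym (lookup-SB n b)))

  W : Fin m₂ → Fin n₂ → Fin m₁ → Fin n₁ → ℕ
  W b k a i = ind (does (cA a i ≟ cB b k)) * w (cA a i)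

  W-sumA : ∀ b k → ∑ (λ a → ∑ (λ i → W b k a i)) ≡ u (cB b k)
  W-sumA b k = trans (∑-cong λ a → trans (∑-cong λ i → at a i) (∑-*ʳ (w n) (λ i → ind (does (cA a i ≟ n)))))
    (trans (∑-*ʳ (w n) (λ a → ∑ (λ i → ind (does (cA a i ≟ n))))) (cong (_* w n) (sumA n)))
    where
    n = cB b k
    at : ∀ a i → W b k a i ≡ ind (does (cA a i ≟ n)) * w n
    at a i with does (cA a i ≟ n) in eq
    ... | true  = cong (λ x → 1 * w x) (does-true (cA a i ≟ n) eq)
    ... | false = refl

  W-sumB : ∀ a i → ∑ (λ b → ∑ (λ k → W b k a i)) ≡ F (cA a i)
  W-sumB a i = trans (∑-cong λ b → trans (∑-cong λ k → cong (λ z → ind z * w n) (≟-sym n (cB b k))) (∑-*ʳ (w n) (λ k → ind (does (cB b k ≟ n)))))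
    (trans (∑-*ʳ (w n) (λ b → ∑ (λ k → ind (does (cB b k ≟ n))))) (cong (_* w n) (sumB n)))
    where
    n = cA a i

  double-count : ∑ (λ b → ∑ (λ k → u (cB b k))) ≡ ∑ (λ a → ∑ (λ i → F (cA a i)))
  double-count = begin
    ∑ (λ b → ∑ (λ k → u (cB b k)))                       ≡⟨ ∑-cong (λ b → ∑-cong λ k → sym (W-sumA b k)) ⟩
    ∑ (λ b → ∑ (λ k → ∑ (λ a → ∑ (λ i → W b k a i))))    ≡⟨ ∑-cong (λ b → ∑-swap (λ k a → ∑ (λ i → W b k a i))) ⟩
    ∑ (λ b → ∑ (λ a → ∑ (λ k → ∑ (λ i → W b k a i))))    ≡⟨ ∑-swap (λ b a → ∑ (λ k → ∑ (λ i → W b k a i))) ⟩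
    ∑ (λ a → ∑ (λ b → ∑ (λ k → ∑ (λ i → W b k a i))))    ≡⟨ ∑-cong (λ a → ∑-cong λ b → ∑-swap (λ k i → W b k a i)) ⟩
    ∑ (λ a → ∑ (λ b → ∑ (λ i → ∑ (λ k → W b k a i))))    ≡⟨ ∑-cong (λ a → ∑-swap (λ b i → ∑ (λ k → W b k a i))) ⟩
    ∑ (λ a → ∑ (λ i → ∑ (λ b → ∑ (λ k → W b k a i))))    ≡⟨ ∑-cong (λ a → ∑-cong λ i → W-sumB a i) ⟩
    ∑ (λ a → ∑ (λ i → F (cA a i)))                       ∎
    where open ≡-Reasoning

  at-least-2 : ∀ n → 2 ≤ 2 * ind (outside n) + u n
  at-least-2 n = go (card (XA n))
    where
    go : ∀ k → 2 ≤ 2 * ind (does (k ≟ 0)) + k * (if does (k ≟ 1) then 2 else 1)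
    go zero          = ≤-refl
    go (suc zero)    = ≤-refl
    go (suc (suc k)) = s≤s (s≤s z≤n)

  F≤ : ∀ n → F n ≤ m₂ + ind (alone n) * (2 * card (SB n) ∸ m₂)
  F≤ n with alone n
  ... | true  = ≤-trans (≤-reflexive (*-comm (card (SB n)) 2)) (≤-trans (m≤n+m∸n (2 * card (SB n)) m₂) (≤-reflexive (cong (m₂ +_) (sym (+-identityʳ _)))))
  ... | false = ≤-trans (≤-reflexive (*-identityʳ _)) (≤-trans (card≤ (SB n)) (m≤m+n m₂ 0))

  -- Blocks without small parts differ in their sets of large parts by `block-ext`, so at most 2^(m₂
  -- - 1) of them meet b.
  module AtB (b : Fin m₂) = DistinctSubsets (outside ∘ cB b) (SB ∘ cB b)
    (λ {i} {k} p q r → cB-injective (block-ext (inj₂ (b , i)) (inj₂ (b , k)) (cong₂ _,_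
      (lookup-ext λ a → trans (card-0 {X = XA (cB b i)} (does-true (card (XA (cB b i)) ≟ 0) p) a) (sym (card-0 {X = XA (cB b k)} (does-true (card (XA (cB b k)) ≟ 0) q) a))) r)))
    (λ T → ind (lookup T b))

  self-A : ∀ a i → lookup (XA (cA a i)) a ≡ true
  self-A a i = sig⁺ (inj₁ (a , i)) refl

  self-B : ∀ b k → lookup (SB (cB b k)) b ≡ true
  self-B b k = sig⁺ (inj₂ (b , k)) refl

  same-alone : ∀ {a i k} → alone (cA a i) ≡ true → alone (cA a k) ≡ true → XA (cA a i) ≡ XA (cA a k)
  same-alone {a} {i} {k} p q = lookup-ext λ a′ → bool-ext (to {i} {k} p a′) (to {k} {i} q a′)
    where
    to : ∀ {i k} → alone (cA a i) ≡ true → ∀ a′ → lookup (XA (cA a i)) a′ ≡ true → lookup (XA (cA a k)) a′ ≡ true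
    to {i} {k} p a′ q = subst (λ z → lookup (XA (cA a k)) z ≡ true) (card-1 {X = XA (cA a i)} (does-true (card (XA (cA a i)) ≟ 1) p) (self-A a i) q) (self-A a k)

  module AtA (a : Fin m₁) = DistinctSubsets (alone ∘ cA a) (SB ∘ cA a)
    (λ {i} {k} p q r → cA-injective (block-ext (inj₁ (a , i)) (inj₁ (a , k)) (cong₂ _,_ (same-alone {a} {i} {k} p q) r)))
    (λ T → 2 * card T ∸ m₂)

  outside-sum : ∀ b → ∑ (λ k → ind (outside (cB b k))) ≡ ∑ (λ k → ind (outside (cB b k)) * ind (lookup (SB (cB b k)) b))
  outside-sum b = ∑-cong λ k → trans (sym (*-identityʳ _)) (cong (λ z → ind (outside (cB b k)) * ind z) (sym (self-B b k)))

  outside-bound : ∀ b → ∑ (λ k → ind (outside (cB b k))) ≤ 2 ^ m₂′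
  outside-bound b = ≤-trans (≤-reflexive (outside-sum b)) (≤-trans (AtB.bound b) (≤-reflexive (count-∋ b)))

  A-total : ∀ a → ∑ (λ i → m₂ + ind (alone (cA a i)) * (2 * card (SB (cA a i)) ∸ m₂)) ≡
    n₁ * m₂ + ∑ (λ i → ind (alone (cA a i)) * (2 * card (SB (cA a i)) ∸ m₂))
  A-total a = trans (∑-+ (λ _ → m₂) (λ i → ind (alone (cA a i)) * (2 * card (SB (cA a i)) ∸ m₂))) (cong (_+ ∑ (λ i → ind (alone (cA a i)) * (2 * card (SB (cA a i)) ∸ m₂))) (∑-const n₁ m₂))

  A-bound : ∀ a → ∑ (λ i → F (cA a i)) ≤ n₁ * m₂ + surplus
  A-bound a = ≤-trans (∑-mono λ i → F≤ (cA a i)) (≤-trans (≤-reflexive (A-total a)) (+-monoʳ-≤ (n₁ * m₂) (AtA.bound a)))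

  -- `X₀` ≤ `X₁ᴮ + X₁ᴬ` ≤ `X₂ᴮ + X₂ᴬ` is the bound times 2 m₂. Every vertex of a large part demands
  -- 2; it is served by small parts (`X₁ᴬ`) or credited 2 if its block has none (`X₁ᴮ`). The last
  -- sum holds the maxima of both.
  X₀ X₁ᴮ X₁ᴬ X₂ᴮ X₂ᴬ : ℕ
  X₀  = ∑ {m₂} (λ b → ∑ {n₂} (λ k → 2))
  X₁ᴮ = ∑ (λ b → 2 * ∑ (λ k → ind (outside (cB b k))))
  X₁ᴬ = ∑ (λ a → ∑ (λ i → F (cA a i)))
  X₂ᴮ = ∑ {m₂} (λ b → 2 * 2 ^ m₂′)
  X₂ᴬ = ∑ {m₁} (λ a → n₁ * m₂ + surplus)

  X₁≡ : ∑ (λ b → ∑ (λ k → 2 * ind (outside (cB b k)) + u (cB b k))) ≡ X₁ᴮ + X₁ᴬ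
  X₁≡ = trans (∑-cong λ b → trans (∑-+ (λ k → 2 * ind (outside (cB b k))) (λ k → u (cB b k))) (cong (_+ ∑ (λ k → u (cB b k))) (∑-*ˡ 2 (λ k → ind (outside (cB b k))))))
    (trans (∑-+ (λ b → 2 * ∑ (λ k → ind (outside (cB b k)))) (λ b → ∑ (λ k → u (cB b k)))) (cong (X₁ᴮ +_) double-count))

  X₀≤X₁ : X₀ ≤ X₁ᴮ + X₁ᴬ
  X₀≤X₁ = ≤-trans (∑-mono λ b → ∑-mono λ k → at-least-2 (cB b k)) (≤-reflexive X₁≡)

  X₁ᴮ≤ : X₁ᴮ ≤ X₂ᴮ
  X₁ᴮ≤ = ∑-mono λ b → *-monoʳ-≤ 2 (outside-bound b)

  X₁ᴬ≤ : X₁ᴬ ≤ X₂ᴬ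
  X₁ᴬ≤ = ∑-mono A-bound

  module _ (n₁≡ : n₁ ≡ 2 + N) where
    X₀≡ : X₀ ≡ 2 * m₂ * n₂
    X₀≡ = trans (∑-cong {m₂} λ b → ∑-const n₂ 2) (trans (∑-const m₂ (n₂ * 2)) (arith m₂ n₂))
      where
      arith : ∀ a b → a * (b * 2) ≡ 2 * a * b
      arith = solve-∀

    X₂≡ : X₂ᴮ + X₂ᴬ ≡ 2 * m₂ * (suc D * m₁ + 2 ^ m₂′)
    X₂≡ = trans (cong₂ _+_ (∑-const m₂ (2 * 2 ^ m₂′)) (trans (∑-const m₁ (n₁ * m₂ + surplus)) (cong (m₁ *_) per-A))) (arith m₂ (2 ^ m₂′) m₁ D)
      where
      split : ∀ n m s → (2 + n) * m + s ≡ 2 * m + (n * m + s)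
      split = solve-∀
      per-A : n₁ * m₂ + surplus ≡ 2 * m₂ + 2 * (m₂ * D)
      per-A = trans (cong (λ x → x * m₂ + surplus) n₁≡) (trans (split N m₂ surplus) (cong (2 * m₂ +_) surplus-total))
      arith : ∀ m p a d → m * (2 * p) + a * (2 * m + 2 * (m * d)) ≡ 2 * m * (suc d * a + p)
      arith = solve-∀

    upper-bound : n₂ ≤ suc D * m₁ + 2 ^ m₂′
    upper-bound = *-cancelˡ-≤ (2 * m₂) (≤-trans (≤-reflexive (sym X₀≡)) (≤-trans X₀≤X₁ (≤-trans (+-mono-≤ X₁ᴮ≤ X₁ᴬ≤) (≤-reflexive X₂≡))))

    module Tight (tight : suc D * m₁ + 2 ^ m₂′ ≤ n₂) where
      X₂≤X₀ : X₂ᴮ + X₂ᴬ ≤ X₀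
      X₂≤X₀ = ≤-trans (≤-reflexive X₂≡) (≤-trans (*-monoʳ-≤ (2 * m₂) tight) (≤-reflexive (sym X₀≡)))

      squeezed : X₂ᴮ ≤ X₁ᴮ × X₂ᴬ ≤ X₁ᴬ
      squeezed = squeeze X₁ᴮ≤ X₁ᴬ≤ (≤-trans X₂≤X₀ X₀≤X₁)

      -- The whole chain of inequalities collapses, first for each large part and then for each of
      -- its vertices.
      exactly-2 : ∀ b k → 2 ≡ 2 * ind (outside (cB b k)) + u (cB b k)
      exactly-2 b = ∑-mono-≡ (λ k → at-least-2 (cB b k)) (≤-reflexive (sym
        (∑-mono-≡ (λ b → ∑-mono λ k → at-least-2 (cB b k)) (≤-trans (≤-reflexive X₁≡) (≤-trans (+-mono-≤ X₁ᴮ≤ X₁ᴬ≤) X₂≤X₀)) b)))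

      all-inner : ∀ b T → lookup T b ≡ true → ∃ λ k → card (XA (cB b k)) ≡ 0 × SB (cB b k) ≡ T
      all-inner b T p = proj₁ hit , does-true (card (XA (cB b (proj₁ hit))) ≟ 0) (proj₁ (proj₂ hit)) , proj₂ (proj₂ hit)
        where
        tight-b : 2 * ∑ (λ k → ind (outside (cB b k))) ≡ 2 * 2 ^ m₂′
        tight-b = ∑-mono-≡ (λ b → *-monoʳ-≤ 2 (outside-bound b)) (proj₁ squeezed) b
        hit : ∃ λ k → outside (cB b k) ≡ true × SB (cB b k) ≡ T
        hit = AtB.all-hit b (≤-trans (≤-reflexive (count-∋ b)) (≤-trans (≤-reflexive (sym (*-cancelˡ-≡ _ _ 2 tight-b))) (≤-reflexive (outside-sum b))))
          T (≤-reflexive (cong ind (sym p)))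

      A-exact : ∀ a → n₁ * m₂ + surplus ≤ ∑ (λ i → F (cA a i))
      A-exact a = ≤-reflexive (sym (∑-mono-≡ A-bound (proj₂ squeezed) a))

      all-alone : ∀ a T → m₂ < 2 * card T → ∃ λ i → card (XA (cA a i)) ≡ 1 × SB (cA a i) ≡ T
      all-alone a T p = proj₁ hit , does-true (card (XA (cA a (proj₁ hit))) ≟ 1) (proj₁ (proj₂ hit)) , proj₂ (proj₂ hit)
        where
        hit : ∃ λ i → alone (cA a i) ≡ true × SB (cA a i) ≡ T
        hit = AtA.all-hit a (+-cancelˡ-≤ (n₁ * m₂) _ _ (≤-trans (A-exact a) (≤-trans (∑-mono λ i → F≤ (cA a i)) (≤-reflexive (A-total a)))))
          T (m<n⇒0<n∸m p)

      F-exact : ∀ a i → F (cA a i) ≡ m₂ + ind (alone (cA a i)) * (2 * card (SB (cA a i)) ∸ m₂)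
      F-exact a = ∑-mono-≡ (λ i → F≤ (cA a i)) (≤-trans (≤-trans (≤-reflexive (A-total a)) (+-monoʳ-≤ (n₁ * m₂) (AtA.bound a))) (A-exact a))

      data BlockKind (n : ℕ) : Set where
        alone′ : card (XA n) ≡ 1 → m₂ ≤ 2 * card (SB n) → BlockKind n
        double′ : card (XA n) ≡ 2 → (∀ b → lookup (SB n) b ≡ true) → BlockKind n

      -- If |X| ≠ 1, `F-exact` gives |S| = m₂, so the block contains every large part; `exactly-2`,
      -- applied at one of them, then forces |X| = 2.
      kind : ∀ a i → BlockKind (cA a i)
      kind a i = go (does (card (XA n) ≟ 1)) refl
        where
        n = cA a i
        go : ∀ z → does (card (XA n) ≟ 1) ≡ z → BlockKind n
        go true p = alone′ (does-true (card (XA n) ≟ 1) p) (≤-trans (m≤m+n m₂ _) (≤-reflexive (trans (sym (F-exact a i))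
          (trans (cong (λ z → card (SB n) * (if z then 2 else 1)) p) (*-comm (card (SB n)) 2)))))
        go false p = double′ (pick (does (card (XA n) ≟ 0)) refl) all
          where
          cardB : card (SB n) ≡ m₂
          cardB = trans (sym (*-identityʳ _)) (trans (cong (λ z → card (SB n) * (if z then 2 else 1)) (sym p)) (trans (F-exact a i)
            (trans (cong (λ z → m₂ + ind z * (2 * card (SB n) ∸ m₂)) p) (+-identityʳ m₂))))
          all : ∀ b → lookup (SB n) b ≡ true
          all = co-0 {X = SB n} (+-cancelˡ-≡ (card (SB n)) _ _ (trans (card+co (SB n)) (trans (sym cardB) (sym (+-identityʳ _)))))
          at-B : ∃ λ k → cB zero k ≡ n
          at-B = does-true (meetsB n zero) (trans (sym (lookup-SB n zero)) (all zero))
          u≡ : 2 ≡ 2 * ind (outside n) + u n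
          u≡ = subst (λ n → 2 ≡ 2 * ind (outside n) + u n) (proj₂ at-B) (exactly-2 zero (proj₁ at-B))
          pick : ∀ z → does (card (XA n) ≟ 0) ≡ z → card (XA n) ≡ 2
          pick true q = contradiction (≤-trans (∈⇒1≤card {X = XA n} (self-A a i)) (≤-reflexive (does-true (card (XA n) ≟ 0) q))) λ ()
          pick false q = sym (trans u≡ (trans (cong₂ (λ x y → 2 * ind x + card (XA n) * (if y then 2 else 1)) q p) (*-identityʳ _)))


-- Orbits of two involutions

least : ∀ {P : ℕ → Set} → (∀ n → Dec (P n)) → ∀ n → P n → ∃ λ m → P m × (∀ k → k < m → ¬ P k)
least P? zero p = zero , p , λ _ ()
least P? (suc n) p with P? 0
... | yes q = zero , q , λ _ ()
... | no ¬q with m , r , below ← least (P? ∘ suc) n p = suc m , r , λ { zero _ → ¬q ; (suc k) (s≤s k<) → below k k< }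

-- Two involutions of a finite set; the orbits of the group they generate are paths and cycles.
module Dihedral {D : Set} (_≟D_ : (x y : D) → Dec (x ≡ y)) {M : ℕ} (enc : D → Fin M) (enc-injective : ∀ {x y} → enc x ≡ enc y → x ≡ y)
  (α β : D → D) (αα : ∀ x → α (α x) ≡ x) (ββ : ∀ x → β (β x) ≡ x) where

  φ φ⁻ : D → D
  φ  x = α (β x)
  φ⁻ x = β (α x)

  φ^ : ℕ → D → D
  φ^ zero    x = x
  φ^ (suc k) x = φ (φ^ k x)

  φ-injective : ∀ {x y} → φ x ≡ φ y → x ≡ y
  φ-injective {x} {y} p = trans (sym (ββ x)) (trans (cong β (trans (sym (αα _)) (trans (cong α p) (αα _)))) (ββ y))

  φ^-injective : ∀ k {x y} → φ^ k x ≡ φ^ k y → x ≡ y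
  φ^-injective zero    p = p
  φ^-injective (suc k) p = φ^-injective k (φ-injective p)

  φ^-+ : ∀ k l x → φ^ (k + l) x ≡ φ^ k (φ^ l x)
  φ^-+ zero    l x = refl
  φ^-+ (suc k) l x = cong φ (φ^-+ k l x)

  φ^-suc : ∀ k x → φ^ (suc k) x ≡ φ^ k (φ x)
  φ^-suc k x = trans (cong (λ n → φ^ n x) (+-comm 1 k)) (φ^-+ k 1 x)

  φ^-comm : ∀ k l x → φ^ k (φ^ l x) ≡ φ^ l (φ^ k x)
  φ^-comm k l x = trans (sym (φ^-+ k l x)) (trans (cong (λ n → φ^ n x) (+-comm k l)) (φ^-+ l k x))

  φ^-* : ∀ q N {x} → φ^ N x ≡ x → φ^ (q * N) x ≡ x
  φ^-* zero    N p = refl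
  φ^-* (suc q) N {x} p = trans (φ^-+ N (q * N) x) (trans (cong (φ^ N) (φ^-* q N p)) p)

  -- For an involution γ this is the dihedral relation γ φ γ = φ⁻¹, written without the inverse.
  Reverses : (D → D) → Set
  Reverses γ = ∀ y → φ (γ (φ y)) ≡ γ y

  α-reverses : Reverses α
  α-reverses y = trans (cong (α ∘ β) (αα (β y))) (cong α (ββ y))

  β-reverses : Reverses β
  β-reverses y = trans (cong α (ββ (φ y))) (αα (β y))

  reverse^ : ∀ {γ} → Reverses γ → ∀ k x → φ^ k (γ (φ^ k x)) ≡ γ x
  reverse^ r zero x = refl
  reverse^ {γ} r (suc k) x = trans (φ^-suc k (γ (φ (φ^ k x)))) (trans (cong (φ^ k) (r (φ^ k x))) (reverse^ r k x))

  period : ∀ x → ∃ λ k → φ^ (suc k) x ≡ x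
  period x = go (Fin.pigeonhole {M} {suc M} ≤-refl (λ i → enc (φ^ (toℕ i) x)))
    where
    go : (∃ λ i → ∃ λ k → i Fin.< k × enc (φ^ (toℕ i) x) ≡ enc (φ^ (toℕ k) x)) → ∃ λ k → φ^ (suc k) x ≡ x
    go (i , k , i<k , p) = toℕ k ∸ suc (toℕ i) , φ^-injective (toℕ i) (trans (sym (φ^-+ (toℕ i) (suc (toℕ k ∸ suc (toℕ i))) x))
      (trans (cong (λ n → φ^ n x) (trans (+-suc (toℕ i) _) (m+[n∸m]≡n i<k))) (sym (enc-injective p))))

  abstract
    per′ : D → ℕ
    per′ x = proj₁ (least (λ k → φ^ (suc k) x ≟D x) (proj₁ (period x)) (proj₂ (period x)))

    per′-period : ∀ x → φ^ (suc (per′ x)) x ≡ x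
    per′-period x = proj₁ (proj₂ (least (λ k → φ^ (suc k) x ≟D x) (proj₁ (period x)) (proj₂ (period x))))

    per′-least : ∀ x k → k < per′ x → φ^ (suc k) x ≢ x
    per′-least x = proj₂ (proj₂ (least (λ k → φ^ (suc k) x ≟D x) (proj₁ (period x)) (proj₂ (period x))))

  per : D → ℕ
  per x = suc (per′ x)

  per-period : ∀ x → φ^ (per x) x ≡ x
  per-period = per′-period

  per-least : ∀ x k → suc k < per x → φ^ (suc k) x ≢ x
  per-least x k p = per′-least x k (s≤s⁻¹ p)

  per-≤ : ∀ {x y} → (∀ k → φ^ k x ≡ x → φ^ k y ≡ y) → per y ≤ per x
  per-≤ {x} {y} f = ≮⇒≥ λ p → per-least y (per′ x) p (f (per x) (per-period x))

  per-γ : ∀ {γ} → Reverses γ → (∀ x → γ (γ x) ≡ x) → ∀ x → per (γ x) ≡ per x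
  per-γ {γ} r γγ x = ≤-antisym (per-≤ (to x)) (per-≤ λ k p → subst (λ z → φ^ k z ≡ z) (γγ x) (to (γ x) k p))
    where
    to : ∀ x k → φ^ k x ≡ x → φ^ k (γ x) ≡ γ x
    to x k p = trans (cong (φ^ k ∘ γ) (sym p)) (reverse^ r k x)

  per-φ^ : ∀ l x → per (φ^ l x) ≡ per x
  per-φ^ l x = ≤-antisym (per-≤ λ k p → trans (φ^-comm k l x) (cong (φ^ l) p))
    (per-≤ λ k p → φ^-injective l (trans (φ^-comm l k x) p))

  halfway′ : ∀ {n} → (∃ λ p → n ≡ p + p ⊎ n ≡ suc (p + p)) → ℕ
  halfway′     (p , inj₁ _) = p
  halfway′ {n} (_ , inj₂ _) = n

  -- Half of an even n, and n itself if n is odd: then φ to the power n is the identity on an orbit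
  -- of length n, and odd orbits stay as they are.
  halfway : ℕ → ℕ
  halfway n = halfway′ (halves n)

  halfway-double : ∀ k → halfway (k + k) ≡ k
  halfway-double k = go (halves (k + k))
    where
    go : (h : ∃ λ p → k + k ≡ p + p ⊎ k + k ≡ suc (p + p)) → halfway′ h ≡ k
    go (p , inj₁ q) = double-injective p k (sym q)
    go (p , inj₂ q) = contradiction (sym q) (odd≢even p k)

  half : D → ℕ
  half x = halfway (per x)

  halfway-twice : ∀ n {x} → φ^ n x ≡ x → φ^ (halfway n + halfway n) x ≡ x
  halfway-twice n {x} p with halves n
  ... | q , inj₁ refl = p
  ... | q , inj₂ refl = trans (φ^-+ n n x) (trans (cong (φ^ n) p) p)

  -- Half a turn of every orbit of even length.
  ρ : D → D
  ρ x = φ^ (half x) x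

  ρρ : ∀ x → ρ (ρ x) ≡ x
  ρρ x = trans (cong (λ n → φ^ (halfway n) (ρ x)) (per-φ^ (half x) x)) (trans (sym (φ^-+ (half x) (half x) x)) (halfway-twice (per x) (per-period x)))

  -- γ turns the rotation by h into the rotation by -h, and the two agree because 2 h is a multiple
  -- of the period.
  ρ-γ : ∀ {γ} → Reverses γ → (∀ x → γ (γ x) ≡ x) → ∀ x → ρ (γ x) ≡ γ (ρ x)
  ρ-γ {γ} r γγ x = trans (cong (λ n → φ^ (halfway n) (γ x)) (per-γ r γγ x)) (trans (cong (φ^ h) (sym (reverse^ r h x)))
    (trans (sym (φ^-+ h h y)) (trans (cong (λ n → φ^ (halfway n + halfway n) y) (sym per-y)) (halfway-twice (per y) (per-period y)))))
    where
    h = half x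
    y = γ (φ^ h x)
    per-y : per y ≡ per x
    per-y = trans (per-γ r γγ (φ^ h x)) (per-φ^ h x)

  ρ-α : ∀ x → ρ (α x) ≡ α (ρ x)
  ρ-α = ρ-γ α-reverses αα
  ρ-β : ∀ x → ρ (β x) ≡ β (ρ x)
  ρ-β = ρ-γ β-reverses ββ

  -- On a path, half a turn exchanges the two ends.
  ρ-moves : ∀ {d} → β d ≡ d → (∀ k → α (φ^ k d) ≢ φ^ k d) → ρ d ≢ d
  ρ-moves {d} fixed free p = go (halves (per d))
    where
    y≡ : ∀ l → per d ≡ suc (l + l) → φ^ (suc l) d ≡ β (φ^ l d)
    y≡ l q = φ^-injective l (trans (sym (φ^-+ l (suc l) d)) (trans (cong (λ n → φ^ n d) (trans (+-suc l l) (sym q)))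
      (trans (per-period d) (trans (sym fixed) (sym (reverse^ β-reverses l d))))))
    go : (∃ λ q → per d ≡ q + q ⊎ per d ≡ suc (q + q)) → ⊥
    go (suc l , inj₁ q) = per-least d l (subst (suc l <_) (sym q) (m<m+n (suc l) (s≤s z≤n)))
      (trans (cong (λ k → φ^ k d) (sym (trans (cong halfway q) (halfway-double (suc l))))) p)
    -- With odd period 2 l + 1, the dart φ^(l+1) d equals β (φ^l d), and α would fix it. So the
    -- period of a path is even.
    go (l , inj₂ q) = free (suc l) (cong α (y≡ l q))

  Orbit : D → D → Set
  Orbit d x = ∃ λ k → φ^ k d ≡ x

  reduce : ∀ d k → φ^ (k % per d) d ≡ φ^ k d
  reduce d k = trans (cong (φ^ (k % per d)) (sym (φ^-* (k / per d) (per d) (per-period d)))) (trans (sym (φ^-+ (k % per d) (k / per d * per d) d))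
    (cong (λ n → φ^ n d) (sym (DivMod.m≡m%n+[m/n]*n k (per d)))))

  orbit? : ∀ d x → Dec (Orbit d x)
  orbit? d x = go (Fin.any? {n = per d} (λ k → φ^ (toℕ k) d ≟D x))
    where
    go : Dec (∃ λ (k : Fin (per d)) → φ^ (toℕ k) d ≡ x) → Dec (Orbit d x)
    go (yes (k , p)) = yes (toℕ k , p)
    go (no ¬p) = no λ { (k , q) → ¬p (fromℕ< (DivMod.m%n<n k (per d)) ,
      trans (cong (λ n → φ^ n d) (Fin.toℕ-fromℕ< (DivMod.m%n<n k (per d)))) (trans (reduce d k) q)) }

  orbit-bounded : ∀ {d x} → Orbit d x → ∃ λ k → k < per d × φ^ k d ≡ x
  orbit-bounded {d} (k , p) = k % per d , DivMod.m%n<n k (per d) , trans (reduce d k) p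

  -- If β fixes both d and φ^k d, then φ^(2k) d = d; with 0 < k < `per d` this leaves only 2 k =
  -- `per d`, the half turn.
  path-ends : ∀ {d x} → β d ≡ d → β x ≡ x → Orbit d x → x ≡ d ⊎ x ≡ ρ d
  path-ends {d} {x} fixed-d fixed-x o = go (orbit-bounded o)
    where
    go : (∃ λ k → k < per d × φ^ k d ≡ x) → x ≡ d ⊎ x ≡ ρ d
    go (zero  , _  , p) = inj₁ (sym p)
    go (suc k , k< , p) = compare-with (<-cmp (suc k + suc k) (per d))
      where
      twice : φ^ (suc k + suc k) d ≡ d
      twice = trans (φ^-+ (suc k) (suc k) d) (trans (cong (φ^ (suc k)) (trans p (trans (sym fixed-x) (cong β (sym p)))))
        (trans (reverse^ β-reverses (suc k) d) fixed-d))
      compare-with : Tri (suc k + suc k < per d) (suc k + suc k ≡ per d) (per d < suc k + suc k) → x ≡ d ⊎ x ≡ ρ d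
      compare-with (tri< q _ _) = contradiction twice (per-least d (k + suc k) q)
      compare-with (tri≈ _ q _) = inj₂ (trans (sym p) (cong (λ n → φ^ n d) (sym (trans (cong halfway (sym q)) (halfway-double (suc k))))))
      compare-with (tri> _ _ q) = contradiction (φ^-injective (per d) (trans (sym (φ^-+ (per d) (suc e) d)) (trans (cong (λ n → φ^ n d) N+e) (trans twice (sym (per-period d))))))
        (per-least d e (+-cancelˡ-< (per d) (suc e) (per d) (subst (_< per d + per d) (sym N+e) (+-mono-< k< k<))))
        where
        e = suc k + suc k ∸ suc (per d)
        N+e : per d + suc e ≡ suc k + suc k
        N+e = trans (+-suc (per d) e) (m+[n∸m]≡n q)

  orbit-sym : ∀ {d x} → Orbit d x → Orbit x d
  orbit-sym {d} (k , refl) = k * per′ d , trans (sym (φ^-+ (k * per′ d) k d)) (trans (cong (λ n → φ^ n d) (trans (+-comm (k * per′ d) k) (sym (*-suc k (per′ d)))))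
    (φ^-* k (per d) (per-period d)))

  orbit-trans : ∀ {d x y} → Orbit d x → Orbit x y → Orbit d y
  orbit-trans {d} (k , refl) (l , refl) = l + k , φ^-+ l k d

  orbit-φ : ∀ {d x} → Orbit d x → Orbit d (φ x)
  orbit-φ (k , refl) = suc k , refl

  orbit-γ : ∀ {γ} → Reverses γ → ∀ {d x} → Orbit d x → Orbit (γ d) (γ x)
  orbit-γ r {d} (k , refl) = orbit-sym (k , reverse^ r k d)

  record Commuting : Set where
    field
      f f⁻ : D → D
      ff⁻ : ∀ x → f (f⁻ x) ≡ x
      f⁻f : ∀ x → f⁻ (f x) ≡ x
      f-α  : ∀ x → f (α x) ≡ α (f x)
      f-β  : ∀ x → f (β x) ≡ β (f x)
      f⁻-α : ∀ x → f⁻ (α x) ≡ α (f⁻ x)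
      f⁻-β : ∀ x → f⁻ (β x) ≡ β (f⁻ x)

  half-turn : Commuting
  half-turn = record { f = ρ ; f⁻ = ρ ; ff⁻ = ρρ ; f⁻f = ρρ ; f-α = ρ-α ; f-β = ρ-β ; f⁻-α = ρ-α ; f⁻-β = ρ-β }

  -- As β fixes d, the φ-orbit of d is closed under α and β. A half turn of this orbit alone
  -- therefore still commutes with both.
  module HalfTurnAt (d : D) (β-fixed : β d ≡ d) where
    orbit-α : ∀ {x} → Orbit d x → Orbit d (α x)
    orbit-α o = orbit-trans (1 , cong α β-fixed) (orbit-γ α-reverses o)

    orbit-β : ∀ {x} → Orbit d x → Orbit d (β x)
    orbit-β {x} o = subst (λ e → Orbit e (β x)) β-fixed (orbit-γ β-reverses o)

    orbit-ρ : ∀ {x} → Orbit d x → Orbit d (ρ x)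
    orbit-ρ {x} o = orbit-trans o (half x , refl)

    turn : D → D
    turn x = if does (orbit? d x) then ρ x else x

    turn-in : ∀ {x} → Orbit d x → turn x ≡ ρ x
    turn-in {x} o = cong (λ b → if b then ρ x else x) (dec-true (orbit? d x) o)

    turn-out : ∀ {x} → ¬ Orbit d x → turn x ≡ x
    turn-out {x} o = cong (λ b → if b then ρ x else x) (dec-false (orbit? d x) o)

    turn-turn : ∀ x → turn (turn x) ≡ x
    turn-turn x = go (orbit? d x)
      where
      go : Dec (Orbit d x) → turn (turn x) ≡ x
      go (yes o) = trans (cong turn (turn-in o)) (trans (turn-in (orbit-ρ o)) (ρρ x))
      go (no ¬o) = trans (cong turn (turn-out ¬o)) (turn-out ¬o)

    turn-γ : ∀ {γ : D → D} → (∀ {x} → Orbit d x → Orbit d (γ x)) → (∀ x → γ (γ x) ≡ x) → (∀ x → ρ (γ x) ≡ γ (ρ x)) → ∀ x → turn (γ x) ≡ γ (turn x)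
    turn-γ {γ} closed γγ comm x = go (orbit? d x)
      where
      go : Dec (Orbit d x) → turn (γ x) ≡ γ (turn x)
      go (yes o) = trans (turn-in (closed o)) (trans (comm x) (cong γ (sym (turn-in o))))
      go (no ¬o) = trans (turn-out λ o → ¬o (subst (Orbit d) (γγ x) (closed o))) (cong γ (sym (turn-out ¬o)))

    half-turn-at : Commuting
    half-turn-at = record { f = turn ; f⁻ = turn ; ff⁻ = turn-turn ; f⁻f = turn-turn ; f-α = turn-α ; f-β = turn-β ; f⁻-α = turn-α ; f⁻-β = turn-β }
      where
      turn-α : ∀ x → turn (α x) ≡ α (turn x)
      turn-α = turn-γ orbit-α αα ρ-α
      turn-β : ∀ x → turn (β x) ≡ β (turn x)
      turn-β = turn-γ orbit-β ββ ρ-β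

  -- A cycle splits into two orbits of φ, which turn in opposite directions.
  module Rotation (d : D) (apart : ¬ Orbit d (α d)) where

    data Position (x : D) : Set where
      ahead   : Orbit d x → ¬ Orbit (α d) x → Position x
      behind  : ¬ Orbit d x → Orbit (α d) x → Position x
      outside : ¬ Orbit d x → ¬ Orbit (α d) x → Position x

    not-both : ∀ {x} → Orbit d x → ¬ Orbit (α d) x
    not-both o o′ = apart (orbit-trans o (orbit-sym o′))

    position : ∀ x → Position x
    position x with orbit? d x | orbit? (α d) x
    ... | yes o | _      = ahead o (not-both o)
    ... | no ¬o | yes o′ = behind ¬o o′
    ... | no ¬o | no ¬o′ = outside ¬o ¬o′

    turn : D → D
    turn x = if does (orbit? d x) then φ x else (if does (orbit? (α d) x) then φ⁻ x else x)

    turn-ahead : ∀ {x} → Orbit d x → turn x ≡ φ x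
    turn-ahead {x} o = cong (λ b → if b then φ x else (if does (orbit? (α d) x) then φ⁻ x else x)) (dec-true (orbit? d x) o)

    turn-behind : ∀ {x} → Orbit (α d) x → turn x ≡ φ⁻ x
    turn-behind {x} o = cong₂ (λ b b′ → if b then φ x else (if b′ then φ⁻ x else x)) (dec-false (orbit? d x) (λ o′ → not-both o′ o)) (dec-true (orbit? (α d) x) o)

    turn-outside : ∀ {x} → ¬ Orbit d x → ¬ Orbit (α d) x → turn x ≡ x
    turn-outside {x} p q = cong₂ (λ b b′ → if b then φ x else (if b′ then φ⁻ x else x)) (dec-false (orbit? d x) p) (dec-false (orbit? (α d) x) q)

    α-behind : ∀ {x} → Orbit d x → Orbit (α d) (α x)
    α-behind = orbit-γ α-reverses

    α-ahead : ∀ {x} → Orbit (α d) x → Orbit d (α x)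
    α-ahead {x} o = subst (λ e → Orbit e (α x)) (αα d) (orbit-γ α-reverses o)

    β-behind : ∀ {x} → Orbit d x → Orbit (α d) (β x)
    β-behind {x} o = subst (Orbit (α d)) (αα (β x)) (α-behind (orbit-φ o))

    β-ahead : ∀ {x} → Orbit (α d) x → Orbit d (β x)
    β-ahead {x} o = subst (Orbit d) (αα (β x)) (α-ahead (orbit-φ o))

    turn-α : ∀ x → turn (α x) ≡ α (turn x)
    turn-α x with position x
    ... | ahead o _  = trans (turn-behind (α-behind o)) (trans (cong β (αα x)) (trans (sym (αα (β x))) (cong α (sym (turn-ahead o)))))
    ... | behind _ o = trans (turn-ahead (α-ahead o)) (cong α (sym (turn-behind o)))
    ... | outside p q = trans (turn-outside (λ o → q (subst (Orbit (α d)) (αα x) (α-behind o))) (λ o → p (subst (Orbit d) (αα x) (α-ahead o)))) (cong α (sym (turn-outside p q)))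

    turn-β : ∀ x → turn (β x) ≡ β (turn x)
    turn-β x with position x
    ... | ahead o _  = trans (turn-behind (β-behind o)) (cong β (sym (turn-ahead o)))
    ... | behind _ o = trans (turn-ahead (β-ahead o)) (trans (cong α (ββ x)) (trans (sym (ββ (α x))) (cong β (sym (turn-behind o)))))
    ... | outside p q = trans (turn-outside (λ o → q (subst (Orbit (α d)) (ββ x) (β-behind o))) (λ o → p (subst (Orbit d) (ββ x) (β-ahead o)))) (cong β (sym (turn-outside p q)))

  module Rotations (d : D) (apart : ¬ Orbit d (α d)) where
    apart′ : ¬ Orbit (α d) (α (α d))
    apart′ o = apart (orbit-sym (subst (Orbit (α d)) (αα d) o))

    module R = Rotation d apart
    module L = Rotation (α d) apart′

    back : ∀ {x} → Orbit d x → Orbit (α (α d)) x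
    back {x} = subst (λ e → Orbit e x) (sym (αα d))

    φφ⁻ : ∀ x → φ (φ⁻ x) ≡ x
    φφ⁻ x = trans (cong α (ββ (α x))) (αα x)
    φ⁻φ : ∀ x → φ⁻ (φ x) ≡ x
    φ⁻φ x = trans (cong β (αα (β x))) (ββ x)

    orbit-φ⁻ : ∀ {e x} → Orbit e x → Orbit e (φ⁻ x)
    orbit-φ⁻ {e} {x} o = orbit-trans o (orbit-sym (1 , φφ⁻ x))

    LR : ∀ x → L.turn (R.turn x) ≡ x
    LR x with R.position x
    ... | R.ahead o _   = trans (cong L.turn (R.turn-ahead o)) (trans (L.turn-behind (back (orbit-φ o))) (φ⁻φ x))
    ... | R.behind _ o  = trans (cong L.turn (R.turn-behind o)) (trans (L.turn-ahead (orbit-φ⁻ o)) (φφ⁻ x))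
    ... | R.outside p q = trans (cong L.turn (R.turn-outside p q)) (L.turn-outside q (λ o → p (subst (λ e → Orbit e x) (αα d) o)))

    RL : ∀ x → R.turn (L.turn x) ≡ x
    RL x with R.position x
    ... | R.ahead o _   = trans (cong R.turn (L.turn-behind (back o))) (trans (R.turn-ahead (orbit-φ⁻ o)) (φφ⁻ x))
    ... | R.behind _ o  = trans (cong R.turn (L.turn-ahead o)) (trans (R.turn-behind (orbit-φ o)) (φ⁻φ x))
    ... | R.outside p q = trans (cong R.turn (L.turn-outside q (λ o → p (subst (λ e → Orbit e x) (αα d) o)))) (R.turn-outside p q)

    rotation : Commuting
    rotation = record { f = R.turn ; f⁻ = L.turn ; ff⁻ = RL ; f⁻f = LR ; f-α = R.turn-α ; f-β = R.turn-β ; f⁻-α = L.turn-α ; f⁻-β = L.turn-β }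

  -- If α d = φ^k d, the reflection has a fixed midpoint: α fixes φ^l d when k = 2 l, and β fixes it
  -- when k = 2 l + 1.
  α-apart : ∀ {d} → (∀ k → α (φ^ k d) ≢ φ^ k d) → (∀ k → β (φ^ k d) ≢ φ^ k d) → ¬ Orbit d (α d)
  α-apart {d} α-free β-free (k , p) with halves k
  ... | l , inj₁ refl = α-free l (φ^-injective l (trans (reverse^ α-reverses l d) (trans (sym p) (φ^-+ l l d))))
  ... | l , inj₂ refl = β-free l (φ^-injective l (trans (reverse^ β-reverses l d) (trans βd≡ (φ^-+ l l d))))
    where
    βd≡ : β d ≡ φ^ (l + l) d
    βd≡ = φ-injective (trans (cong α (ββ d)) (sym p))

-- Excluding equality for odd m₂ and for m₂ = 2

relabel : ∀ {m} → (Fin m → Fin m) → Vec Bool m → Vec Bool m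
relabel τ⁻ S = Vec.tabulate (lookup S ∘ τ⁻)

lookup-relabel : ∀ {m} (τ τ⁻ : Fin m → Fin m) → (∀ b → τ⁻ (τ b) ≡ b) → ∀ S b → lookup (relabel τ⁻ S) (τ b) ≡ lookup S b
lookup-relabel τ τ⁻ τ⁻τ S b = trans (Vec.lookup∘tabulate (lookup S ∘ τ⁻) (τ b)) (cong (lookup S) (τ⁻τ b))

three-terms≤∑ : ∀ {n} (f : Fin n → ℕ) {i j k} → j ≢ i → k ≢ i → j ≢ k → f i + (f j + f k) ≤ ∑ f
three-terms≤∑ {n} f {i} {j} {k} j≢i k≢i j≢k = ≤-trans (+-mono-≤ only rest) (≤-reflexive (trans (sym (∑-+ (λ x → on x * f x) (λ x → off x * f x))) (∑-cong both)))
  where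
  on off : Fin n → ℕ
  on x  = ind (does (x Fin.≟ i))
  off x = ind (not (does (x Fin.≟ i)))
  both : ∀ x → on x * f x + off x * f x ≡ f x
  both x = trans (sym (*-distribʳ-+ (f x) (on x) (off x))) (trans (cong (_* f x) (ind-not (does (x Fin.≟ i)))) (+-identityʳ (f x)))
  only : f i ≤ ∑ (λ x → on x * f x)
  only = ≤-trans (≤-reflexive (trans (sym (+-identityʳ (f i))) (cong (λ b → ind b * f i) (sym (dec-true (i Fin.≟ i) refl))))) (term≤∑ (λ x → on x * f x) i)
  keep : ∀ {x} → x ≢ i → f x ≡ off x * f x
  keep {x} p = trans (sym (+-identityʳ (f x))) (cong (λ b → ind (not b) * f x) (sym (dec-false (x Fin.≟ i) p)))
  rest : f j + f k ≤ ∑ (λ x → off x * f x)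
  rest = ≤-trans (≤-reflexive (cong₂ _+_ (keep j≢i) (keep k≢i))) (two-terms≤∑ (λ x → off x * f x) j≢k)

card-2 : ∀ {m} {X : Vec Bool m} → card X ≡ 2 → ∀ {i j k} → lookup X i ≡ true → lookup X j ≡ true → lookup X k ≡ true → j ≢ i → k ≢ i → j ≡ k
card-2 {X = X} c {i} {j} {k} p q r j≢i k≢i with j Fin.≟ k
... | yes s = s
... | no ¬s = contradiction (≤-trans (≤-reflexive (cong₂ _+_ (cong ind (sym p)) (cong₂ (λ x y → ind x + ind y) (sym q) (sym r)))) (three-terms≤∑ (ind ∘ lookup X) j≢i k≢i ¬s))
  (<⇒≱ (s≤s (≤-reflexive c)))

module TightSymmetry {m₁ n₁ m₂′ n₂ : ℕ} (c : Vertex m₁ n₁ (suc m₂′) n₂ → ℕ) (dist : IsDistinguishing (K m₁ n₁ (suc m₂′) n₂) c)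
  (n₁≡ : n₁ ≡ 2 + Surplus.N m₂′) (tight : suc (Surplus.D m₂′) * m₁ + 2 ^ m₂′ ≤ n₂) where
  open Weights c dist public
  open Tight n₁≡ tight public

  BlockCarried : (Part m₁ m₂ → Part m₁ m₂) → ℕ → Set
  BlockCarried π n = ∃ λ y → ∀ p → has (sig (c y)) (π p) ≡ has (sig n) p

  module Carrying (σ : Fin m₁ → Fin m₁) (τ τ⁻ : Fin m₂ → Fin m₂) (τ⁻τ : ∀ b → τ⁻ (τ b) ≡ b)
    (A-carried : ∀ a i → BlockCarried (Sum.map σ τ) (cA a i)) where
    π : Part m₁ m₂ → Part m₁ m₂
    π = Sum.map σ τ

    -- Only blocks that meet a small part put a condition on the symmetry: by `all-inner` every
    -- nonempty set of large parts is itself a block, so these are permuted by any τ.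
    B-carried : ∀ b k → BlockCarried π (cB b k)
    B-carried b k = go (card (XA n) ≟ 0)
      where
      n = cB b k
      T : Vec Bool m₂
      T = relabel τ⁻ (SB n)
      T≡ : ∀ b → lookup T (τ b) ≡ lookup (SB n) b
      T≡ = lookup-relabel τ τ⁻ τ⁻τ (SB n)
      inner : card (XA n) ≡ 0 → (∃ λ k′ → card (XA (cB (τ b) k′)) ≡ 0 × SB (cB (τ b) k′) ≡ T) → BlockCarried π n
      inner p (k′ , q , r) = inj₂ (τ b , k′) , λ
        { (inj₁ a) → trans (card-0 {X = XA (cB (τ b) k′)} q (σ a)) (sym (card-0 {X = XA n} p a))
        ; (inj₂ b′) → trans (cong (λ S → lookup S (τ b′)) r) (T≡ b′) }
      meeting : (∃ λ a → 1 ≤ ind (lookup (XA n) a)) → BlockCarried π n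
      meeting (a , p) = through (does-true (meetsA n a) (trans (sym (lookup-XA n a)) (1≤ind⇒true p)))
        where
        through : (∃ λ i → cA a i ≡ n) → BlockCarried π n
        through (i , q) = subst (BlockCarried π) q (A-carried a i)
      go : Dec (card (XA n) ≡ 0) → BlockCarried π n
      go (yes p) = inner p (all-inner (τ b) T (trans (T≡ b) (self-B b k)))
      go (no ¬p) = meeting (∑-pos (ind ∘ lookup (XA n)) (n≢0⇒n>0 ¬p))

    carried : ∀ x → BlockCarried π (c x)
    carried (inj₁ (a , i)) = A-carried a i
    carried (inj₂ (b , k)) = B-carried b k

    carries : Carries π
    carries x = go (carried x)
      where
      go : BlockCarried π (c x) → ∃ λ y → partOf y ≡ π (partOf x) × (∀ p → has (sig (c y)) (π p) ≡ has (sig (c x)) p)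
      go (y , h) = finish (sig⁻ (π (partOf x)) (trans (h (partOf x)) (sig⁺ x refl)))
        where
        finish : (∃ λ z → partOf z ≡ π (partOf x) × c z ≡ c y) → ∃ λ y → partOf y ≡ π (partOf x) × (∀ p → has (sig (c y)) (π p) ≡ has (sig (c x)) p)
        finish (z , q , r) = z , q , λ p → trans (cong (λ n → has (sig n) (π p)) r) (h p)

  map-inverse : ∀ {σ σ⁻ : Fin m₁ → Fin m₁} {τ τ⁻ : Fin m₂ → Fin m₂} → (∀ a → σ (σ⁻ a) ≡ a) → (∀ b → τ (τ⁻ b) ≡ b) →
    ∀ p → Sum.map σ τ (Sum.map σ⁻ τ⁻ p) ≡ p
  map-inverse p q (inj₁ a) = cong inj₁ (p a)
  map-inverse p q (inj₂ b) = cong inj₂ (q b)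

  rigid : (σ σ⁻ : Fin m₁ → Fin m₁) (τ τ⁻ : Fin m₂ → Fin m₂) → (∀ a → σ (σ⁻ a) ≡ a) → (∀ a → σ⁻ (σ a) ≡ a) →
    (∀ b → τ (τ⁻ b) ≡ b) → (∀ b → τ⁻ (τ b) ≡ b) →
    (∀ a i → BlockCarried (Sum.map σ τ) (cA a i)) → (∀ a i → BlockCarried (Sum.map σ⁻ τ⁻) (cA a i)) →
    ∀ x → Sum.map σ τ (partOf x) ≡ partOf x
  rigid σ σ⁻ τ τ⁻ σσ⁻ σ⁻σ ττ⁻ τ⁻τ h h⁻ = no-symmetry (Sum.map σ τ) (Sum.map σ⁻ τ⁻) (map-inverse σσ⁻ ττ⁻) (map-inverse σ⁻σ τ⁻τ)
    (Carrying.carries σ τ τ⁻ τ⁻τ h) (Carrying.carries σ⁻ τ⁻ τ ττ⁻ h⁻)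

-- m₂ odd: the large parts can be permuted arbitrarily.
module OddTight {m₁ n₁ m n₂ p : ℕ} (c : Vertex m₁ n₁ (2 + m) n₂ → ℕ) (dist : IsDistinguishing (K m₁ n₁ (2 + m) n₂) c)
  (n₁≡ : n₁ ≡ 2 + Surplus.N (suc m)) (tight : suc (Surplus.D (suc m)) * m₁ + 2 ^ suc m ≤ n₂) (is-odd : 2 + m ≡ suc (p + p)) where
  open TightSymmetry c dist n₁≡ tight

  τ : Fin (2 + m) → Fin (2 + m)
  τ zero          = suc zero
  τ (suc zero)    = zero
  τ (suc (suc b)) = suc (suc b)

  ττ : ∀ b → τ (τ b) ≡ b
  ττ zero          = refl
  ττ (suc zero)    = refl
  ττ (suc (suc b)) = refl

  not-half : ∀ k → 2 + m ≢ 2 * k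
  not-half k q = odd≢even p k (trans (sym is-odd) (trans q (cong (k +_) (+-identityʳ k))))

  -- For odd m₂ the inequality 2|S| ≥ m₂ is strict, and `all-alone` provides {a} ∪ S for every S
  -- with 2|S| > m₂, in particular for the image of S under τ.
  A-carried : ∀ a i → BlockCarried (Sum.map id τ) (cA a i)
  A-carried a i = go (kind a i)
    where
    n = cA a i
    T : Vec Bool m₂
    T = relabel τ (SB n)
    T≡ : ∀ b → lookup T (τ b) ≡ lookup (SB n) b
    T≡ = lookup-relabel τ τ ττ (SB n)
    go : BlockKind n → BlockCarried (Sum.map id τ) n
    go (double′ _ all) = inj₁ (a , i) , λ { (inj₁ a′) → refl ; (inj₂ b) → trans (all (τ b)) (sym (all b)) }
    go (alone′ p q) = finish (all-alone a T (subst (λ k → m₂ < 2 * k) (sym (card-relabel {X = SB n} {T} id τ τ ττ ττ T≡)) (≤∧≢⇒< q (not-half (card (SB n))))))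
      where
      finish : (∃ λ i′ → card (XA (cA a i′)) ≡ 1 × SB (cA a i′) ≡ T) → BlockCarried (Sum.map id τ) n
      finish (i′ , r , s) = inj₁ (a , i′) , λ
        { (inj₁ a′) → cong (λ X → lookup X a′) (same-alone {a} {i′} {i} (dec-true (card (XA (cA a i′)) ≟ 1) r) (dec-true (card (XA n) ≟ 1) p))
        ; (inj₂ b) → trans (cong (λ S → lookup S (τ b)) s) (T≡ b) }

  impossible : Fin n₂ → ⊥
  impossible k = case rigid id id τ τ (λ _ → refl) (λ _ → refl) ττ ττ A-carried A-carried (inj₂ (zero , k)) of λ ()

-- m₂ ≤ 2, so n₁ = 3: besides {a} together with all large parts, each small part a lies in two further blocks,
-- which link the small parts into paths and cycles.
other : Fin 3 → Fin 3 → Fin 3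
other zero             zero             = zero
other zero             (suc zero)       = suc (suc zero)
other zero             (suc (suc zero)) = suc zero
other (suc zero)       zero             = suc (suc zero)
other (suc zero)       (suc zero)       = suc zero
other (suc zero)       (suc (suc zero)) = zero
other (suc (suc zero)) zero             = suc zero
other (suc (suc zero)) (suc zero)       = zero
other (suc (suc zero)) (suc (suc zero)) = suc (suc zero)

other-self : ∀ p → other p p ≡ p
other-self zero             = refl
other-self (suc zero)       = refl
other-self (suc (suc zero)) = refl

other-other : ∀ p i → other p (other p i) ≡ i
other-other zero             zero             = refl
other-other zero             (suc zero)       = refl
other-other zero             (suc (suc zero)) = refl
other-other (suc zero)       zero             = refl
other-other (suc zero)       (suc zero)       = refl
other-other (suc zero)       (suc (suc zero)) = refl
other-other (suc (suc zero)) zero             = refl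
other-other (suc (suc zero)) (suc zero)       = refl
other-other (suc (suc zero)) (suc (suc zero)) = refl

other-fixed : ∀ p i → other p i ≡ i → i ≡ p
other-fixed zero             zero             _ = refl
other-fixed zero             (suc zero)       ()
other-fixed zero             (suc (suc zero)) ()
other-fixed (suc zero)       zero             ()
other-fixed (suc zero)       (suc zero)       _ = refl
other-fixed (suc zero)       (suc (suc zero)) ()
other-fixed (suc (suc zero)) zero             ()
other-fixed (suc (suc zero)) (suc zero)       ()
other-fixed (suc (suc zero)) (suc (suc zero)) _ = refl

pick : Fin 3 → Fin 3
pick zero    = suc zero
pick (suc _) = zero

pick≢ : ∀ p → pick p ≢ p
pick≢ zero    ()
pick≢ (suc _) ()

pick-or-other : ∀ p i → i ≢ p → i ≡ pick p ⊎ i ≡ other p (pick p)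
pick-or-other zero             zero             q = contradiction refl q
pick-or-other zero             (suc zero)       q = inj₁ refl
pick-or-other zero             (suc (suc zero)) q = inj₂ refl
pick-or-other (suc zero)       zero             q = inj₁ refl
pick-or-other (suc zero)       (suc zero)       q = contradiction refl q
pick-or-other (suc zero)       (suc (suc zero)) q = inj₂ refl
pick-or-other (suc (suc zero)) zero             q = inj₁ refl
pick-or-other (suc (suc zero)) (suc zero)       q = inj₂ refl
pick-or-other (suc (suc zero)) (suc (suc zero)) q = contradiction refl q

module LinkedTight {m₁ m₂′ n₂ : ℕ} (c : Vertex m₁ 3 (suc m₂′) n₂ → ℕ) (dist : IsDistinguishing (K m₁ 3 (suc m₂′) n₂) c)
  (n₁≡ : 3 ≡ 2 + Surplus.N m₂′) (tight : suc (Surplus.D m₂′) * m₁ + 2 ^ m₂′ ≤ n₂) where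
  open TightSymmetry c dist n₁≡ tight public

  -- A vertex of a small part, read as one end of the block that contains it. α passes to the other
  -- free dart of the same small part, β to the other small part of the same block.
  Dart : Set
  Dart = Fin m₁ × Fin 3

  cD : Dart → ℕ
  cD (a , i) = cA a i

  dart-ext : ∀ {x y} → proj₁ x ≡ proj₁ y → cD x ≡ cD y → x ≡ y
  dart-ext {a , i} {.a , k} refl q = cong (a ,_) (cA-injective q)

  abstract
    full-alone : ∀ a → ∃ λ i → card (XA (cA a i)) ≡ 1 × SB (cA a i) ≡ full
    full-alone a = all-alone a full (subst (λ k → m₂ < 2 * k) (sym (card-full {m₂})) (m<m+n m₂ (s≤s z≤n)))

  i₀ : Fin m₁ → Fin 3
  i₀ a = proj₁ (full-alone a)

  Special : Dart → Set
  Special (a , i) = i ≡ i₀ a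

  special? : ∀ x → Dec (Special x)
  special? (a , i) = i Fin.≟ i₀ a

  special-card : ∀ {x} → Special x → card (XA (cD x)) ≡ 1
  special-card {a , _} refl = proj₁ (proj₂ (full-alone a))

  special-full : ∀ {x} → Special x → SB (cD x) ≡ full
  special-full {a , _} refl = proj₂ (proj₂ (full-alone a))

  special-intro : ∀ x → card (XA (cD x)) ≡ 1 → SB (cD x) ≡ full → Special x
  special-intro (a , i) p q = cA-injective (block-ext (inj₁ (a , i)) (inj₁ (a , i₀ a)) (cong₂ _,_
    (same-alone {a} {i} {i₀ a} (dec-true (card (XA (cA a i)) ≟ 1) p) (dec-true (card (XA (cA a (i₀ a))) ≟ 1) (special-card {a , i₀ a} refl)))
    (trans q (sym (special-full {a , i₀ a} refl)))))

  special-block : ∀ {x y} → cD x ≡ cD y → Special x → Special y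
  special-block {x} {y} p s = special-intro y (trans (cong (card ∘ XA) (sym p)) (special-card {x} s)) (trans (cong SB (sym p)) (special-full {x} s))

  α : Dart → Dart
  α (a , i) = a , other (i₀ a) i

  αα : ∀ x → α (α x) ≡ x
  αα (a , i) = cong (a ,_) (other-other (i₀ a) i)

  α-special : ∀ {x} → Special x → α x ≡ x
  α-special {a , _} refl = cong (a ,_) (other-self (i₀ a))

  α-fixed : ∀ {x} → α x ≡ x → Special x
  α-fixed {a , i} p = other-fixed (i₀ a) i (cong proj₂ p)

  partner? : ∀ x → Dec (∃ λ a′ → a′ ≢ proj₁ x × lookup (XA (cD x)) a′ ≡ true)
  partner? x = Fin.any? (λ a′ → ¬? (a′ Fin.≟ proj₁ x) ×-dec (lookup (XA (cD x)) a′ Bool.≟ true))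

  dart-at : ∀ n a → lookup (XA n) a ≡ true → ∃ λ i → cA a i ≡ n
  dart-at n a q = does-true (meetsA n a) (trans (sym (lookup-XA n a)) q)

  partner : ∀ x → Dec (∃ λ a′ → a′ ≢ proj₁ x × lookup (XA (cD x)) a′ ≡ true) →
    ∃ λ y → cD y ≡ cD x × ((proj₁ y ≢ proj₁ x) ⊎ (y ≡ x × (∀ a′ → lookup (XA (cD x)) a′ ≡ true → a′ ≡ proj₁ x)))
  partner x (yes (a′ , p , q)) = (a′ , proj₁ (dart-at (cD x) a′ q)) , proj₂ (dart-at (cD x) a′ q) , inj₁ p
  partner x (no ¬p) = x , refl , inj₂ (refl , λ a′ q → decidable-stable (a′ Fin.≟ proj₁ x) λ r → ¬p (a′ , r , q))

  abstract
    β : Dart → Dart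
    β x = proj₁ (partner x (partner? x))

    β-block : ∀ x → cD (β x) ≡ cD x
    β-block x = proj₁ (proj₂ (partner x (partner? x)))

    β-spec : ∀ x → (proj₁ (β x) ≢ proj₁ x) ⊎ (β x ≡ x × (∀ a′ → lookup (XA (cD x)) a′ ≡ true → a′ ≡ proj₁ x))
    β-spec x = proj₂ (proj₂ (partner x (partner? x)))

  self : ∀ x → lookup (XA (cD x)) (proj₁ x) ≡ true
  self (a , i) = self-A a i

  in-block : ∀ {x} z → cD z ≡ cD x → lookup (XA (cD x)) (proj₁ z) ≡ true
  in-block z q = subst (λ n → lookup (XA n) (proj₁ z) ≡ true) q (self z)

  alone-β : ∀ {x} → card (XA (cD x)) ≡ 1 → β x ≡ x
  alone-β {x} p = dart-ext (card-1 {X = XA (cD x)} p (in-block (β x) (β-block x)) (self x)) (β-block x)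

  -- By `kind` a block meets at most two small parts, and in each of them it has one vertex.
  mates : ∀ {z x} → cD z ≡ cD x → z ≡ x ⊎ z ≡ β x
  mates {z} {x} p = go (proj₁ z Fin.≟ proj₁ x)
    where
    go : Dec (proj₁ z ≡ proj₁ x) → z ≡ x ⊎ z ≡ β x
    go (yes q) = inj₁ (dart-ext q p)
    go (no ¬q) = inj₂ (by-kind (kind (proj₁ x) (proj₂ x)) (β-spec x))
      where
      by-kind : BlockKind (cD x) → (proj₁ (β x) ≢ proj₁ x) ⊎ (β x ≡ x × (∀ a′ → lookup (XA (cD x)) a′ ≡ true → a′ ≡ proj₁ x)) → z ≡ β x
      by-kind _ (inj₂ (_ , only)) = contradiction (only (proj₁ z) (in-block z p)) ¬q
      by-kind (alone′ r _) (inj₁ _) = contradiction (card-1 {X = XA (cD x)} r (in-block z p) (self x)) ¬q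
      by-kind (double′ r _) (inj₁ moved) = dart-ext
        (card-2 {X = XA (cD x)} r (self x) (in-block z p) (in-block (β x) (β-block x)) ¬q moved) (trans p (sym (β-block x)))

  ββ : ∀ x → β (β x) ≡ x
  ββ x with mates {x} {β x} (sym (β-block x))
  ... | inj₁ p = trans (cong β (sym p)) (sym p)
  ... | inj₂ p = sym p

  β-fixed-alone : ∀ {x} → β x ≡ x → card (XA (cD x)) ≡ 1
  β-fixed-alone {x} p = go (β-spec x)
    where
    go : (proj₁ (β x) ≢ proj₁ x) ⊎ (β x ≡ x × (∀ a′ → lookup (XA (cD x)) a′ ≡ true → a′ ≡ proj₁ x)) → card (XA (cD x)) ≡ 1
    go (inj₁ moved) = contradiction (cong proj₁ p) moved
    go (inj₂ (_ , only)) = trans (∑-single (ind ∘ lookup (XA (cD x))) (proj₁ x) λ a′ q → cong ind (Bool.¬-not λ r → q (only a′ r))) (cong ind (self x))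

  β-moved-full : ∀ {x} → β x ≢ x → ∀ b → lookup (SB (cD x)) b ≡ true
  β-moved-full {x} p = go (kind (proj₁ x) (proj₂ x))
    where
    go : BlockKind (cD x) → ∀ b → lookup (SB (cD x)) b ≡ true
    go (alone′ q _) = contradiction (alone-β {x} q) p
    go (double′ _ all) = all

  _≟D_ : (x y : Dart) → Dec (x ≡ y)
  _≟D_ = Product.≡-dec Fin._≟_ Fin._≟_

  open Dihedral _≟D_ {m₁ * 3} (λ x → Fin.combine (proj₁ x) (proj₂ x))
    (λ {x} {y} p → cong₂ _,_ (Fin.combine-injectiveˡ (proj₁ x) (proj₂ x) (proj₁ y) (proj₂ y) p) (Fin.combine-injectiveʳ (proj₁ x) (proj₂ x) (proj₁ y) (proj₂ y) p))
    α β αα ββ public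

  Free : Dart → Set
  Free x = ¬ Special x

  free-α : ∀ {x} → Free x → Free (α x)
  free-α {x} p s = p (α-fixed {x} (trans (sym (α-special {α x} s)) (αα x)))

  free-β : ∀ {x} → Free x → Free (β x)
  free-β {x} p s = p (special-block {β x} {x} (β-block x) s)

  free-φ^ : ∀ k {x} → Free x → Free (φ^ k x)
  free-φ^ zero    p = p
  free-φ^ (suc k) p = free-α {β (φ^ k _)} (free-β {φ^ k _} (free-φ^ k p))

  free-moves : ∀ {x} → Free x → ∀ k → α (φ^ k x) ≢ φ^ k x
  free-moves {x} p k q = free-φ^ k p (α-fixed {φ^ k x} q)

  flip-Commuting : Commuting → Commuting
  flip-Commuting κ = record { f = f⁻ ; f⁻ = f ; ff⁻ = f⁻f ; f⁻f = ff⁻ ; f-α = f⁻-α ; f-β = f⁻-β ; f⁻-α = f-α ; f⁻-β = f-β }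
    where open Commuting κ

  start : Fin m₁ → Dart
  start a = a , pick (i₀ a)

  start-free : ∀ a → Free (start a)
  start-free a = pick≢ (i₀ a)

  module Induced (κ : Commuting) where
    open Commuting κ public

    σ : Fin m₁ → Fin m₁
    σ a = proj₁ (f (start a))

    f-free : ∀ {x} → Free x → Free (f x)
    f-free {x} p s = p (α-fixed {x} (trans (sym (f⁻f (α x))) (trans (cong f⁻ (trans (f-α x) (α-special {f x} s))) (f⁻f x))))

    -- α exchanges the two free darts of a small part, and `f` commutes with α, so both are sent to
    -- the same small part.
    f-part : ∀ {x} → Free x → proj₁ (f x) ≡ σ (proj₁ x)
    f-part {a , i} p with pick-or-other (i₀ a) i p
    ... | inj₁ refl = refl
    ... | inj₂ refl = cong proj₁ (f-α (start a))

    f-mates : ∀ {z x} → cD z ≡ cD x → cD (f z) ≡ cD (f x)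
    f-mates {z} {x} p with mates {z} {x} p
    ... | inj₁ refl = refl
    ... | inj₂ refl = trans (cong cD (f-β x)) (β-block (f x))

  module Action (κ : Commuting) where
    module F = Induced κ
    module G = Induced (flip-Commuting κ)
    open Commuting κ

    σ σ⁻ : Fin m₁ → Fin m₁
    σ  = F.σ
    σ⁻ = G.σ

    σσ⁻ : ∀ a → σ (σ⁻ a) ≡ a
    σσ⁻ a = trans (sym (F.f-part {f⁻ (start a)} (G.f-free {start a} (start-free a)))) (cong proj₁ (ff⁻ (start a)))
    σ⁻σ : ∀ a → σ⁻ (σ a) ≡ a
    σ⁻σ a = trans (sym (G.f-part {f (start a)} (F.f-free {start a} (start-free a)))) (cong proj₁ (f⁻f (start a)))

    module _ (τ τ⁻ : Fin m₂ → Fin m₂) (labels : ∀ x → Free x → β x ≡ x → ∀ b → lookup (SB (cD (f x))) (τ b) ≡ lookup (SB (cD x)) b) where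

      -- Blocks with two small parts contain all large parts by `β-moved-full`, so the hypothesis
      -- `labels` about the ends of paths covers what is left of the free darts.
      A-carried : ∀ a i → BlockCarried (Sum.map σ τ) (cA a i)
      A-carried a i = go (special? x)
        where
        x : Dart
        x = a , i
        go : Dec (Special x) → BlockCarried (Sum.map σ τ) (cD x)
        -- On special darts `f` need not agree with `σ`, so the special block of a is sent to that
        -- of `σ a`.
        go (yes s) = inj₁ y , λ { (inj₁ a′) → bool-ext (to a′) (from a′) ; (inj₂ b) → trans (is-full y refl (τ b)) (sym (is-full x s b)) }
          where
          y : Dart
          y = σ a , i₀ (σ a)
          is-full : ∀ x → Special x → ∀ b → lookup (SB (cD x)) b ≡ true
          is-full x s b = trans (cong (λ S → lookup S b) (special-full {x} s)) (lookup-full b)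
          to : ∀ a′ → lookup (XA (cD y)) (σ a′) ≡ true → lookup (XA (cD x)) a′ ≡ true
          to a′ p = subst (λ e → lookup (XA (cD x)) e ≡ true)
            (trans (sym (σ⁻σ a)) (trans (cong σ⁻ (card-1 {X = XA (cD y)} (special-card {y} refl) (self y) p)) (σ⁻σ a′))) (self x)
          from : ∀ a′ → lookup (XA (cD x)) a′ ≡ true → lookup (XA (cD y)) (σ a′) ≡ true
          from a′ p = subst (λ e → lookup (XA (cD y)) (σ e) ≡ true) (card-1 {X = XA (cD x)} (special-card {x} s) (self x) p) (self y)
        go (no free) = inj₁ (f x) , λ { (inj₁ a′) → bool-ext (to a′) (from a′) ; (inj₂ b) → on-B (β x ≟D x) b }
          where
          to : ∀ a′ → lookup (XA (cD (f x))) (σ a′) ≡ true → lookup (XA (cD x)) a′ ≡ true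
          to a′ p = subst (λ e → lookup (XA (cD x)) e ≡ true) (trans (G.f-part {z′} z′-free) (σ⁻σ a′)) (in-block (f⁻ z′) (trans (G.f-mates {z′} {f x} z′-block) (cong cD (f⁻f x))))
            where
            found : ∃ λ k → cA (σ a′) k ≡ cD (f x)
            found = dart-at (cD (f x)) (σ a′) p
            z′ : Dart
            z′ = σ a′ , proj₁ found
            z′-block : cD z′ ≡ cD (f x)
            z′-block = proj₂ found
            z′-free : Free z′
            z′-free s = F.f-free {x} free (special-block {z′} {f x} z′-block s)
          from : ∀ a′ → lookup (XA (cD x)) a′ ≡ true → lookup (XA (cD (f x))) (σ a′) ≡ true
          from a′ p = subst (λ e → lookup (XA (cD (f x))) e ≡ true) (F.f-part {z} z-free) (in-block (f z) (F.f-mates {z} {x} (proj₂ found)))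
            where
            found : ∃ λ k → cA a′ k ≡ cD x
            found = dart-at (cD x) a′ p
            z : Dart
            z = a′ , proj₁ found
            z-free : Free z
            z-free s = free (special-block {z} {x} (proj₂ found) s)
          on-B : Dec (β x ≡ x) → ∀ b → lookup (SB (cD (f x))) (τ b) ≡ lookup (SB (cD x)) b
          on-B (yes p) b = labels x free p b
          on-B (no ¬p) b = trans (β-moved-full {f x} (λ q → ¬p (trans (sym (f⁻f (β x))) (trans (cong f⁻ (trans (f-β x) q)) (f⁻f x)))) (τ b)) (sym (β-moved-full {x} ¬p b))

  conclude : (κ : Commuting) (τ τ⁻ : Fin m₂ → Fin m₂) → (∀ b → τ (τ⁻ b) ≡ b) → (∀ b → τ⁻ (τ b) ≡ b) →
    (∀ x → Free x → β x ≡ x → ∀ b → lookup (SB (cD (Commuting.f κ x))) (τ b) ≡ lookup (SB (cD x)) b) →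
    ∀ x → Sum.map (Action.σ κ) τ (partOf x) ≡ partOf x
  conclude κ τ τ⁻ ττ⁻ τ⁻τ labels = rigid A.σ A.σ⁻ τ τ⁻ A.σσ⁻ A.σ⁻σ ττ⁻ τ⁻τ (A.A-carried τ τ⁻ labels) (A⁻.A-carried τ⁻ τ labels⁻)
    where
    module A  = Action κ
    module A⁻ = Action (flip-Commuting κ)
    open Commuting κ
    labels⁻ : ∀ x → Free x → β x ≡ x → ∀ b → lookup (SB (cD (f⁻ x))) (τ⁻ b) ≡ lookup (SB (cD x)) b
    labels⁻ x free p b = trans (sym (labels (f⁻ x) (A.G.f-free {x} free) (trans (sym (f⁻-β x)) (cong f⁻ p)) (τ⁻ b)))
      (cong₂ (λ y b → lookup (SB (cD y)) b) (ff⁻ x) (ττ⁻ b))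

module OneTight {m₁ n₂ : ℕ} (c : Vertex m₁ 3 1 n₂ → ℕ) (dist : IsDistinguishing (K m₁ 3 1 n₂) c)
  (tight : 2 * m₁ + 1 ≤ n₂) where
  open LinkedTight {m₂′ = 0} c dist refl tight

  -- For m₂ = 1 the condition 2|S| ≥ m₂ forces S to be full. A free dart is thus never the end of a
  -- path, and all components are cycles.
  end-special : ∀ x → β x ≡ x → Special x
  end-special x p = special-intro x (β-fixed-alone {x} p) (lookup-ext λ { zero → trans (go (kind (proj₁ x) (proj₂ x))) (sym (lookup-full zero)) })
    where
    S = SB (cD x)
    go : BlockKind (cD x) → lookup S zero ≡ true
    go (double′ _ all) = all zero
    go (alone′ _ q) = by-card (∑-pos (ind ∘ lookup S) (nonzero (card S) q))
      where
      nonzero : ∀ k → 1 ≤ 2 * k → 1 ≤ k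
      nonzero (suc k) _ = s≤s z≤n
      by-card : (∃ λ b → 1 ≤ ind (lookup S b)) → lookup S zero ≡ true
      by-card (zero , r) = 1≤ind⇒true r

  impossible : Fin m₁ → ⊥
  -- Rotating the cycle of d fixes all small parts, so d and β d lie in the same one. Being in the
  -- same block they are equal, which makes d special.
  impossible a = start-free a (end-special d (dart-ext same-part (β-block d)))
    where
    d : Dart
    d = start a
    apart : ¬ Orbit d (α d)
    apart = α-apart (free-moves {d} (start-free a)) (λ k q → free-φ^ k {d} (start-free a) (end-special (φ^ k d) q))
    module R = Rotations d apart
    same-part : proj₁ (β d) ≡ proj₁ d
    same-part = trans (cong proj₁ (sym (R.R.turn-ahead {d} (0 , refl))))
      (inj₁-injective (conclude R.rotation id id (λ _ → refl) (λ _ → refl) (λ x free p → contradiction (end-special x p) free) (inj₁ (a , zero))))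

flip₂ : Fin 2 → Fin 2
flip₂ zero       = suc zero
flip₂ (suc zero) = zero

flip₂-flip₂ : ∀ b → flip₂ (flip₂ b) ≡ b
flip₂-flip₂ zero       = refl
flip₂-flip₂ (suc zero) = refl

-- If the ends of some path carry the same label, reverse that path; otherwise reverse all paths and exchange the two large parts.
module TwoTight {m₁ n₂ : ℕ} (c : Vertex m₁ 3 2 n₂ → ℕ) (dist : IsDistinguishing (K m₁ 3 2 n₂) c)
  (tight : 2 * m₁ + 2 ≤ n₂) where
  open LinkedTight {m₂′ = 1} c dist refl tight

  label : Dart → Vec Bool 2
  label x = SB (cD x)

  End : Dart → Set
  End x = Free x × β x ≡ x

  end-ρ : ∀ {x} → End x → End (ρ x)
  end-ρ {x} (p , q) = Induced.f-free half-turn {x} p , trans (sym (ρ-β x)) (cong ρ q)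

  -- The label is not full, because x is free, and not empty, because 2|S| ≥ 2. So it is a single
  -- large part.
  one-label : ∀ {x} → End x → ∀ b → lookup (label x) (flip₂ b) ≡ not (lookup (label x) b)
  one-label {x} (free , p) = by-cases (lookup S zero) (lookup S (suc zero)) refl refl
    where
    S = label x
    single-part : card (XA (cD x)) ≡ 1
    single-part = β-fixed-alone {x} p
    not-full : ¬ (∀ b → lookup S b ≡ true)
    not-full all = free (special-intro x single-part (lookup-ext λ b → trans (all b) (sym (lookup-full b))))
    not-empty : ¬ (∀ b → lookup S b ≡ false)
    not-empty none = go (kind (proj₁ x) (proj₂ x))
      where
      go : ¬ BlockKind (cD x)
      go (double′ _ all) = case trans (sym (all zero)) (none zero) of λ ()
      go (alone′ _ q) = case subst (λ k → 2 ≤ 2 * k) (∑-zero (cong ind ∘ none)) q of λ ()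
    by-cases : ∀ u v → lookup S zero ≡ u → lookup S (suc zero) ≡ v → ∀ b → lookup S (flip₂ b) ≡ not (lookup S b)
    by-cases true  true  p q = ⊥-elim (not-full λ { zero → p ; (suc zero) → q })
    by-cases false false p q = ⊥-elim (not-empty λ { zero → p ; (suc zero) → q })
    by-cases true  false p q = λ { zero → trans q (cong not (sym p)) ; (suc zero) → trans p (cong not (sym q)) }
    by-cases false true  p q = λ { zero → trans q (cong not (sym p)) ; (suc zero) → trans p (cong not (sym q)) }

  opposite : ∀ {x y} → End x → End y → label y ≢ label x → ∀ b → lookup (label y) (flip₂ b) ≡ lookup (label x) b
  opposite {x} {y} ex ey ≢ = by-cases (lookup (label x) zero) (lookup (label y) zero) refl refl
    where
    at-1 : ∀ {z} → End z → lookup (label z) (suc zero) ≡ not (lookup (label z) zero)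
    at-1 {z} e = one-label {z} e zero
    same : lookup (label x) zero ≡ lookup (label y) zero → label y ≡ label x
    same p = lookup-ext λ { zero → sym p ; (suc zero) → trans (at-1 {y} ey) (trans (cong not (sym p)) (sym (at-1 {x} ex))) }
    differ : lookup (label y) zero ≡ not (lookup (label x) zero) → ∀ b → lookup (label y) (flip₂ b) ≡ lookup (label x) b
    differ p zero       = trans (at-1 {y} ey) (trans (cong not p) (Bool.not-involutive _))
    differ p (suc zero) = trans p (sym (at-1 {x} ex))
    by-cases : ∀ u v → lookup (label x) zero ≡ u → lookup (label y) zero ≡ v → ∀ b → lookup (label y) (flip₂ b) ≡ lookup (label x) b
    by-cases true  true  p q = contradiction (same (trans p (sym q))) ≢
    by-cases false false p q = contradiction (same (trans p (sym q))) ≢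
    by-cases true  false p q = differ (trans q (cong not (sym p)))
    by-cases false true  p q = differ (trans q (cong not (sym p)))

  Monochrome : Dart → Set
  Monochrome d = End d × label (ρ d) ≡ label d

  -- Reversing this path alone preserves all labels, so it fixes all small parts. Both ends then lie
  -- in one small part and have equal labels, hence are the same dart, against `ρ-moves`.
  no-monochrome-path : ∀ d → ¬ Monochrome d
  no-monochrome-path d (e@(free , fixed) , same) = ρ-moves {d} fixed (free-moves {d} free) (dart-ext part≡ block≡)
    where
    module H = HalfTurnAt d fixed
    κ = H.half-turn-at
    labels : ∀ x → Free x → β x ≡ x → ∀ b → lookup (label (H.turn x)) b ≡ lookup (label x) b
    labels x _ p b = cong (λ S → lookup S b) (go (orbit? d x))
      where
      go : Dec (Orbit d x) → label (H.turn x) ≡ label x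
      go (no ¬o) = cong label (H.turn-out ¬o)
      go (yes o) = trans (cong label (H.turn-in o)) (at-end (path-ends fixed p o))
        where
        at-end : x ≡ d ⊎ x ≡ ρ d → label (ρ x) ≡ label x
        at-end (inj₁ q) = subst (λ x → label (ρ x) ≡ label x) (sym q) same
        at-end (inj₂ q) = subst (λ x → label (ρ x) ≡ label x) (sym q) (trans (cong label (ρρ d)) (sym same))
    part≡ : proj₁ (ρ d) ≡ proj₁ d
    part≡ = trans (cong proj₁ (sym (H.turn-in (0 , refl)))) (trans (Induced.f-part κ {d} free)
      (inj₁-injective (conclude κ id id (λ _ → refl) (λ _ → refl) labels (inj₁ (proj₁ d , zero)))))
    alone-at : ∀ x → β x ≡ x → alone (cD x) ≡ true
    alone-at x p = dec-true (card (XA (cD x)) ≟ 1) (β-fixed-alone {x} p)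
    in-same : ∀ x y → proj₁ x ≡ proj₁ y → β x ≡ x → β y ≡ y → XA (cD x) ≡ XA (cD y)
    in-same (a , i) (.a , k) refl p q = same-alone {a} {i} {k} (alone-at (a , i) p) (alone-at (a , k) q)
    block≡ : cD (ρ d) ≡ cD d
    block≡ = block-ext (inj₁ (ρ d)) (inj₁ d) (cong₂ _,_ (in-same (ρ d) d part≡ (proj₂ (end-ρ {d} e)) fixed) same)

  impossible : Fin n₂ → ⊥
  impossible k = case conclude half-turn flip₂ flip₂ flip₂-flip₂ flip₂-flip₂ labels (inj₂ (zero , k)) of λ ()
    where
    labels : ∀ x → Free x → β x ≡ x → ∀ b → lookup (label (ρ x)) (flip₂ b) ≡ lookup (label x) b
    labels x p q = opposite {x} {ρ x} (p , q) (end-ρ {x} (p , q)) λ same → no-monochrome-path x ((p , q) , same)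

one-loose : ∀ {m₁ n₁ n₂} (c : Vertex m₁ n₁ 1 n₂ → ℕ) → IsDistinguishing (K m₁ n₁ 1 n₂) c → n₁ ≡ 3 → Fin m₁ → ¬ (2 * m₁ + 1 ≤ n₂)
one-loose c dist refl a tight = OneTight.impossible c dist tight a

two-loose : ∀ {m₁ n₁ n₂} (c : Vertex m₁ n₁ 2 n₂ → ℕ) → IsDistinguishing (K m₁ n₁ 2 n₂) c → n₁ ≡ 3 → Fin n₂ → ¬ (2 * m₁ + 2 ≤ n₂)
two-loose c dist refl k tight = TwoTight.impossible c dist tight k

non-existence : ∀ m₂′ {m₁ n₁ n₂} → n₁ ≡ 2 + Surplus.N m₂′ → 1 ≤ m₁ → 1 ≤ n₂ → HasDistinguishingPartition (K m₁ n₁ (suc m₂′) n₂) →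
  n₂ ≤ suc (Surplus.D m₂′) * m₁ + eps (suc m₂′)
non-existence m₂′ {m₁} {n₁} {n₂} n₁≡ 1≤m₁ 1≤n₂ (c , dist) = go (epsCase m₂′)
  where
  bound = suc (Surplus.D m₂′) * m₁

  unless-tight : ¬ (bound + 2 ^ m₂′ ≤ n₂) → eps (suc m₂′) ≡ 2 ^ m₂′ ∸ 1 → n₂ ≤ bound + eps (suc m₂′)
  unless-tight loose e = ≤-trans (s≤s⁻¹ (≤-trans (≰⇒> loose) (≤-reflexive (trans (cong (bound +_) (sym (m+[n∸m]≡n (m^n>0 2 m₂′)))) (+-suc bound _)))))
    (≤-reflexive (cong (bound +_) (sym e)))

  go : EpsCase m₂′ → n₂ ≤ bound + eps (suc m₂′)
  go (even p _ _ _ e)       = ≤-trans (Weights.upper-bound c dist n₁≡) (≤-reflexive (cong (bound +_) (sym e)))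
  go (odd zero refl _ e)    = unless-tight (one-loose c dist n₁≡ (fromℕ< 1≤m₁)) e
  go (odd (suc q) refl _ e) = unless-tight (λ tight → OddTight.impossible {p = suc q} c dist n₁≡ tight refl (fromℕ< 1≤n₂)) e
  go (two refl)             = unless-tight (two-loose c dist n₁≡ (fromℕ< 1≤n₂)) refl

-- Passage to the rational bound

open import Data.Integer using (+_)

absorption : ∀ n k → suc k * (suc n C suc k) ≡ suc n * (n C k)
absorption n zero = trans (+-identityʳ _) (trans (nC1≡n (suc n)) (sym (*-identityʳ (suc n))))
absorption zero (suc k) = trans (*-zeroʳ (suc (suc k))) refl
absorption (suc n) (suc k) = begin
  suc (suc k) * (suc (suc n) C suc (suc k))
    ≡⟨ cong (suc (suc k) *_) (sym (nCk+nC[k+1]≡[n+1]C[k+1] (suc n) (suc k))) ⟩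
  suc (suc k) * (suc n C suc k + suc n C suc (suc k))
    ≡⟨ split (suc k) (suc n C suc k) (suc n C suc (suc k)) ⟩
  suc n C suc k + (suc k * (suc n C suc k) + suc (suc k) * (suc n C suc (suc k)))
    ≡⟨ cong (λ z → suc n C suc k + z) (trans (cong₂ _+_ (absorption n k) (absorption n (suc k))) (sym (*-distribˡ-+ (suc n) (n C k) (n C suc k)))) ⟩
  suc n C suc k + suc n * (n C k + n C suc k)
    ≡⟨ cong (λ z → suc n C suc k + suc n * z) (nCk+nC[k+1]≡[n+1]C[k+1] n k) ⟩
  suc (suc n) * (suc n C suc k) ∎
  where
  open ≡-Reasoning
  split : ∀ k a b → suc k * (a + b) ≡ a + (k * a + suc k * b)
  split = solve-∀

-- This identity makes every summand of `rJK` an integer.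
complement-absorption : ∀ n k → k ≤ suc n → (suc n ∸ k) * (suc n C k) ≡ suc n * (n C k)
complement-absorption n zero    _ = refl
complement-absorption n (suc k) p = +-cancelˡ-≡ (suc k * (suc n C suc k)) _ _ (begin
  suc k * (suc n C suc k) + (suc n ∸ suc k) * (suc n C suc k)  ≡⟨ sym (*-distribʳ-+ (suc n C suc k) (suc k) (suc n ∸ suc k)) ⟩
  (suc k + (suc n ∸ suc k)) * (suc n C suc k)                 ≡⟨ cong₂ _*_ (m+[n∸m]≡n p) (sym (nCk+nC[k+1]≡[n+1]C[k+1] n k)) ⟩
  suc n * (n C k + n C suc k)                                 ≡⟨ *-distribˡ-+ (suc n) (n C k) (n C suc k) ⟩
  suc n * (n C k) + suc n * (n C suc k)                       ≡⟨ cong (_+ suc n * (n C suc k)) (sym (absorption n k)) ⟩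
  suc k * (suc n C suc k) + suc n * (n C suc k)               ∎)
  where open ≡-Reasoning

ι : ℕ → ℚ
ι n = (+ n) ℚ./ 1

ιᵘ : ∀ n → ℚ.toℚᵘ (ι n) ℚᵘ.≃ ℚᵘ.mkℚᵘ (+ n) 0
ιᵘ n = ℚ.toℚᵘ-fromℚᵘ (ℚᵘ.mkℚᵘ (+ n) 0)

ι-+ : ∀ a b → ι a ℚ.+ ι b ≡ ι (a + b)
ι-+ a b = ℚ.toℚᵘ-injective (ℚᵘ.≃-trans (ℚ.toℚᵘ-homo-+ (ι a) (ι b)) (ℚᵘ.≃-trans (ℚᵘ.+-cong (ιᵘ a) (ιᵘ b))
  (ℚᵘ.≃-trans (ℚᵘ.*≡* (cong (ℤ._* ℤ.1ℤ) (cong₂ ℤ._+_ (ℤ.*-identityʳ (+ a)) (ℤ.*-identityʳ (+ b))))) (ℚᵘ.≃-sym (ιᵘ (a + b))))))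

ι-* : ∀ a b → ι a ℚ.* ι b ≡ ι (a * b)
ι-* a b = ℚ.toℚᵘ-injective (ℚᵘ.≃-trans (ℚ.toℚᵘ-homo-* (ι a) (ι b)) (ℚᵘ.≃-trans (ℚᵘ.*-cong (ιᵘ a) (ιᵘ b))
  (ℚᵘ.≃-trans (ℚᵘ.*≡* (cong (ℤ._* ℤ.1ℤ) (sym (ℤ.pos-* a b)))) (ℚᵘ.≃-sym (ιᵘ (a * b))))))

ι-mono-≤ : ∀ {a b} → a ≤ b → ι a ℚ.≤ ι b
ι-mono-≤ {a} {b} p = ℚ.toℚᵘ-cancel-≤ (ℚᵘ.≤-trans (ℚᵘ.≤-reflexive (ιᵘ a)) (ℚᵘ.≤-trans
  (ℚᵘ.*≤* (subst₂ ℤ._≤_ (sym (ℤ.*-identityʳ (+ a))) (sym (ℤ.*-identityʳ (+ b))) (ℤ.+≤+ p))) (ℚᵘ.≤-reflexive (ℚᵘ.≃-sym (ιᵘ b)))))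

ι-cancel-≤ : ∀ {a b} → ι a ℚ.≤ ι b → a ≤ b
ι-cancel-≤ {a} {b} p = unwrap (ℚᵘ.≤-trans (ℚᵘ.≤-reflexive (ℚᵘ.≃-sym (ιᵘ a))) (ℚᵘ.≤-trans (ℚ.toℚᵘ-mono-≤ p) (ℚᵘ.≤-reflexive (ιᵘ b))))
  where
  unwrap : ℚᵘ.mkℚᵘ (+ a) 0 ℚᵘ.≤ ℚᵘ.mkℚᵘ (+ b) 0 → a ≤ b
  unwrap (ℚᵘ.*≤* q) = ℤ.drop‿+≤+ (subst₂ ℤ._≤_ (ℤ.*-identityʳ (+ a)) (ℤ.*-identityʳ (+ b)) q)

frac-multiple : ∀ m x → frac (suc m * x) (suc m) ≡ ι x
frac-multiple m x = ℚ.fromℚᵘ-cong {ℚᵘ.mkℚᵘ (+ (suc m * x)) m} {ℚᵘ.mkℚᵘ (+ x) 0}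
  (ℚᵘ.*≡* (trans (ℤ.*-identityʳ (+ (suc m * x))) (trans (cong +_ (*-comm (suc m) x)) (ℤ.pos-* x (suc m)))))

sumToℚ-ι : ∀ (f : ℕ → ℚ) (g : ℕ → ℕ) j → (∀ i → i ≤ j → f i ≡ ι (g i)) → sumToℚ f j ≡ ι (sumTo g j)
sumToℚ-ι f g zero    p = p 0 z≤n
sumToℚ-ι f g (suc j) p = trans (cong₂ ℚ._+_ (sumToℚ-ι f g j λ i q → p i (≤-trans q (n≤1+n j))) (p (suc j) ≤-refl)) (ι-+ (sumTo g j) (g (suc j)))

rJK-ι : ∀ m → rJK (suc m) (jmax (suc m)) 0 ≡ ι (suc (sumTo (m C_) (jmax (suc m))))
rJK-ι m = trans (cong₂ ℚ._+_ (trans (cong (ℚ.1ℚ ℚ.+_) (sumToℚ-ι _ (m C_) j λ i p →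
    trans (cong (λ z → frac z (suc m)) (complement-absorption m i (≤-trans p (≤-trans (DivMod.m/n≤m m 2) (n≤1+n m))))) (frac-multiple m (m C i)))) (ι-+ 1 (sumTo (m C_) j)))
    -- At j = `jmax` the test j + 1 ≤ `jmax` fails, and the last term is k/2 with k = 0.
    (cong (λ b → if b then frac ((suc m ∸ j ∸ 1) * 0) (suc m) else frac 0 2) (dec-false (j <? j) (<-irrefl refl))))
  (ℚ.+-identityʳ (ι (suc (sumTo (m C_) j))))
  where
  j = jmax (suc m)

bound-ι : ∀ m m₁ → rJK (suc m) (jmax (suc m)) 0 ℚ.* ι m₁ ℚ.+ ι (eps (suc m)) ≡ ι (suc (sumTo (m C_) (jmax (suc m))) * m₁ + eps (suc m))
bound-ι m m₁ = trans (cong (λ r → r ℚ.* ι m₁ ℚ.+ ι (eps (suc m))) (rJK-ι m))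
  (trans (cong (ℚ._+ ι (eps (suc m))) (ι-* (suc (sumTo (m C_) (jmax (suc m)))) m₁)) (ι-+ (suc (sumTo (m C_) (jmax (suc m))) * m₁) (eps (suc m))))

theorem1p5 : (n₁ m₂ : ℕ) → n₁ ≥ 3 → m₂ ≥ 1 → IsJK n₁ m₂ (jmax m₂) 0 →
    Σ ℕ (λ M → (m₁ n₂ : ℕ) → m₁ ≥ M → n₂ ≥ 1 →
    HasDistinguishingPartition (K m₁ n₁ m₂ n₂)
    ⇔ (((+ n₂) ℚ./ 1) ℚ.≤ rJK m₂ (jmax m₂) 0 ℚ.* ((+ m₁) ℚ./ 1) ℚ.+ ((+ eps m₂) ℚ./ 1)))
theorem1p5 n₁ (suc m) _ _ (n₁≡ , _) = Existence.threshold m , λ m₁ n₂ large n₂≥1 → mk⇔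
  (λ P → subst (ι n₂ ℚ.≤_) (sym (bound-ι m m₁)) (ι-mono-≤ (non-existence m n₁≡′ (≤-trans (s≤s z≤n) large) n₂≥1 P)))
  (λ le → subst (λ n → HasDistinguishingPartition (K m₁ n (suc m) n₂)) (sym n₁≡′)
    (existence m large n₂≥1 (ι-cancel-≤ (subst (ι n₂ ℚ.≤_) (bound-ι m m₁) le))))
  where
  n₁≡′ : n₁ ≡ 2 + sumTo (suc m C_) (jmax (suc m))
  n₁≡′ = trans n₁≡ (+-identityʳ _)
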